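{- For any partitions $\mu,\nu$ and any $n,m\ge1$, $$\sum_\lambda\widetilde{\mathsf F}^*_{\lambda'/\nu'}(u_1,\dots,u_m\mid\Xi,\mathsf{S})\,\mathbb{F}_{\lambda/\mu}(\kappa_1,\dots,\kappa_n\mid\Xi,\mathsf{S})$$ $$=\prod_{i=1}^n\prod_{j=1}^m\frac{1-u_j\kappa_i}{1-u_j\xi_is_i}\ \sum_{\lambda}\mathbb{F}_{\nu/\lambda}(\kappa_1,\dots,\kappa_n\mid\Xi,\mathsf{S})\,\widetilde{\mathsf F}^*_{\mu'/\lambda'}(u_1,\dots,u_m\mid\tau^n_{\mathsf{S}}\Xi,\tau^n_{\Xi}\mathsf{S}),$$ where both sums are over all partitions $\lambda$ and each has only finitely many nonzero terms.
   Context: Fix a generic parameter $q$, and write $(x;q)_n:=\prod_{i=1}^n(1-xq^{i-1})$, $(x;q)_0:=1$. A partition is a weakly decreasing sequence $\lambda=(\lambda_1\ge\lambda_2\ge\dots\ge0)$ of nonnegative integers with finitely many nonzero entries; $l(\lambda)$ is the number of nonzero parts and $\lambda'$ is the conjugate partition, so the number of parts of $\lambda'$ equal to $j$ is $m_j(\lambda')=\lambda_j-\lambda_{j+1}$. Let $\Xi=(\xi_0,\xi_1,\dots)$ and $\mathsf{S}=(s_0,s_1,\dots)$ be sequences of generic parameters, with fixed square roots $\sqrt{\xi_i},\sqrt{s_i}$. For $k\ge0$ put $\xi_i^{(k)}:=\sqrt{\xi_{i+k}s_{i+k}\xi_i/s_i}$, $s_i^{(k)}:=\sqrt{s_{i+k}\xi_{i+k}s_i/\xi_i}$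 (formed from the fixed roots), $\tau^k_{\mathsf{S}}\Xi:=(\xi^{(k)}_0,\xi^{(k)}_1,\dots)$, $\tau^k_{\Xi}\mathsf{S}:=(s^{(k)}_0,s^{(k)}_1,\dots)$. Put $\mathsf{c}_{\mathsf{S}}(\lambda):=\prod_{i\ge1}\frac{(s_i^2;q)_{\lambda_i-\lambda_{i+1}}}{(q;q)_{\lambda_i-\lambda_{i+1}}}$, $(-\mathsf{S})^\lambda:=\prod_{i\ge1}(-s_{i-1})^{\lambda_i}$ (likewise for other sequences in place of $\mathsf S$). Functions $\mathbb{F}_{\lambda/\mu}$. For $i,j,k,l\in\mathbb{Z}_{\ge0}$ (labels of the bottom, left, top, right edge) let $$W_{t,s}(i,j;k,l):=\mathbf{1}_{i+j=k+l}\,\mathbf{1}_{i\ge l}\,(s^2/t^2)^{l}\frac{(s^2/t^2;q)_{i-l}(t^2;q)_l}{(s^2;q)_i}\frac{(q;q)_i}{(q;q)_{i-l}(q;q)_l}.$$ For $a_1,\dots,a_n\in\mathbb{Z}_{\ge0}$ and $L>l(\lambda),l(\mu)$, $$ZW^{(a_1,\dots,a_n)}_{\lambda/\mu}(\kappa_1,\dots,\kappa_n\mid\Xi,\mathsf{S}):=\sum\prod_{r=1}^n\prod_{c=1}^L W_{t_{r,c},\,s^{(r)}_c}(v_{r,c},h_{r,c-1};v_{r-1,c},h_{r,c}),\qquad t_{r,c}^2=\frac{\xi_{r+c}s_{r+c}}{\kappa_r},$$ the sum being over all nonnegative integers $v_{r,c}$ ($0\le r\le n$, $1\le c\le L$)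 and $h_{r,c}$ ($1\le r\le n$, $0\le c\le L$) with $v_{0,c}=m_c(\lambda')$, $v_{n,c}=m_c(\mu')$, $h_{r,0}=a_r$, $h_{r,L}=0$ (independent of $L$). Then $$\mathbb{F}_{\lambda/\mu}(\kappa_1,\dots,\kappa_n\mid\Xi,\mathsf{S}):=\frac{(-\tau^n_\Xi\mathsf{S})^{\mu}}{(-\mathsf{S})^{\lambda}}\frac{\mathsf{c}_{\tau^n_\Xi\mathsf{S}}(\mu)}{\mathsf{c}_{\mathsf{S}}(\lambda)}\sum_{a_1+\dots+a_n=\lambda_1-\mu_1}\Bigl(\prod_{i=1}^n(\kappa_is_0/\xi_0)^{a_i}\frac{(\kappa_i^{ -1}s_i\xi_i;q)_{a_i}}{(q;q)_{a_i}}\Bigr)ZW^{(a_1,\dots,a_n)}_{\lambda/\mu}(\kappa_1,\dots,\kappa_n\mid\Xi,\mathsf{S}).$$ Functions $\widetilde{\mathsf F}^*_{\lambda'/\mu'}$. For $g\in\mathbb{Z}_{\ge0}$ let $w_{u;s}(i,j;k,l)$ ($i,k\in\mathbb{Z}_{\ge0}$ bottom and top labels, $j,l\in\{0,1\}$ left and right labels) be $$w_{u;s}(g,0;g,0)=\frac{1-suq^g}{1-su},\quad w_{u;s}(g,0;g-1,1)=\frac{(q^g-1)su}{1-su},\quad w_{u;s}(g,1;g+1,0)=\frac{1-s^2q^g}{1-su},\quad w_{u;s}(g,1;g,1)=\frac{s^2q^g-su}{1-su},$$ and $0$ otherwise. For $a_1,\dots,a_m\in\{0,1\}$ and $L>l(\lambda),l(\mu)$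 let $$Zw^{(a_1,\dots,a_m)}_{\lambda/\mu}(u_1,\dots,u_m\mid\Xi,\mathsf{S}):=\sum\prod_{r=1}^m\prod_{c=1}^L w_{u_r\xi_c;\,s_c}(v_{r,c},h_{r,c-1};v_{r-1,c},h_{r,c}),$$ the sum being over $v_{r,c}\in\mathbb{Z}_{\ge0}$, $h_{r,c}\in\{0,1\}$ with $v_{0,c}=m_c(\lambda')$, $v_{m,c}=m_c(\mu')$, $h_{r,0}=a_r$, $h_{r,L}=0$ (independent of $L$). Set $$\widetilde{\mathsf F}_{\lambda'/\mu'}(u_1,\dots,u_m\mid\Xi,\mathsf{S}):=\frac{(-\mathsf{S})^\mu}{(-\mathsf{S})^\lambda}\frac{\mathsf{c}_{\mathsf{S}}(\mu)}{\mathsf{c}_{\mathsf{S}}(\lambda)}\sum_{a_1,\dots,a_m\in\{0,1\}}\Bigl(\prod_{i=1}^m(-u_i\xi_0s_0)^{a_i}\Bigr)Zw^{(a_1,\dots,a_m)}_{\lambda/\mu}(u_1,\dots,u_m\mid\Xi,\mathsf{S}),$$ $$\widetilde{\mathsf F}^*_{\lambda'/\mu'}(u_1,\dots,u_m\mid\Xi,\mathsf{S}):=\frac{\mathsf{c}_{\mathsf{S}}(\lambda)}{\mathsf{c}_{\mathsf{S}}(\mu)}\,\widetilde{\mathsf F}_{\lambda'/\mu'}(u_1,\dots,u_m\mid\Xi,\mathsf{S}).$$ -}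

module Defs where

open import Algebra.Apartness.Bundles using (HeytingField)
open import Algebra.Bundles using (CommutativeRing; Semiring)
open import Algebra.Core using (Op₁)
import Algebra.Definitions.RawSemiring
open import Data.Bool.Base using (if_then_else_; _∧_)
open import Data.Fin.Base using (Fin; toℕ; inject₁)
open import Data.List.Base as List
  using (List; []; _∷_; length; foldr; upTo; filter; cartesianProduct; cartesianProductWith)
open import Data.List.Membership.Propositional using (_∉_)
open import Data.List.Relation.Unary.All using (All)
open import Data.List.Relation.Unary.Linked using (Linked)
open import Data.List.Relation.Unary.Unique.Propositional using (Unique)
open import Data.Nat.Base as ℕ using (ℕ; zero; suc; _∸_; _⊔_; _≥_)
import Data.Nat.Properties as ℕ
open import Data.Product.Base using (_×_; _,_)
open import Data.Vec.Base as Vec using (Vec; lookup; tabulate; replicate)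
import Data.Vec.Functional as Functional
import Data.Vec.Properties as Vec
open import Function.Base using (_∘_)
import Level
open import Relation.Binary.PropositionalEquality.Core using (_≡_)
open import Relation.Nullary.Decidable using (Dec; does; _×-dec_)

-- The library's notion of field, together with a total reciprocal whose value
-- is only constrained on elements apart from zero.
record Field c ℓ₁ ℓ₂ : Set (Level.suc (c Level.⊔ ℓ₁ Level.⊔ ℓ₂)) where
  infix 8 _⁻¹
  infixl 7 _/_
  field
    heytingField : HeytingField c ℓ₁ ℓ₂
  open HeytingField heytingField public
  field
    _⁻¹        : Op₁ Carrier
    ⁻¹-cong    : ∀ {x y} → x ≈ y → x ⁻¹ ≈ y ⁻¹
    ⁻¹-inverse : ∀ {x} → x # 0# → x * x ⁻¹ ≈ 1#

  commutativeRing : CommutativeRing c ℓ₁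
  commutativeRing = record { isCommutativeRing = isCommutativeRing }

  _/_ : Carrier → Carrier → Carrier
  x / y = x * y ⁻¹

  open Algebra.Definitions.RawSemiring
    (Semiring.rawSemiring (CommutativeRing.semiring commutativeRing)) public
    using (_^_; product)

-- A partition is given by its nonzero entries.  The proofs are irrelevant, so
-- partitions with the same entries are propositionally equal.
record Partition : Set where
  constructor partition
  field
    parts       : List ℕ
    .decreasing : Linked _≥_ parts
    .positive   : All (0 ℕ.<_) parts

open Partition public using (parts)

ℓ : Partition → ℕ
ℓ ƛ = length (parts ƛ)

entry : List ℕ → ℕ → ℕ
entry []       _       = 0
entry (x ∷ _)  zero    = x
entry (_ ∷ xs) (suc i) = entry xs i

-- Indices are shifted by one: part ƛ i is λᵢ₊₁.
part : Partition → ℕ → ℕ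
part ƛ = entry (parts ƛ)

-- conjMult ƛ j is mⱼ₊₁(λ′) = λⱼ₊₁ − λⱼ₊₂.
conjMult : Partition → ℕ → ℕ
conjMult ƛ j = part ƛ j ∸ part ƛ (suc j)

words : ∀ {a} {A : Set a} → List A → (n : ℕ) → List (Vec A n)
words xs zero    = Vec.[] ∷ []
words xs (suc n) = cartesianProductWith Vec._∷_ xs (words xs n)

arrays : ∀ {a} {A : Set a} → List A → (m n : ℕ) → List (Vec (Vec A n) m)
arrays xs m n = words (words xs n) m

-- Edge labels of a lattice with n rows and L columns: v has rows 0,…,n and
-- columns 1,…,L, and h has rows 1,…,n and columns 0,…,L.
Boundary : ∀ {n L} (top bottom : Vec ℕ L) (left : Vec ℕ n) →
           Vec (Vec ℕ L) (suc n) × Vec (Vec ℕ (suc L)) n → Set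
Boundary {n} top bottom left (v , h) =
  Vec.head v ≡ top × Vec.last v ≡ bottom ×
  Vec.map Vec.head h ≡ left × Vec.map Vec.last h ≡ replicate n 0

boundary? : ∀ {n L} (top bottom : Vec ℕ L) (left : Vec ℕ n) →
            ∀ vh → Dec (Boundary top bottom left vh)
boundary? top bottom left (v , h) =
  Vec.≡-dec ℕ._≟_ _ _ ×-dec Vec.≡-dec ℕ._≟_ _ _ ×-dec
  Vec.≡-dec ℕ._≟_ _ _ ×-dec Vec.≡-dec ℕ._≟_ _ _

module Functions {c ℓ₁ ℓ₂} (K : Field c ℓ₁ ℓ₂) (q : Field.Carrier K) where

  open Field K

  Seq : Set c
  Seq = ℕ → Carrier

  Vector : ℕ → Set c
  Vector = Functional.Vector Carrier

  ∑ : ∀ {a} {A : Set a} → List A → (A → Carrier) → Carrier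
  ∑ xs f = foldr (λ x acc → f x + acc) 0# xs

  ∏ : ∀ n → (Fin n → Carrier) → Carrier
  ∏ n f = product {n} f

  infix 5 ∑ ∏
  syntax ∑ xs (λ x → e) = ∑[ x ∈ xs ] e
  syntax ∏ n (λ i → e) = ∏[ i < n ] e

  -- A is the sum of a family that is zero off a finite set of indices.
  record IsFiniteSum {a} {I : Set a} (f : I → Carrier) (A : Carrier) : Set (a Level.⊔ ℓ₁) where
    field
      support  : List I
      unique   : Unique support
      vanishes : ∀ i → i ∉ support → f i ≈ 0#
      total    : ∑ support f ≈ A

  -- (x;q)ₙ
  poch : Carrier → ℕ → Carrier
  poch x n = ∏[ i < n ] (1# - x * q ^ toℕ i)

  square : Seq → Seq
  square x i = x i * x i

  -- τᵏ_S Ξ and τᵏ_Ξ S, in terms of the chosen square roots of the entries of Ξ and S.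
  τΞ τS : ℕ → (√Ξ √S : Seq) → Seq
  τΞ k √Ξ √S i = √Ξ (i ℕ.+ k) * √S (i ℕ.+ k) * √Ξ i / √S i
  τS k √Ξ √S i = √S (i ℕ.+ k) * √Ξ (i ℕ.+ k) * √S i / √Ξ i

  -- c_S(λ); the factors with index beyond l(λ) are 1.
  𝖼 : Seq → Partition → Carrier
  𝖼 S ƛ = ∏[ i < ℓ ƛ ]
    (poch (S (suc (toℕ i)) ^ 2) (conjMult ƛ (toℕ i)) / poch q (conjMult ƛ (toℕ i)))

  -- (−S)^λ
  negPow : Seq → Partition → Carrier
  negPow S ƛ = ∏[ i < ℓ ƛ ] ((- S (toℕ i)) ^ part ƛ (toℕ i))

  -- Partition function with vertical labels from vs and horizontal labels from
  -- hs; weight r c i j k l is the weight of the vertex in row r and column c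
  -- (both counted from 1) with bottom, left, top and right labels i, j, k, l.
  latticeSum : ∀ {n L} (vs hs : List ℕ) (top bottom : Vec ℕ L) (left : Vec ℕ n) →
               (Fin n → ℕ → ℕ → ℕ → ℕ → ℕ → Carrier) → Carrier
  latticeSum {n} {L} vs hs top bottom left weight =
    ∑ (filter (boundary? top bottom left)
              (cartesianProduct (arrays vs (suc n) L) (arrays hs n (suc L))))
      λ (v , h) → ∏[ r < n ] ∏[ c < L ]
        weight r (suc (toℕ c))
          (lookup (lookup v (Fin.suc r)) c)
          (lookup (lookup h r) (inject₁ c))
          (lookup (lookup v (inject₁ r)) c)
          (lookup (lookup h r) (Fin.suc c))

  -- Any number of columns above l(λ) and l(μ) gives the same partition function.
  columns : (ƛ μ : Partition) → ℕ
  columns ƛ μ = suc (ℓ ƛ ⊔ ℓ μ)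

  column-labels : (ƛ : Partition) (L : ℕ) → Vec ℕ L
  column-labels ƛ L = tabulate (conjMult ƛ ∘ toℕ)

  -- W_{t,s}(i,j;k,l) as a function of t² and s²; t itself need not lie in K.
  W : (t² s² : Carrier) (i j k l : ℕ) → Carrier
  W t² s² i j k l =
    if does (i ℕ.+ j ℕ.≟ k ℕ.+ l) ∧ does (l ℕ.≤? i)
    then (s² / t²) ^ l
         * ((poch (s² / t²) (i ∸ l) * poch t² l) / poch s² i)
         * (poch q i / (poch q (i ∸ l) * poch q l))
    else 0#

  -- The sum over all nonnegative labels reduces to labels at most λ₁: in a term
  -- with nonzero weights, adding i + j = k + l along row r gives
  -- aᵣ + ∑_c v_{r,c} = ∑_c v_{r−1,c}, and ∑_c v_{0,c} = λ₁, while l ≤ i bounds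
  -- the horizontal labels by vertical ones.
  ZW : ∀ {n} → Vec ℕ n → (ƛ μ : Partition) → Vector n → (√Ξ √S : Seq) → Carrier
  ZW a ƛ μ κ √Ξ √S =
    latticeSum labels labels (column-labels ƛ L) (column-labels μ L) a
      λ r c → W ((Ξ (suc (toℕ r) ℕ.+ c) * S (suc (toℕ r) ℕ.+ c)) / κ r)
                (τS (suc (toℕ r)) √Ξ √S c ^ 2)
    where
    L = columns ƛ μ
    labels = upTo (suc (part ƛ 0))
    Ξ = square √Ξ
    S = square √S

  -- 𝔽_{λ/μ}(κ | Ξ, S), where Ξ and S are the squares of √Ξ and √S.  The
  -- condition on a is ∑ aᵢ = λ₁ − μ₁ in ℤ, so that the sum is empty if λ₁ < μ₁.
  𝔽 : ∀ {n} (ƛ μ : Partition) → Vector n → (√Ξ √S : Seq) → Carrier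
  𝔽 {n} ƛ μ κ √Ξ √S =
    negPow Sₙ μ / negPow S ƛ * (𝖼 Sₙ μ / 𝖼 S ƛ)
    * (∑[ a ∈ filter (λ a → Vec.sum a ℕ.+ part μ 0 ℕ.≟ part ƛ 0)
                     (words (upTo (suc (part ƛ 0))) n) ]
         (∏[ i < n ] ((κ i * S 0 / Ξ 0) ^ lookup a i
           * (poch (κ i ⁻¹ * S (suc (toℕ i)) * Ξ (suc (toℕ i))) (lookup a i)
              / poch q (lookup a i))))
         * ZW a ƛ μ κ √Ξ √S)
    where
    Ξ = square √Ξ
    S = square √S
    Sₙ = τS n √Ξ √S

  -- w_{u;s}(i,j;k,l)
  w : (u s : Carrier) (i j k l : ℕ) → Carrier
  w u s g j k l =
    if does (g ℕ.+ j ℕ.≟ k ℕ.+ l) then (numerator j l / (1# - s * u)) else 0#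
    where
    numerator : ℕ → ℕ → Carrier
    numerator 0 0 = 1# - s * u * q ^ g
    numerator 0 1 = (q ^ g - 1#) * (s * u)
    numerator 1 0 = 1# - s ^ 2 * q ^ g
    numerator 1 1 = s ^ 2 * q ^ g - s * u
    numerator _ _ = 0#

  bits : List ℕ
  bits = 0 ∷ 1 ∷ []

  -- Vertical labels above λ₁ do not contribute, as for ZW.
  Zw : ∀ {m} → Vec ℕ m → (ƛ μ : Partition) → Vector m → (Ξ S : Seq) → Carrier
  Zw a ƛ μ u Ξ S =
    latticeSum (upTo (suc (part ƛ 0))) bits (column-labels ƛ L) (column-labels μ L) a
      λ r c → w (u r * Ξ c) (S c)
    where
    L = columns ƛ μ

  -- F~ ƛ μ and F~* ƛ μ are the functions indexed by the conjugates λ′/μ′.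
  F~ F~* : ∀ {m} (ƛ μ : Partition) → Vector m → (Ξ S : Seq) → Carrier
  F~ {m} ƛ μ u Ξ S =
    negPow S μ / negPow S ƛ * (𝖼 S μ / 𝖼 S ƛ)
    * (∑[ a ∈ words bits m ]
         (∏[ i < m ] ((- (u i * Ξ 0 * S 0)) ^ lookup a i))
         * Zw a ƛ μ u Ξ S)
  F~* ƛ μ u Ξ S = 𝖼 S ƛ / 𝖼 S μ * F~ ƛ μ u Ξ S

  -- The parameters avoid the zeros of the denominators in 𝔽, F~* and the
  -- Cauchy kernel, and q is nonzero.
  record Generic {n m} (κ : Vector n) (u : Vector m) (√Ξ √S : Seq) : Set ℓ₂ where
    field
      q#0          : q # 0#
      qᵏ#1         : ∀ k → q ^ suc k # 1#
      √ξ#0         : ∀ i → √Ξ i # 0#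
      √s#0         : ∀ i → √S i # 0#
      s²qᵏ#1       : ∀ i k → square √S (suc i) ^ 2 * q ^ k # 1#
      shift-s²qᵏ#1 : ∀ r i k → τS r √Ξ √S (suc i) ^ 2 * q ^ k # 1#
      κ#0          : ∀ i → κ i # 0#
      uξs#1        : ∀ j i → u j * square √Ξ (suc i) * square √S (suc i) # 1#

-- All sums over partitions become sums over the vectors of multiplicities of the
-- conjugates, and the functions become products of one-row transfer kernels.  Put
-- p_c = ξ_c s_c.  Conjugating by c_S(λ) and the square of (−S)^λ turns the weights w
-- into weights ŵ with numerators
--   (g,0;g,0): 1 − U q^g           (g,0;g−1,1): −(y − U q^(g−1))
--   (g,1;g+1,0): 1 − q^(g+1)       (g,1;g,1): q^g − y
-- and denominator 1 − U, where U = u p_c and y = u ξ_c / s_c, so that both sides of the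
-- identity are entries of products of the same two kinds of kernels in opposite orders.
-- The kernels of a single ŵ-row and a single W-row are exchanged by a cross vertex R with
-- ingoing and outgoing pairs of horizontal labels (a, j), (a′, j′), a − j = a′ − j′,
--   (a,0;a,0): 1 − Ω q^a           (a,0;a+1,1): −(v − Ω q^a)
--   (a,1;a−1,0): 1 − q^a           (a,1;a,1): q^a − v
-- with Ω = u p_c and v = u κ: by a Yang–Baxter equation R passes through a column while
-- p_c is replaced by p_(c+1), it is trivial at the right end of the lattice, and the left
-- boundary weights are an eigenvector with eigenvalue 1 − u κ, against the
-- normalisation 1 − u p_1 of R.  The general case follows by moving m ŵ-rows through n W-rows.

module Submission where

open import Defs
open import Algebra.Apartness.Bundles using (HeytingField)
import Algebra.Apartness.Properties.HeytingCommutativeRing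
open import Algebra.Bundles using (CommutativeRing)
import Algebra.Properties.CommutativeSemiring.Exp
import Algebra.Properties.Ring
import Algebra.Properties.Semiring.Exp
import Algebra.Properties.Semiring.Mult.TCOptimised
import Algebra.Solver.Ring
open import Algebra.Solver.Ring.AlmostCommutativeRing
  using (AlmostCommutativeRing; fromCommutativeRing; _-Raw-AlmostCommutative⟶_; -raw-almostCommutative⟶)
open import Data.Bool.Base using (if_then_else_; _∧_)
open import Data.Empty using (⊥)
open import Data.Fin.Base as Fin using (Fin; toℕ; inject₁)
open import Data.Integer.Base as ℤ using (ℤ; +_; -[1+_]; _⊖_)
import Data.Integer.Properties as ℤ
open import Data.List.Base as List
  using (List; []; _∷_; _++_; length; filter; upTo; cartesianProduct; cartesianProductWith)
import Data.List.Membership.DecPropositional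
open import Data.List.Membership.Propositional using (_∈_; _∉_)
open import Data.List.Membership.Propositional.Properties
  using (∈-cartesianProductWith⁺; ∈-cartesianProductWith⁻; ∈-upTo⁺; ∈-upTo⁻; ∈-map⁺; ∈-map⁻)
open import Data.List.Relation.Unary.All as All using (All; []; _∷_)
open import Data.List.Relation.Unary.AllPairs using ([]; _∷_)
open import Data.List.Relation.Unary.Any using (here; there)
open import Data.List.Relation.Unary.Linked as Linked using (Linked; []; [-]; _∷_)
open import Data.List.Relation.Unary.Unique.Propositional using (Unique)
import Data.List.Relation.Unary.Unique.Propositional.Properties as Unique
open import Data.Maybe.Base using (Maybe; just; nothing)
open import Data.Nat.Base as ℕ using (ℕ; zero; suc; pred; _∸_; _⊔_; _≤_; _<_; _≥_; z≤n; s≤s)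
import Data.Nat.Properties as ℕ
import Data.Nat.Solver
open import Data.Product.Base using (_×_; _,_; proj₁; proj₂; ∃; ∃₂)
open import Data.Sum.Base as Sum using (_⊎_; inj₁; inj₂)
open import Data.Unit.Base using (⊤; tt)
open import Data.Vec.Base as Vec using (Vec; []; _∷_; _∷ʳ_; lookup; sum; tabulate; replicate; allFin)
open import Data.Vec.N-ary using (N-ary; _$ⁿ_)
import Data.Vec.Properties as Vec
open import Data.Vec.Relation.Binary.Pointwise.Inductive as Pointwise using (Pointwise; []; _∷_)
import Data.Vec.Relation.Unary.All as VecAll
open import Function.Base using (_∘_)
import Level
open import Relation.Binary.Definitions using (DecidableEquality)
open import Relation.Binary.PropositionalEquality as ≡ using (_≡_; _≢_)
open import Relation.Nullary.Decidable using (Dec; yes; no; does; recompute; _×-dec_)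
open import Relation.Nullary.Negation using (¬_; contradiction)
open import Relation.Unary using (Pred; Decidable)

-- The cross vertex is not trivial at the right end for every pair of labels: if the W-row ended
-- there with label 1 and the w-row with bit 1, a term 1 - q would be left over. A W-vertex sends no
-- more to the right than it has below, so this is excluded as soon as the last bottom label is
-- zero. A W-row lengthens a partition by at most one part; hence l(μ) + n columns keep the last
-- label zero at every one of the exchanges. The sums over partitions become sums over finite boxes
-- of vectors. Rows only shrink a partition from top to bottom, a w-row changes the first part by at
-- most one, and a W-row changes the length by at most one; these bounds give the finite supports
-- and show that the size of the box is immaterial. The shifts by τ on the right-hand side come from
-- the replacement of p_c by p_(c+1) in each exchange: τ^k keeps ξ/s, on which y depends, and turns
-- the product ξ_i s_i into p_(i+k), on which U depends.

private module ℕS = Data.Nat.Solver.+-*-Solver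


-- Field arithmetic and a ring solver with integer coefficients

module FieldProperties {c ℓ₁ ℓ₂} (K : Field c ℓ₁ ℓ₂) where

  open Field K hiding (zero)
  open CommutativeRing commutativeRing using (ring; semiring)
  open import Relation.Binary.Reasoning.Setoid setoid
  open Algebra.Apartness.Properties.HeytingCommutativeRing
    (HeytingField.heytingCommutativeRing heytingField) public
    using (x-0≈x; 1#0; #-congʳ; #-congˡ; invertibleʳ⇒#)
    renaming (x#0y#0→xy#0 to x*y#0)

  private
    module Mult = Algebra.Properties.Semiring.Mult.TCOptimised semiring
    open Mult using () renaming (_×_ to _×ᶜ_)
    module R = Algebra.Properties.Ring ring
    module Exp = Algebra.Properties.Semiring.Exp semiring

    acr : AlmostCommutativeRing c ℓ₁
    acr = fromCommutativeRing commutativeRing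

    -- Equality of coefficients from the field is not decided, so this solver does not recognise
    -- coefficients that cancel. It serves to show that the integers map homomorphically into the
    -- field, which gives a solver with decidable coefficients.
    module Free = Algebra.Solver.Ring
      (AlmostCommutativeRing.rawRing acr) acr (-raw-almostCommutative⟶ acr) (λ _ _ → nothing)

    ⟦_⟧ᶻ : ℤ → Carrier
    ⟦ + n ⟧ᶻ      = n ×ᶜ 1#
    ⟦ -[1+ n ] ⟧ᶻ = - (suc n ×ᶜ 1#)

    ⟦⊖⟧ : ∀ m n → ⟦ m ⊖ n ⟧ᶻ ≈ m ×ᶜ 1# - n ×ᶜ 1#
    ⟦⊖⟧ m       ℕ.zero  = trans (reflexive (≡.cong ⟦_⟧ᶻ (ℤ.⊖-≥ {m} ℕ.z≤n)))
                                (sym (x-0≈x _))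
    ⟦⊖⟧ ℕ.zero  (suc n) = sym (+-identityˡ _)
    ⟦⊖⟧ (suc m) (suc n) = begin
      ⟦ suc m ⊖ suc n ⟧ᶻ            ≡⟨ ≡.cong ⟦_⟧ᶻ (ℤ.[1+m]⊖[1+n]≡m⊖n m n) ⟩
      ⟦ m ⊖ n ⟧ᶻ                    ≈⟨ ⟦⊖⟧ m n ⟩
      m ×ᶜ 1# - n ×ᶜ 1#               ≈⟨ +-congˡ (sym (+-identityˡ _)) ⟩
      m ×ᶜ 1# + (0# - n ×ᶜ 1#)        ≈⟨ +-congˡ (+-congʳ (sym (-‿inverseʳ 1#))) ⟩
      m ×ᶜ 1# + (1# - 1# - n ×ᶜ 1#)
        ≈⟨ Free.solve 3 (λ o m n → m Free.:+ (o Free.:- o Free.:- n)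
                              Free.:= (o Free.:+ m) Free.:- (o Free.:+ n)) refl 1# (m ×ᶜ 1#) (n ×ᶜ 1#) ⟩
      (1# + m ×ᶜ 1#) - (1# + n ×ᶜ 1#) ≈⟨ +-cong (Mult.1+× m 1#) (-‿cong (Mult.1+× n 1#)) ⟨
      suc m ×ᶜ 1# - suc n ×ᶜ 1#       ∎

    ⟦⟧-+ : ∀ i j → ⟦ i ℤ.+ j ⟧ᶻ ≈ ⟦ i ⟧ᶻ + ⟦ j ⟧ᶻ
    ⟦⟧-+ (+ m)    (+ n)    = Mult.×-homo-+ 1# m n
    ⟦⟧-+ (+ m)    -[1+ n ] = ⟦⊖⟧ m (suc n)
    ⟦⟧-+ -[1+ m ] (+ n)    = trans (⟦⊖⟧ n (suc m)) (+-comm _ _)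
    ⟦⟧-+ -[1+ m ] -[1+ n ] = begin
      - (suc (suc (m ℕ.+ n)) ×ᶜ 1#)      ≡⟨ ≡.cong (λ k → - (suc k ×ᶜ 1#)) (≡.sym (ℕ.+-suc m n)) ⟩
      - ((suc m ℕ.+ suc n) ×ᶜ 1#)        ≈⟨ -‿cong (Mult.×-homo-+ 1# (suc m) (suc n)) ⟩
      - (suc m ×ᶜ 1# + suc n ×ᶜ 1#)
        ≈⟨ Free.solve 2 (λ a b → Free.:- (a Free.:+ b) Free.:= Free.:- a Free.:+ Free.:- b) refl _ _ ⟩
      - (suc m ×ᶜ 1#) + - (suc n ×ᶜ 1#)   ∎

    ⟦-⟧ : ∀ i → ⟦ ℤ.- i ⟧ᶻ ≈ - ⟦ i ⟧ᶻ
    ⟦-⟧ (+ ℕ.zero) = sym R.-0#≈0#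
    ⟦-⟧ (+ suc n)  = refl
    ⟦-⟧ -[1+ n ]   = sym (R.-‿involutive _)

    ⟦⟧-*⁺ : ∀ m j → ⟦ + m ℤ.* j ⟧ᶻ ≈ m ×ᶜ 1# * ⟦ j ⟧ᶻ
    ⟦⟧-*⁺ m (+ n)    = trans (reflexive (≡.cong ⟦_⟧ᶻ (≡.sym (ℤ.pos-* m n)))) (Mult.×1-homo-* m n)
    ⟦⟧-*⁺ m -[1+ n ] = begin
      ⟦ + m ℤ.* -[1+ n ] ⟧ᶻ        ≡⟨ ≡.cong ⟦_⟧ᶻ (≡.sym (ℤ.neg-distribʳ-* (+ m) (+ suc n))) ⟩
      ⟦ ℤ.- (+ m ℤ.* + suc n) ⟧ᶻ   ≈⟨ ⟦-⟧ (+ m ℤ.* + suc n) ⟩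
      - ⟦ + m ℤ.* + suc n ⟧ᶻ       ≈⟨ -‿cong (⟦⟧-*⁺ m (+ suc n)) ⟩
      - (m ×ᶜ 1# * (suc n ×ᶜ 1#))    ≈⟨ R.-‿distribʳ-* _ _ ⟩
      m ×ᶜ 1# * - (suc n ×ᶜ 1#)      ∎

    ⟦⟧-* : ∀ i j → ⟦ i ℤ.* j ⟧ᶻ ≈ ⟦ i ⟧ᶻ * ⟦ j ⟧ᶻ
    ⟦⟧-* (+ m)    j = ⟦⟧-*⁺ m j
    ⟦⟧-* -[1+ m ] j = begin
      ⟦ -[1+ m ] ℤ.* j ⟧ᶻ         ≡⟨ ≡.cong ⟦_⟧ᶻ (≡.sym (ℤ.neg-distribˡ-* (+ suc m) j)) ⟩
      ⟦ ℤ.- (+ suc m ℤ.* j) ⟧ᶻ    ≈⟨ ⟦-⟧ (+ suc m ℤ.* j) ⟩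
      - ⟦ + suc m ℤ.* j ⟧ᶻ        ≈⟨ -‿cong (⟦⟧-*⁺ (suc m) j) ⟩
      - (suc m ×ᶜ 1# * ⟦ j ⟧ᶻ)     ≈⟨ R.-‿distribˡ-* _ _ ⟩
      - (suc m ×ᶜ 1#) * ⟦ j ⟧ᶻ     ∎

    ⟦⟧-homo : ℤ.+-*-rawRing -Raw-AlmostCommutative⟶ acr
    ⟦⟧-homo = record
      { ⟦_⟧    = ⟦_⟧ᶻ
      ; +-homo = ⟦⟧-+
      ; *-homo = ⟦⟧-*
      ; -‿homo = ⟦-⟧
      ; 0-homo = refl
      ; 1-homo = refl
      }

    _coeff≟_ : ∀ i j → Maybe (⟦ i ⟧ᶻ ≈ ⟦ j ⟧ᶻ)
    i coeff≟ j with i ℤ.≟ j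
    ... | yes i≡j = just (reflexive (≡.cong ⟦_⟧ᶻ i≡j))
    ... | no  _   = nothing

  open Algebra.Solver.Ring ℤ.+-*-rawRing acr ⟦⟧-homo _coeff≟_ public
    using (solve; _:=_; _:+_; _:*_; _:-_; :-_; con; Polynomial)
  open Algebra.Solver.Ring ℤ.+-*-rawRing acr ⟦⟧-homo _coeff≟_ using (⟦_⟧; ⟦_⟧↓; op; var; _:^_; [+]; [*]; prove)

  :1 : ∀ {n} → Polynomial n
  :1 = con (+ 1)

  :0 : ∀ {n} → Polynomial n
  :0 = con (+ 0)

  x-y#0 : ∀ {x y} → x # y → x - y # 0#
  x-y#0 {x} {y} x#y with #⇒invertible x#y
  ... | z , _ , xz≈1 = invertibleʳ⇒# (z , trans (*-congʳ (x-0≈x _)) xz≈1)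

  1-x#0 : ∀ {x} → x # 1# → 1# - x # 0#
  1-x#0 x#1 = x-y#0 (#-sym x#1)

  xy≈1⇒x#0 : ∀ {x y} → x * y ≈ 1# → x # 0#
  xy≈1⇒x#0 {y = y} xy≈1 = invertibleʳ⇒# (y , trans (*-congʳ (x-0≈x _)) xy≈1)

  x⁻¹#0 : ∀ {x} → x # 0# → x ⁻¹ # 0#
  x⁻¹#0 x#0 = xy≈1⇒x#0 (trans (*-comm _ _) (⁻¹-inverse x#0))

  -x#0 : ∀ {x} → x # 0# → - x # 0#
  -x#0 {x} x#0 = xy≈1⇒x#0 {y = - (x ⁻¹)}
    (trans (solve 2 (λ a b → :- a :* :- b := a :* b) refl x (x ⁻¹)) (⁻¹-inverse x#0))

  *-cancelˡ : ∀ {x y z} → x # 0# → x * y ≈ x * z → y ≈ z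
  *-cancelˡ {x} {y} {z} x#0 xy≈xz = begin
    y               ≈⟨ *-identityˡ y ⟨
    1# * y          ≈⟨ *-congʳ (trans (*-comm _ _) (⁻¹-inverse x#0)) ⟨
    x ⁻¹ * x * y    ≈⟨ *-assoc _ _ _ ⟩
    x ⁻¹ * (x * y)  ≈⟨ *-congˡ xy≈xz ⟩
    x ⁻¹ * (x * z)  ≈⟨ *-assoc _ _ _ ⟨
    x ⁻¹ * x * z    ≈⟨ *-congʳ (trans (*-comm _ _) (⁻¹-inverse x#0)) ⟩
    1# * z          ≈⟨ *-identityˡ z ⟩
    z               ∎

  ⁻¹-unique : ∀ {x y} → x * y ≈ 1# → y ≈ x ⁻¹
  ⁻¹-unique xy≈1 = *-cancelˡ (xy≈1⇒x#0 xy≈1) (trans xy≈1 (sym (⁻¹-inverse (xy≈1⇒x#0 xy≈1))))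

  1⁻¹≈1 : 1# ⁻¹ ≈ 1#
  1⁻¹≈1 = sym (⁻¹-unique (*-identityˡ 1#))

  x/y*y : ∀ {x y} → y # 0# → x / y * y ≈ x
  x/y*y {x} {y} y#0 = begin
    x * y ⁻¹ * y    ≈⟨ solve 3 (λ x y z → x :* z :* y := x :* (y :* z)) refl x y (y ⁻¹) ⟩
    x * (y * y ⁻¹)  ≈⟨ *-congˡ (⁻¹-inverse y#0) ⟩
    x * 1#          ≈⟨ *-identityʳ x ⟩
    x               ∎

  /-unique : ∀ {x y z} → y # 0# → z * y ≈ x → z ≈ x / y
  /-unique {x} {y} {z} y#0 zy≈x = *-cancelˡ y#0
    (trans (*-comm y z) (trans zy≈x (trans (sym (x/y*y y#0)) (*-comm _ y))))

  /-cong : ∀ {x y z t} → x ≈ y → z ≈ t → x / z ≈ y / t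
  /-cong x≈y z≈t = *-cong x≈y (⁻¹-cong z≈t)

  1/1≈1 : 1# / 1# ≈ 1#
  1/1≈1 = trans (*-identityˡ _) 1⁻¹≈1


  private
    _[_] : ∀ {m n} → Polynomial m → Vec (Polynomial n) m → Polynomial n
    op o p r [ σ ] = op o (p [ σ ]) (r [ σ ])
    con z    [ σ ] = con z
    var i    [ σ ] = lookup σ i
    (p :^ n) [ σ ] = (p [ σ ]) :^ n
    (:- p)   [ σ ] = :- (p [ σ ])

    -- The elements `ρ` are only assumed equivalent to the values of the substituted polynomials, so
    -- that a factorised form can stand in for a weight inside an identity that is checked
    -- symbolically.
    ⟦[]⟧ : ∀ {m n} (p : Polynomial m) (σ : Vec (Polynomial n) m) {ρ τ} →
           Pointwise (λ x r → x ≈ ⟦ r ⟧ τ) ρ σ → ⟦ p ⟧ ρ ≈ ⟦ p [ σ ] ⟧ τ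
    ⟦[]⟧ (op [+] p r) σ eqs = +-cong (⟦[]⟧ p σ eqs) (⟦[]⟧ r σ eqs)
    ⟦[]⟧ (op [*] p r) σ eqs = *-cong (⟦[]⟧ p σ eqs) (⟦[]⟧ r σ eqs)
    ⟦[]⟧ (con z)      σ eqs = refl
    ⟦[]⟧ (var i)      σ eqs = Pointwise.lookup eqs i
    ⟦[]⟧ (p :^ n)     σ eqs = Exp.^-congˡ n (⟦[]⟧ p σ eqs)
    ⟦[]⟧ (:- p)       σ eqs = -‿cong (⟦[]⟧ p σ eqs)

    variables : ∀ {n} → Vec (Polynomial n) n
    variables {n} = Vec.map var (allFin n)

  -- Ring identity among elements ρ that are given as polynomials σ in elements τ.
  solve-with : ∀ {m n} (e : N-ary m (Polynomial m) (Polynomial m × Polynomial m))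
               (σ : N-ary n (Polynomial n) (Vec (Polynomial n) m)) (τ : Vec Carrier n)
               {ρ : Vec Carrier m} →
               Pointwise (λ x r → x ≈ ⟦ r ⟧ τ) ρ (σ $ⁿ variables) →
               ⟦ proj₁ (e $ⁿ variables) [ σ $ⁿ variables ] ⟧↓ τ ≈ ⟦ proj₂ (e $ⁿ variables) [ σ $ⁿ variables ] ⟧↓ τ →
               ⟦ proj₁ (e $ⁿ variables) ⟧ ρ ≈ ⟦ proj₂ (e $ⁿ variables) ⟧ ρ
  solve-with {m} {n} e σ τ {ρ} eqs normal =
    trans (⟦[]⟧ p s eqs) (trans (prove τ (p [ s ]) (r [ s ]) normal) (sym (⟦[]⟧ r s eqs)))
    where
    p r : Polynomial m
    p = proj₁ (e $ⁿ variables)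
    r = proj₂ (e $ⁿ variables)
    s : Vec (Polynomial n) m
    s = σ $ⁿ variables

-- q-Pochhammer ratios, the W-vertex and the Yang-Baxter equation

module QWeights {c ℓ₁ ℓ₂} (K : Field c ℓ₁ ℓ₂) (q : Field.Carrier K) where

  open Field K hiding (zero)
  open FieldProperties K
  open Functions K q
  open CommutativeRing commutativeRing using (semiring)
  open import Relation.Binary.Reasoning.Setoid setoid
  open Algebra.Properties.Semiring.Exp semiring public using (^-homo-*; ^-congˡ)

  ∏-cong : ∀ n {f g : Fin n → Carrier} → (∀ i → f i ≈ g i) → ∏ n f ≈ ∏ n g
  ∏-cong zero    f≈g = refl
  ∏-cong (suc n) f≈g = *-cong (f≈g Fin.zero) (∏-cong n (λ i → f≈g (Fin.suc i)))

  ∏-last : ∀ n (f : ℕ → Carrier) → ∏ (suc n) (λ i → f (toℕ i)) ≈ ∏ n (λ i → f (toℕ i)) * f n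
  ∏-last zero    f = *-comm _ _
  ∏-last (suc n) f = trans (*-congˡ (∏-last n (λ i → f (suc i)))) (sym (*-assoc _ _ _))

  ∏#0 : ∀ n {f : Fin n → Carrier} → (∀ i → f i # 0#) → ∏ n f # 0#
  ∏#0 zero    f#0 = 1#0
  ∏#0 (suc n) f#0 = x*y#0 (f#0 Fin.zero) (∏#0 n (λ i → f#0 (Fin.suc i)))

  poch-suc : ∀ x n → poch x (suc n) ≈ poch x n * (1# - x * q ^ n)
  poch-suc x n = ∏-last n (λ i → 1# - x * q ^ i)

  poch-cong : ∀ {x y} n → x ≈ y → poch x n ≈ poch y n
  poch-cong n x≈y = ∏-cong n (λ i → +-congˡ (-‿cong (*-congʳ x≈y)))

  poch#0 : ∀ {x} n → (∀ k → x * q ^ k # 1#) → poch x n # 0#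
  poch#0 n xqᵏ#1 = ∏#0 n (λ i → 1-x#0 (xqᵏ#1 (toℕ i)))

  poch-ratio : Carrier → Carrier → ℕ → Carrier
  poch-ratio a b n = poch a n / poch b n

  -- Both symbols gain one factor. The form without denominators is what reduces identities between
  -- neighbouring weights to polynomial ones.
  poch-ratio-suc : ∀ {a b} → (∀ k → b * q ^ k # 1#) → ∀ n →
    poch-ratio a b (suc n) * (1# - b * q ^ n) ≈ poch-ratio a b n * (1# - a * q ^ n)
  poch-ratio-suc {a} {b} bqᵏ#1 n = *-cancelˡ (poch#0 n bqᵏ#1) (begin
    poch b n * (poch a (suc n) / poch b (suc n) * (1# - b * q ^ n))
      ≈⟨ solve 4 (λ u v w z → u :* (v :* w :* z) := v :* w :* (u :* z)) refl _ _ _ _ ⟩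
    poch a (suc n) / poch b (suc n) * (poch b n * (1# - b * q ^ n))
      ≈⟨ *-congˡ (poch-suc b n) ⟨
    poch a (suc n) / poch b (suc n) * poch b (suc n)
      ≈⟨ x/y*y (poch#0 (suc n) bqᵏ#1) ⟩
    poch a (suc n)
      ≈⟨ poch-suc a n ⟩
    poch a n * (1# - a * q ^ n)
      ≈⟨ *-congʳ (x/y*y (poch#0 n bqᵏ#1)) ⟨
    poch a n / poch b n * poch b n * (1# - a * q ^ n)
      ≈⟨ solve 4 (λ u v w z → u :* v :* w :* z := w :* (u :* v :* z)) refl _ _ _ _ ⟩
    poch b n * (poch a n / poch b n * (1# - a * q ^ n)) ∎)

  poch-ratio-zero : ∀ a b → poch-ratio a b 0 ≈ 1#
  poch-ratio-zero a b = 1/1≈1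

  -- The vertex weight factorises as ω i b = F i * G b * H (i - b), and ω vanishes for i < b.
  module Weight (qᵏ#1 : ∀ k → q ^ suc k # 1#) (x T : Carrier) (xTqᵏ#1 : ∀ k → x * T * q ^ k # 1#) where

    -- In the notation of the W-vertex `x` is s²/t² and `T` is t², so that `x * T` is s².
    F G H H⁺ : ℕ → Carrier
    F = poch-ratio q (x * T)
    G b = x ^ b * poch-ratio T q b
    H = poch-ratio x q
    -- The index is shifted by one: the truncated difference `suc i ∸ b` is zero exactly when i < b,
    -- where the weight has to vanish.
    H⁺ zero    = 0#
    H⁺ (suc d) = H d

    opaque
      ω : ℕ → ℕ → Carrier
      ω i b = F i * G b * H⁺ (suc i ∸ b)

      ω-def : ∀ i b → ω i b ≈ F i * G b * H⁺ (suc i ∸ b)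
      ω-def i b = refl

      ω-≤ : ∀ b d → ω (b ℕ.+ d) b ≈ F (b ℕ.+ d) * G b * H d
      ω-≤ b d = *-congˡ (reflexive (≡.cong H⁺ (≡.trans (≡.cong (_∸ b) (≡.sym (ℕ.+-suc b d))) (ℕ.m+n∸m≡n b (suc d)))))

      ω-> : ∀ {i b} → suc i ≤ b → ω i b ≈ 0#
      ω-> i<b = trans (*-congˡ (reflexive (≡.cong H⁺ (ℕ.m≤n⇒m∸n≡0 i<b)))) (zeroʳ _)

    private
      -- Neighbouring values with g a = f b are written over the common unknown f / a: here f is its
      -- multiple by a, and in `split′` g is its multiple by b. This leaves no division for the ring
      -- solver to interpret.
      split : ∀ {g f a b} → a # 0# → g * a ≈ f * b → f ≈ f / a * a
      split a#0 _ = sym (x/y*y a#0)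

      split′ : ∀ {g f a b} → a # 0# → g * a ≈ f * b → g ≈ f / a * b
      split′ {g} {f} {a} {b} a#0 e = *-cancelˡ a#0 (begin
        a * g            ≈⟨ *-comm a g ⟩
        g * a            ≈⟨ e ⟩
        f * b            ≈⟨ *-congʳ (x/y*y a#0) ⟨
        f / a * a * b    ≈⟨ solve 3 (λ x y z → x :* y :* z := y :* (x :* z)) refl _ _ _ ⟩
        a * (f / a * b)  ∎)

      1-qᵏ#0 : ∀ k → 1# - q ^ suc k # 0#
      1-qᵏ#0 k = 1-x#0 (qᵏ#1 k)

      Ĥ : ℕ → Carrier
      Ĥ d = H d / (1# - q ^ suc d)

      H-suc : ∀ d → H (suc d) * (1# - q ^ suc d) ≈ H d * (1# - x * q ^ d)
      H-suc = poch-ratio-suc qᵏ#1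

      F̂ : ℕ → Carrier
      F̂ i = F i / (1# - x * T * q ^ i)

      F-suc : ∀ i → F (suc i) * (1# - x * T * q ^ i) ≈ F i * (1# - q ^ suc i)
      F-suc = poch-ratio-suc xTqᵏ#1

      Ĝ : ℕ → Carrier
      Ĝ b = G b / (1# - q ^ suc b)

      G-suc : ∀ b → G (suc b) * (1# - q ^ suc b) ≈ G b * (x * (1# - T * q ^ b))
      G-suc b = begin
        x * x ^ b * r * (1# - q ^ suc b)
          ≈⟨ solve 4 (λ x p r z → x :* p :* r :* z := x :* p :* (r :* z)) refl _ _ _ _ ⟩
        x * x ^ b * (r * (1# - q ^ suc b))
          ≈⟨ *-congˡ (poch-ratio-suc qᵏ#1 b) ⟩
        x * x ^ b * (poch-ratio T q b * (1# - T * q ^ b))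
          ≈⟨ solve 4 (λ x p r z → x :* p :* (r :* z) := p :* r :* (x :* z)) refl _ _ _ _ ⟩
        G b * (x * (1# - T * q ^ b)) ∎
        where r = poch-ratio T q (suc b)

    -- ω′ y i b stands for ω i (b - 1) * y * x * (1 - T * q ^ (b - 1)), also when b = 0.
    ω′ : Carrier → ℕ → ℕ → Carrier
    ω′ y i b = y * (F i * (G b * (1# - q ^ b)) * H⁺ (suc (suc i) ∸ b))

    ω′-zero : ∀ y i → ω′ y i 0 ≈ 0#
    ω′-zero y i = solve 4 (λ y f g h → y :* (f :* (g :* (:1 :- :1)) :* h) := :0) refl y (F i) (G 0) (H⁺ (suc (suc i)))

    ω′-suc : ∀ y i b → ω′ y i (suc b) ≈ ω i b * (y * x - y * (x * T) * q ^ b)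
    ω′-suc y i b = begin
      y * (F i * (G (suc b) * (1# - q ^ suc b)) * h)
        ≈⟨ *-congˡ (*-congʳ (*-congˡ (G-suc b))) ⟩
      y * (F i * (G b * (x * (1# - T * q ^ b))) * h)
        ≈⟨ solve 7 (λ y f g x T b h → y :* (f :* (g :* (x :* (:1 :- T :* b))) :* h)
             := f :* g :* h :* (y :* x :- y :* (x :* T) :* b)) refl y (F i) (G b) x T (q ^ b) h ⟩
      F i * G b * h * (y * x - y * (x * T) * q ^ b)
        ≈⟨ *-congʳ (ω-def i b) ⟨
      ω i b * (y * x - y * (x * T) * q ^ b) ∎
      where h = H⁺ (suc i ∸ b)

    -- On the support of the weight the bottom label is b + d. All neighbouring values of `F`, `G`
    -- and `H` become polynomial multiples of three common unknowns, with q^b and q^d as the only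
    -- powers.
    private module Split (b d : ℕ) where

      qᵇ⁺ᵈ : q ^ (b ℕ.+ d) ≈ q ^ b * q ^ d
      qᵇ⁺ᵈ = ^-homo-* q b d

      F₀ : F (b ℕ.+ d) ≈ F̂ (b ℕ.+ d) * (1# - x * T * (q ^ b * q ^ d))
      F₀ = trans (split (1-x#0 (xTqᵏ#1 (b ℕ.+ d))) (F-suc (b ℕ.+ d))) (*-congˡ (+-congˡ (-‿cong (*-congˡ qᵇ⁺ᵈ))))
      F₁ : F (suc (b ℕ.+ d)) ≈ F̂ (b ℕ.+ d) * (1# - q * (q ^ b * q ^ d))
      F₁ = trans (split′ (1-x#0 (xTqᵏ#1 (b ℕ.+ d))) (F-suc (b ℕ.+ d))) (*-congˡ (+-congˡ (-‿cong (*-congˡ qᵇ⁺ᵈ))))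

      G₀ : G b ≈ Ĝ b * (1# - q * q ^ b)
      G₀ = split (1-qᵏ#0 b) (G-suc b)
      G₁ : G (suc b) ≈ Ĝ b * (x * (1# - T * q ^ b))
      G₁ = split′ (1-qᵏ#0 b) (G-suc b)

      H₀ : H d ≈ Ĥ d * (1# - q * q ^ d)
      H₀ = split (1-qᵏ#0 d) (H-suc d)
      H₁ : H (suc d) ≈ Ĥ d * (1# - x * q ^ d)
      H₁ = split′ (1-qᵏ#0 d) (H-suc d)

    module YangBaxter (y Ω : Carrier) where

      private
        u*[0*p] : ∀ {u w p} → w ≈ 0# → u * (w * p) ≈ 0#
        u*[0*p] w≈0 = trans (*-congˡ (trans (*-congʳ w≈0) (zeroˡ _))) (zeroʳ _)

        u*0 : ∀ {u w} → w ≈ 0# → u * w ≈ 0#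
        u*0 w≈0 = trans (*-congˡ w≈0) (zeroʳ _)

        cancel₂ : ∀ {u v s t} → u ≈ s → v ≈ 0# → t ≈ 0# → u - v ≈ s - t
        cancel₂ u≈s v≈0 t≈0 = +-cong u≈s (-‿cong (trans v≈0 (sym t≈0)))

        -- At `b = 0` the factor 1 - q^b removes the default value `pred 0`; otherwise the weight
        -- vanishes because its right label exceeds its bottom label.
        qω≈0 : ∀ b → ω (pred b) b * (1# - q ^ b) ≈ 0#
        qω≈0 zero    = trans (*-congˡ (-‿inverseʳ 1#)) (zeroʳ _)
        qω≈0 (suc b) = trans (*-congʳ (ω-> ℕ.≤-refl)) (zeroˡ _)

        i<1+i+k : ∀ i k → suc i ≤ suc (i ℕ.+ k)
        i<1+i+k i k = ℕ.s≤s (ℕ.m≤m+n i k)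

        ω-≡ : ∀ {i b d} → i ≡ b ℕ.+ d → ω i b ≈ F i * G b * H d
        ω-≡ {b = b} {d} ≡.refl = ω-≤ b d

        H⁺-≡ : ∀ b d → H⁺ (suc (suc (b ℕ.+ d)) ∸ b) ≈ H (suc d)
        H⁺-≡ b d = reflexive (≡.cong H⁺ (≡.trans
          (≡.cong (_∸ b) (ℕS.solve 2 (λ b d → ℕS.con 2 ℕS.:+ (b ℕS.:+ d) ℕS.:= b ℕS.:+ (ℕS.con 2 ℕS.:+ d)) ≡.refl b d))
          (ℕ.m+n∸m≡n b (suc (suc d)))))

      -- The four entries of the Yang–Baxter equation for the cross vertex R of the
      -- header, indexed by its ingoing and outgoing bit.
      yb₀₀ : ∀ i a i₁ b → i ℕ.+ a ≡ i₁ ℕ.+ b →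
        (1# - Ω * q ^ a) * (ω i b * (1# - y * (x * T) * q ^ i))
          - (y * x - Ω * q ^ a) * (ω (pred i) b * (1# - q ^ i))
        ≈ (1# - Ω * q ^ i₁) * (ω i b * (1# - y * (x * T) * q ^ b))
          - (y - Ω * q ^ pred i₁) * (ω i (suc b) * (1# - q ^ suc b))
      -- For i < b all weights vanish. At i = b conservation gives i₁ = a, and only the first term
      -- on each side survives. For i > b both differences are at least one, the predecessors are
      -- genuine, and a polynomial identity in q^a, q^b and q^d remains.
      yb₀₀ i a i₁ b eq with ℕ.compare i b
      ... | ℕ.less _ k = cancel₂
        (trans (u*[0*p] (ω-> (i<1+i+k i k))) (sym (u*[0*p] (ω-> (i<1+i+k i k)))))
        (u*[0*p] (ω-> (ℕ.s≤s (ℕ.≤-trans ℕ.pred[n]≤n (ℕ.m≤m+n i k)))))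
        (u*[0*p] (ω-> (ℕ.m≤n⇒m≤1+n (i<1+i+k i k))))
      ... | ℕ.equal _ with ℕ.+-cancelʳ-≡ i i₁ a (≡.trans (≡.sym eq) (ℕ.+-comm i a))
      ...   | ≡.refl = cancel₂ refl (u*0 (qω≈0 i)) (u*[0*p] (ω-> ℕ.≤-refl))
      yb₀₀ i a i₁ b eq | ℕ.greater _ d with ℕ.+-cancelʳ-≡ b i₁ (suc (a ℕ.+ d)) (≡.trans (≡.sym eq)
        (ℕS.solve 3 (λ a b d → ℕS.con 1 ℕS.:+ (b ℕS.:+ d) ℕS.:+ a ℕS.:= ℕS.con 1 ℕS.:+ (a ℕS.:+ d) ℕS.:+ b) ≡.refl a b d))
      ...   | ≡.refl = solve-with
        (λ A B Qi Qi₁ Pi₁ qB Ω y x T w₁ w₂ w₃ →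
          (:1 :- Ω :* A) :* (w₁ :* (:1 :- y :* (x :* T) :* Qi)) :- (y :* x :- Ω :* A) :* (w₂ :* (:1 :- Qi))
          := (:1 :- Ω :* Qi₁) :* (w₁ :* (:1 :- y :* (x :* T) :* B)) :- (y :- Ω :* Pi₁) :* (w₃ :* (:1 :- qB)))
        (λ A B Z q Ω y x T f g h →
          let BZ = B :* Z ; f₀ = f :* (:1 :- x :* T :* BZ) ; f₁ = f :* (:1 :- q :* BZ)
              g₀ = g :* (:1 :- q :* B) ; g₁ = g :* (x :* (:1 :- T :* B))
              h₀ = h :* (:1 :- q :* Z) ; h₁ = h :* (:1 :- x :* Z) in
          A ∷ B ∷ q :* BZ ∷ q :* (A :* Z) ∷ A :* Z ∷ q :* B ∷ Ω ∷ y ∷ x ∷ T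
            ∷ f₁ :* g₀ :* h₁ ∷ f₀ :* g₀ :* h₀ ∷ f₁ :* g₁ :* h₀ ∷ [])
        (q ^ a ∷ q ^ b ∷ q ^ d ∷ q ∷ Ω ∷ y ∷ x ∷ T ∷ F̂ (b ℕ.+ d) ∷ Ĝ b ∷ Ĥ d ∷ [])
        (refl ∷ refl ∷ *-congˡ qᵇ⁺ᵈ ∷ *-congˡ (^-homo-* q a d) ∷ ^-homo-* q a d ∷ refl ∷ refl ∷ refl ∷ refl ∷ refl
          ∷ trans (ω-≡ (≡.sym (ℕ.+-suc b d))) (*-cong (*-cong F₁ G₀) H₁)
          ∷ trans (ω-≤ b d) (*-cong (*-cong F₀ G₀) H₀)
          ∷ trans (ω-≤ (suc b) d) (*-cong (*-cong F₁ G₁) H₀) ∷ [])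
        refl
        where open Split b d

      yb₀₁ : ∀ i a i₁ b → i ℕ.+ suc a ≡ i₁ ℕ.+ b →
        - ((1# - Ω * q ^ a) * (ω (suc i) b * (y - y * (x * T) * q ^ i)))
          - (y * x - Ω * q ^ a) * (ω i b * (q ^ i - y))
        ≈ - ((1# - Ω * q ^ i₁) * ω′ y i b)
          - (y - Ω * q ^ pred i₁) * (ω i b * (q ^ b - y * x))
      -- The comparison is with `suc i`, the largest bottom label that occurs. In the boundary case
      -- `b = suc i` that weight survives and must match `ω′`; there `F (suc i)` and `F i` are both
      -- expressed through `F̂ i`.
      yb₀₁ i a i₁ b eq with ℕ.compare (suc i) b
      ... | ℕ.less _ k = cancel₂
        (-‿cong (trans (u*[0*p] (ω-> (i<1+i+k (suc i) k)))
          (sym (u*0 (u*0 (u*0 (reflexive (≡.cong H⁺ (ℕ.m≤n⇒m∸n≡0 (i<1+i+k (suc i) k))))))))))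
        (u*[0*p] (ω-> (ℕ.m≤n⇒m≤1+n (i<1+i+k i k)))) (u*[0*p] (ω-> (ℕ.m≤n⇒m≤1+n (i<1+i+k i k))))
      ... | ℕ.equal _ with ℕ.+-cancelʳ-≡ (suc i) i₁ a (≡.trans (≡.sym eq)
        (ℕS.solve 2 (λ a i → i ℕS.:+ (ℕS.con 1 ℕS.:+ a) ℕS.:= a ℕS.:+ (ℕS.con 1 ℕS.:+ i)) ≡.refl a i))
      ...   | ≡.refl = cancel₂
        (solve-with
          (λ u w y x T Q w′ → :- (u :* (w :* (y :- y :* (x :* T) :* Q))) := :- (u :* w′))
          (λ u y x T q Q f g h → u ∷ (f :* (:1 :- q :* Q)) :* g :* h ∷ y ∷ x ∷ T ∷ Q
            ∷ y :* ((f :* (:1 :- x :* T :* Q)) :* (g :* (:1 :- q :* Q)) :* h) ∷ [])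
          (1# - Ω * q ^ a ∷ y ∷ x ∷ T ∷ q ∷ q ^ i ∷ F̂ i ∷ G (suc i) ∷ H⁺ (suc i ∸ i) ∷ [])
          (refl ∷ trans (ω-def (suc i) (suc i)) (*-congʳ (*-congʳ (split′ (1-x#0 (xTqᵏ#1 i)) (F-suc i)))) ∷ refl ∷ refl ∷ refl ∷ refl
            ∷ *-congˡ (*-congʳ (*-congʳ (split (1-x#0 (xTqᵏ#1 i)) (F-suc i)))) ∷ []) refl)
        (u*[0*p] (ω-> ℕ.≤-refl)) (u*[0*p] (ω-> ℕ.≤-refl))
      yb₀₁ i a i₁ b eq | ℕ.greater _ d with ℕ.+-cancelʳ-≡ b i₁ (suc (a ℕ.+ d)) (≡.trans (≡.sym eq)
        (ℕS.solve 3 (λ a b d → (b ℕS.:+ d) ℕS.:+ (ℕS.con 1 ℕS.:+ a) ℕS.:= ℕS.con 1 ℕS.:+ (a ℕS.:+ d) ℕS.:+ b) ≡.refl a b d))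
      ...   | ≡.refl = solve-with
        (λ A B Qi Qi₁ Pi₁ Ω y x T w₁ w₂ w₃ →
          :- ((:1 :- Ω :* A) :* (w₁ :* (y :- y :* (x :* T) :* Qi))) :- (y :* x :- Ω :* A) :* (w₂ :* (Qi :- y))
          := :- ((:1 :- Ω :* Qi₁) :* w₃) :- (y :- Ω :* Pi₁) :* (w₂ :* (B :- y :* x)))
        (λ A B Z q Ω y x T f g h →
          let BZ = B :* Z ; f₀ = f :* (:1 :- x :* T :* BZ) ; f₁ = f :* (:1 :- q :* BZ)
              h₀ = h :* (:1 :- q :* Z) ; h₁ = h :* (:1 :- x :* Z) in
          A ∷ B ∷ BZ ∷ q :* (A :* Z) ∷ A :* Z ∷ Ω ∷ y ∷ x ∷ T
            ∷ f₁ :* g :* h₁ ∷ f₀ :* g :* h₀ ∷ y :* (f₀ :* (g :* (:1 :- B)) :* h₁) ∷ [])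
        (q ^ a ∷ q ^ b ∷ q ^ d ∷ q ∷ Ω ∷ y ∷ x ∷ T ∷ F̂ (b ℕ.+ d) ∷ G b ∷ Ĥ d ∷ [])
        (refl ∷ refl ∷ qᵇ⁺ᵈ ∷ *-congˡ (^-homo-* q a d) ∷ ^-homo-* q a d ∷ refl ∷ refl ∷ refl ∷ refl
          ∷ trans (ω-≡ (≡.sym (ℕ.+-suc b d))) (*-cong (*-congʳ F₁) H₁)
          ∷ trans (ω-≤ b d) (*-cong (*-congʳ F₀) H₀)
          ∷ *-congˡ (*-cong (*-congʳ F₀) (trans (H⁺-≡ b d) H₁)) ∷ [])
        refl
        where open Split b d

      yb₁₀ : ∀ i β i₁ b → i ℕ.+ β ≡ i₁ ℕ.+ suc b →
        (1# - q ^ β) * (ω i b * (1# - y * (x * T) * q ^ i))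
          + (q ^ β - y * x) * (ω (pred i) b * (1# - q ^ i))
        ≈ (1# - q ^ suc i₁) * (ω i b * (1# - y * (x * T) * q ^ b))
          + (q ^ i₁ - y) * (ω i (suc b) * (1# - q ^ suc b))
      yb₁₀ i β i₁ b eq with ℕ.compare i b
      ... | ℕ.less _ k = +-cong
        (trans (u*[0*p] (ω-> (i<1+i+k i k))) (sym (u*[0*p] (ω-> (i<1+i+k i k)))))
        (trans (u*[0*p] (ω-> (ℕ.s≤s (ℕ.≤-trans ℕ.pred[n]≤n (ℕ.m≤m+n i k)))))
          (sym (u*[0*p] (ω-> (ℕ.m≤n⇒m≤1+n (i<1+i+k i k))))))
      ... | ℕ.equal _ with ℕ.+-cancelˡ-≡ i β (suc i₁) (≡.trans eq (≡.trans (ℕ.+-suc i₁ i) (ℕ.+-comm (suc i₁) i)))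
      ...   | ≡.refl = +-congˡ (trans (u*0 (qω≈0 i)) (sym (u*[0*p] (ω-> ℕ.≤-refl))))
      yb₁₀ i β i₁ b eq | ℕ.greater _ d with ℕ.+-cancelʳ-≡ (suc b) i₁ (β ℕ.+ d) (≡.trans (≡.sym eq)
        (ℕS.solve 3 (λ a b d → ℕS.con 1 ℕS.:+ (b ℕS.:+ d) ℕS.:+ a ℕS.:= (a ℕS.:+ d) ℕS.:+ (ℕS.con 1 ℕS.:+ b)) ≡.refl β b d))
      ...   | ≡.refl = solve-with
        (λ A B Qi qQi₁ Qi₁ qB y x T w₁ w₂ w₃ →
          (:1 :- A) :* (w₁ :* (:1 :- y :* (x :* T) :* Qi)) :+ (A :- y :* x) :* (w₂ :* (:1 :- Qi))
          := (:1 :- qQi₁) :* (w₁ :* (:1 :- y :* (x :* T) :* B)) :+ (Qi₁ :- y) :* (w₃ :* (:1 :- qB)))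
        (λ A B Z q y x T f g h →
          let BZ = B :* Z ; f₀ = f :* (:1 :- x :* T :* BZ) ; f₁ = f :* (:1 :- q :* BZ)
              g₀ = g :* (:1 :- q :* B) ; g₁ = g :* (x :* (:1 :- T :* B))
              h₀ = h :* (:1 :- q :* Z) ; h₁ = h :* (:1 :- x :* Z) in
          A ∷ B ∷ q :* BZ ∷ q :* (A :* Z) ∷ A :* Z ∷ q :* B ∷ y ∷ x ∷ T
            ∷ f₁ :* g₀ :* h₁ ∷ f₀ :* g₀ :* h₀ ∷ f₁ :* g₁ :* h₀ ∷ [])
        (q ^ β ∷ q ^ b ∷ q ^ d ∷ q ∷ y ∷ x ∷ T ∷ F̂ (b ℕ.+ d) ∷ Ĝ b ∷ Ĥ d ∷ [])
        (refl ∷ refl ∷ *-congˡ qᵇ⁺ᵈ ∷ *-congˡ (^-homo-* q β d) ∷ ^-homo-* q β d ∷ refl ∷ refl ∷ refl ∷ refl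
          ∷ trans (ω-≡ (≡.sym (ℕ.+-suc b d))) (*-cong (*-cong F₁ G₀) H₁)
          ∷ trans (ω-≤ b d) (*-cong (*-cong F₀ G₀) H₀)
          ∷ trans (ω-≤ (suc b) d) (*-cong (*-cong F₁ G₁) H₀) ∷ [])
        refl
        where open Split b d

      yb₁₁ : ∀ i β i₁ b → i ℕ.+ β ≡ i₁ ℕ.+ b →
        - ((1# - q ^ β) * (ω (suc i) b * (y - y * (x * T) * q ^ i)))
          + (q ^ β - y * x) * (ω i b * (q ^ i - y))
        ≈ - ((1# - q ^ suc i₁) * ω′ y i b)
          + (q ^ i₁ - y) * (ω i b * (q ^ b - y * x))
      yb₁₁ i β i₁ b eq with ℕ.compare (suc i) b
      ... | ℕ.less _ k = +-cong
        (-‿cong (trans (u*[0*p] (ω-> (i<1+i+k (suc i) k)))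
          (sym (u*0 (u*0 (u*0 (reflexive (≡.cong H⁺ (ℕ.m≤n⇒m∸n≡0 (i<1+i+k (suc i) k))))))))))
        (trans (u*[0*p] (ω-> (ℕ.m≤n⇒m≤1+n (i<1+i+k i k)))) (sym (u*[0*p] (ω-> (ℕ.m≤n⇒m≤1+n (i<1+i+k i k))))))
      ... | ℕ.equal _ with ℕ.+-cancelˡ-≡ i β (suc i₁) (≡.trans eq (≡.trans (ℕ.+-suc i₁ i) (ℕ.+-comm (suc i₁) i)))
      ...   | ≡.refl = +-cong
        (solve-with
          (λ u w y x T Q w′ → :- (u :* (w :* (y :- y :* (x :* T) :* Q))) := :- (u :* w′))
          (λ u y x T q Q f g h → u ∷ (f :* (:1 :- q :* Q)) :* g :* h ∷ y ∷ x ∷ T ∷ Q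
            ∷ y :* ((f :* (:1 :- x :* T :* Q)) :* (g :* (:1 :- q :* Q)) :* h) ∷ [])
          (1# - q ^ suc i₁ ∷ y ∷ x ∷ T ∷ q ∷ q ^ i ∷ F̂ i ∷ G (suc i) ∷ H⁺ (suc i ∸ i) ∷ [])
          (refl ∷ trans (ω-def (suc i) (suc i)) (*-congʳ (*-congʳ (split′ (1-x#0 (xTqᵏ#1 i)) (F-suc i)))) ∷ refl ∷ refl ∷ refl ∷ refl
            ∷ *-congˡ (*-congʳ (*-congʳ (split (1-x#0 (xTqᵏ#1 i)) (F-suc i)))) ∷ []) refl)
        (trans (u*[0*p] (ω-> ℕ.≤-refl)) (sym (u*[0*p] (ω-> ℕ.≤-refl))))
      yb₁₁ i β i₁ b eq | ℕ.greater _ d with ℕ.+-cancelʳ-≡ b i₁ (β ℕ.+ d) (≡.trans (≡.sym eq)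
        (ℕS.solve 3 (λ a b d → (b ℕS.:+ d) ℕS.:+ a ℕS.:= (a ℕS.:+ d) ℕS.:+ b) ≡.refl β b d))
      ...   | ≡.refl = solve-with
        (λ A B Qi qQi₁ Qi₁ y x T w₁ w₂ w₃ →
          :- ((:1 :- A) :* (w₁ :* (y :- y :* (x :* T) :* Qi))) :+ (A :- y :* x) :* (w₂ :* (Qi :- y))
          := :- ((:1 :- qQi₁) :* w₃) :+ (Qi₁ :- y) :* (w₂ :* (B :- y :* x)))
        (λ A B Z q y x T f g h →
          let BZ = B :* Z ; f₀ = f :* (:1 :- x :* T :* BZ) ; f₁ = f :* (:1 :- q :* BZ)
              h₀ = h :* (:1 :- q :* Z) ; h₁ = h :* (:1 :- x :* Z) in
          A ∷ B ∷ BZ ∷ q :* (A :* Z) ∷ A :* Z ∷ y ∷ x ∷ T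
            ∷ f₁ :* g :* h₁ ∷ f₀ :* g :* h₀ ∷ y :* (f₀ :* (g :* (:1 :- B)) :* h₁) ∷ [])
        (q ^ β ∷ q ^ b ∷ q ^ d ∷ q ∷ y ∷ x ∷ T ∷ F̂ (b ℕ.+ d) ∷ G b ∷ Ĥ d ∷ [])
        (refl ∷ refl ∷ qᵇ⁺ᵈ ∷ *-congˡ (^-homo-* q β d) ∷ ^-homo-* q β d ∷ refl ∷ refl ∷ refl
          ∷ trans (ω-≡ (≡.sym (ℕ.+-suc b d))) (*-cong (*-congʳ F₁) H₁)
          ∷ trans (ω-≤ b d) (*-cong (*-congʳ F₀) H₀)
          ∷ *-congˡ (*-cong (*-congʳ F₀) (trans (H⁺-≡ b d) H₁)) ∷ [])
        refl
        where open Split b d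

-- Enumeration of words

module _ {a} {A : Set a} where

  words-unique : ∀ {xs : List A} → Unique xs → ∀ n → Unique (words xs n)
  words-unique xs! zero    = [] ∷ []
  words-unique xs! (suc n) =
    Unique.cartesianProductWith⁺ Vec._∷_ (λ { ≡.refl → ≡.refl , ≡.refl }) xs! (words-unique xs! n)

  ∈-words⁺ : ∀ {xs : List A} {n} {w : Vec A n} → VecAll.All (_∈ xs) w → w ∈ words xs n
  ∈-words⁺ VecAll.[]         = here ≡.refl
  ∈-words⁺ (x∈ VecAll.∷ w∈) = ∈-cartesianProductWith⁺ Vec._∷_ x∈ (∈-words⁺ w∈)

  ∈-words⁻ : ∀ {xs : List A} {n} {w : Vec A n} → w ∈ words xs n → VecAll.All (_∈ xs) w
  ∈-words⁻ {n = zero}  {[]}    _ = VecAll.[]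
  ∈-words⁻ {xs} {suc n} {x ∷ w} w∈ with ∈-cartesianProductWith⁻ Vec._∷_ xs (words xs n) w∈
  ... | _ , _ , x∈ , w′∈ , ≡.refl = x∈ VecAll.∷ ∈-words⁻ w′∈

-- Finite sums and Kronecker deltas

module Sums {c ℓ₁ ℓ₂} (K : Field c ℓ₁ ℓ₂) (q : Field.Carrier K) where

  open Field K hiding (zero)
  open FieldProperties K
  open Functions K q
  open import Relation.Binary.Reasoning.Setoid setoid

  module _ {a} {A : Set a} where

    ∑-cong-∈ : ∀ (xs : List A) {f g : A → Carrier} → (∀ x → x ∈ xs → f x ≈ g x) → ∑ xs f ≈ ∑ xs g
    ∑-cong-∈ []       f≈g = refl
    ∑-cong-∈ (x ∷ xs) f≈g = +-cong (f≈g x (here ≡.refl)) (∑-cong-∈ xs (λ y y∈ → f≈g y (there y∈)))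

    ∑-cong : ∀ (xs : List A) {f g : A → Carrier} → (∀ x → f x ≈ g x) → ∑ xs f ≈ ∑ xs g
    ∑-cong xs f≈g = ∑-cong-∈ xs (λ x _ → f≈g x)

    ∑-zero : ∀ (xs : List A) → ∑ xs (λ _ → 0#) ≈ 0#
    ∑-zero []       = refl
    ∑-zero (x ∷ xs) = trans (+-identityˡ _) (∑-zero xs)

    ∑-zero-∈ : ∀ (xs : List A) {f : A → Carrier} → (∀ x → x ∈ xs → f x ≈ 0#) → ∑ xs f ≈ 0#
    ∑-zero-∈ xs f≈0 = trans (∑-cong-∈ xs f≈0) (∑-zero xs)

    ∑-+ : ∀ (xs : List A) (f g : A → Carrier) → ∑ xs (λ x → f x + g x) ≈ ∑ xs f + ∑ xs g
    ∑-+ []       f g = sym (+-identityˡ 0#)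
    ∑-+ (x ∷ xs) f g = begin
      f x + g x + ∑ xs (λ x → f x + g x)  ≈⟨ +-congˡ (∑-+ xs f g) ⟩
      f x + g x + (∑ xs f + ∑ xs g)
        ≈⟨ solve 4 (λ a b c d → a :+ b :+ (c :+ d) := a :+ c :+ (b :+ d)) refl _ _ _ _ ⟩
      f x + ∑ xs f + (g x + ∑ xs g)       ∎

    *-∑ : ∀ k (xs : List A) (f : A → Carrier) → k * ∑ xs f ≈ ∑ xs (λ x → k * f x)
    *-∑ k []       f = zeroʳ k
    *-∑ k (x ∷ xs) f = trans (distribˡ k (f x) (∑ xs f)) (+-congˡ (*-∑ k xs f))

    ∑-* : ∀ k (xs : List A) (f : A → Carrier) → ∑ xs f * k ≈ ∑ xs (λ x → f x * k)
    ∑-* k []       f = zeroˡ k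
    ∑-* k (x ∷ xs) f = trans (distribʳ k (f x) (∑ xs f)) (+-congˡ (∑-* k xs f))

    ∑-++ : ∀ (xs ys : List A) (f : A → Carrier) → ∑ (xs ++ ys) f ≈ ∑ xs f + ∑ ys f
    ∑-++ []       ys f = sym (+-identityˡ _)
    ∑-++ (x ∷ xs) ys f = trans (+-congˡ (∑-++ xs ys f)) (sym (+-assoc _ _ _))

  ∑-map : ∀ {a b} {A : Set a} {B : Set b} (g : A → B) xs (f : B → Carrier) →
          ∑ (List.map g xs) f ≈ ∑ xs (λ x → f (g x))
  ∑-map g []       f = refl
  ∑-map g (x ∷ xs) f = +-congˡ (∑-map g xs f)

  ∑-swap : ∀ {a b} {A : Set a} {B : Set b} (xs : List A) (ys : List B) (f : A → B → Carrier) →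
           ∑ xs (λ x → ∑ ys (f x)) ≈ ∑ ys (λ y → ∑ xs (λ x → f x y))
  ∑-swap []       ys f = sym (∑-zero ys)
  ∑-swap (x ∷ xs) ys f = trans (+-congˡ (∑-swap xs ys f)) (sym (∑-+ ys (f x) _))

  ∑-cartesianProductWith : ∀ {a b d} {A : Set a} {B : Set b} {D : Set d} (g : A → B → D) xs ys (f : D → Carrier) →
    ∑ (cartesianProductWith g xs ys) f ≈ ∑ xs (λ x → ∑ ys (λ y → f (g x y)))
  ∑-cartesianProductWith g []       ys f = refl
  ∑-cartesianProductWith g (x ∷ xs) ys f =
    trans (∑-++ (List.map (g x) ys) _ f) (+-cong (∑-map (g x) ys f) (∑-cartesianProductWith g xs ys f))

  [_] : ∀ {p} {P : Set p} → Dec P → Carrier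
  [ P? ] = if does P? then 1# else 0#

  module _ {p} {P : Set p} where

    []-yes : (P? : Dec P) → P → [ P? ] ≈ 1#
    []-yes (yes _) _ = refl
    []-yes (no ¬p) p = contradiction p ¬p

    []-no : (P? : Dec P) → ¬ P → [ P? ] ≈ 0#
    []-no (yes p) ¬p = contradiction p ¬p
    []-no (no _)  _  = refl

  module _ {p r} {P : Set p} {R : Set r} where

    []-⇔ : (P? : Dec P) (R? : Dec R) → (P → R) → (R → P) → [ P? ] ≈ [ R? ]
    []-⇔ (yes p) R? f g = sym ([]-yes R? (f p))
    []-⇔ (no ¬p) R? f g = sym ([]-no R? (λ r → ¬p (g r)))

    []-× : (P? : Dec P) (R? : Dec R) → [ P? ×-dec R? ] ≈ [ P? ] * [ R? ]
    []-× (yes p) (yes r) = sym (*-identityˡ 1#)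
    []-× (yes p) (no ¬r) = sym (zeroʳ _)
    []-× (no ¬p) R?      = sym (zeroˡ _)

  module _ {a} {A : Set a} where

    ∑-filter : ∀ {p} {P : Pred A p} (P? : Decidable P) xs (f : A → Carrier) →
               ∑ (filter P? xs) f ≈ ∑ xs (λ x → [ P? x ] * f x)
    ∑-filter P? []       f = refl
    ∑-filter P? (x ∷ xs) f with P? x
    ... | yes _ = +-cong (sym (*-identityˡ _)) (∑-filter P? xs f)
    ... | no  _ = trans (∑-filter P? xs f) (sym (trans (+-congʳ (zeroˡ _)) (+-identityˡ _)))

    ∑-single : ∀ {xs : List A} {x} {f : A → Carrier} → Unique xs → x ∈ xs →
               (∀ y → y ∈ xs → y ≢ x → f y ≈ 0#) → ∑ xs f ≈ f x
    ∑-single (x∉ ∷ xs!) (here ≡.refl) f≈0 = trans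
      (+-congˡ (∑-zero-∈ _ (λ y y∈ → f≈0 y (there y∈) (λ y≡x → All.lookup x∉ y∈ (≡.sym y≡x)))))
      (+-identityʳ _)
    ∑-single (x∉ ∷ xs!) (there x∈) f≈0 = trans
      (+-cong (f≈0 _ (here ≡.refl) (All.lookup x∉ x∈))
              (∑-single xs! x∈ (λ y y∈ → f≈0 y (there y∈))))
      (+-identityˡ _)

    module _ (_≟_ : DecidableEquality A) where

      open Data.List.Membership.DecPropositional _≟_ using (_∈?_)

      ∑-δ : ∀ {xs : List A} {x} (f : A → Carrier) → Unique xs → x ∈ xs →
            ∑ xs (λ y → [ x ≟ y ] * f y) ≈ f x
      ∑-δ {x = x} f xs! x∈ = trans
        (∑-single xs! x∈ (λ y _ y≢x → trans (*-congʳ ([]-no (x ≟ y) (λ x≡y → y≢x (≡.sym x≡y)))) (zeroˡ _)))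
        (trans (*-congʳ ([]-yes (x ≟ x) ≡.refl)) (*-identityˡ _))

      ∑-δʳ : ∀ {xs : List A} {x} (f : A → Carrier) → Unique xs → x ∈ xs →
             ∑ xs (λ y → f y * [ y ≟ x ]) ≈ f x
      ∑-δʳ {xs} {x} f xs! x∈ = trans
        (∑-cong xs (λ y → trans (*-comm _ _) (*-congʳ ([]-⇔ (y ≟ x) (x ≟ y) ≡.sym ≡.sym))))
        (∑-δ f xs! x∈)

      -- Each term is expanded by a Kronecker delta over the other list and the two sums are
      -- exchanged. Terms outside the other list vanish by hypothesis, so the expansion is valid
      -- from both ends.
      ∑-support : ∀ {xs ys : List A} {f : A → Carrier} → Unique xs → Unique ys →
                  (∀ x → x ∈ xs → x ∉ ys → f x ≈ 0#) → (∀ y → y ∈ ys → y ∉ xs → f y ≈ 0#) →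
                  ∑ xs f ≈ ∑ ys f
      ∑-support {xs} {ys} {f} xs! ys! f≈0 f≈0′ = begin
        ∑ xs f                                       ≈⟨ ∑-cong-∈ xs (λ x x∈ → sym (pick ys! x (f≈0 x x∈))) ⟩
        ∑ xs (λ x → ∑ ys (λ y → [ x ≟ y ] * f y))    ≈⟨ ∑-swap xs ys _ ⟩
        ∑ ys (λ y → ∑ xs (λ x → [ x ≟ y ] * f y))    ≈⟨ ∑-cong ys (λ y → ∑-cong xs (λ x → flip x y)) ⟩
        ∑ ys (λ y → ∑ xs (λ x → [ y ≟ x ] * f x))    ≈⟨ ∑-cong-∈ ys (λ y y∈ → pick xs! y (f≈0′ y y∈)) ⟩
        ∑ ys f                                       ∎
        where
        pick : ∀ {zs} → Unique zs → ∀ x → (x ∉ zs → f x ≈ 0#) → ∑ zs (λ z → [ x ≟ z ] * f z) ≈ f x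
        pick {zs} zs! x fx≈0 with x ∈? zs
        ... | yes x∈ = ∑-δ f zs! x∈
        ... | no  x∉ = trans
          (∑-zero-∈ zs (λ z z∈ → trans (*-congʳ ([]-no (x ≟ z) (λ { ≡.refl → x∉ z∈ }))) (zeroˡ _)))
          (sym (fx≈0 x∉))
        flip : ∀ x y → [ x ≟ y ] * f y ≈ [ y ≟ x ] * f x
        flip x y with x ≟ y
        ... | yes ≡.refl = sym (*-congʳ ([]-yes (x ≟ x) ≡.refl))
        ... | no  x≢y    = trans (zeroˡ _) (sym (trans (*-congʳ ([]-no (y ≟ x) (λ y≡x → x≢y (≡.sym y≡x)))) (zeroˡ _)))

    ∑-words : ∀ (xs : List A) n (f : Vec A (suc n) → Carrier) →
              ∑ (words xs (suc n)) f ≈ ∑ xs (λ x → ∑ (words xs n) (λ w → f (x ∷ w)))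
    ∑-words xs n f = ∑-cartesianProductWith Vec._∷_ xs (words xs n) f

-- Vectors of multiplicities: containment, number of parts, boxes

_≟ᵛ_ : ∀ {L} → DecidableEquality (Vec ℕ L)
_≟ᵛ_ = Vec.≡-dec ℕ._≟_

infix 4 _⊑_ _≟ᵛ_

-- Containment of partitions, in terms of the multiplicities of the parts of the conjugates.
_⊑_ : ∀ {L} → Vec ℕ L → Vec ℕ L → Set
[]       ⊑ []       = ⊤
(x ∷ xs) ⊑ (y ∷ ys) = x ℕ.+ sum xs ≤ y ℕ.+ sum ys × xs ⊑ ys

⊑-refl : ∀ {L} (xs : Vec ℕ L) → xs ⊑ xs
⊑-refl []       = tt
⊑-refl (x ∷ xs) = ℕ.≤-refl , ⊑-refl xs

⊑-trans : ∀ {L} (xs ys zs : Vec ℕ L) → xs ⊑ ys → ys ⊑ zs → xs ⊑ zs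
⊑-trans []       []       []       _          _            = tt
⊑-trans (x ∷ xs) (y ∷ ys) (z ∷ zs) (le , xs⊑) (le′ , ys⊑) = ℕ.≤-trans le le′ , ⊑-trans xs ys zs xs⊑ ys⊑

⊑⇒sum≤ : ∀ {L} (xs ys : Vec ℕ L) → xs ⊑ ys → sum xs ≤ sum ys
⊑⇒sum≤ []       []       _        = z≤n
⊑⇒sum≤ (x ∷ xs) (y ∷ ys) (le , _) = le

-- For the multiplicities of λ′ this is the condition l(λ) ≤ c.
ZeroFrom : ∀ {L} → ℕ → Vec ℕ L → Set
ZeroFrom c       []       = ⊤
ZeroFrom zero    (x ∷ xs) = x ≡ 0 × ZeroFrom zero xs
ZeroFrom (suc c) (x ∷ xs) = ZeroFrom c xs

sum≡0⇒ZeroFrom : ∀ {L} (xs : Vec ℕ L) → sum xs ≡ 0 → ZeroFrom 0 xs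
sum≡0⇒ZeroFrom []       _  = tt
sum≡0⇒ZeroFrom (x ∷ xs) eq = ℕ.m+n≡0⇒m≡0 x eq , sum≡0⇒ZeroFrom xs (ℕ.m+n≡0⇒n≡0 x eq)

ZeroFrom⇒sum≡0 : ∀ {L} (xs : Vec ℕ L) → ZeroFrom 0 xs → sum xs ≡ 0
ZeroFrom⇒sum≡0 []       _          = ≡.refl
ZeroFrom⇒sum≡0 (x ∷ xs) (eq , xs0) = ≡.cong₂ ℕ._+_ eq (ZeroFrom⇒sum≡0 xs xs0)

⊑-ZeroFrom : ∀ {L} c (xs ys : Vec ℕ L) → xs ⊑ ys → ZeroFrom c ys → ZeroFrom c xs
⊑-ZeroFrom c       []       []       _         _   = tt
⊑-ZeroFrom zero    (x ∷ xs) (y ∷ ys) (le , _)  ys0 =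
  sum≡0⇒ZeroFrom (x ∷ xs) (ℕ.n≤0⇒n≡0 (ℕ.≤-trans le (ℕ.≤-reflexive (ZeroFrom⇒sum≡0 (y ∷ ys) ys0))))
⊑-ZeroFrom (suc c) (x ∷ xs) (y ∷ ys) (_ , xs⊑) ys0 = ⊑-ZeroFrom c xs ys xs⊑ ys0

_⊑?_ : ∀ {L} (xs ys : Vec ℕ L) → Dec (xs ⊑ ys)
[]       ⊑? []       = yes tt
(x ∷ xs) ⊑? (y ∷ ys) = (x ℕ.+ sum xs ℕ.≤? y ℕ.+ sum ys) ×-dec (xs ⊑? ys)

ZeroFrom? : ∀ {L} c (xs : Vec ℕ L) → Dec (ZeroFrom c xs)
ZeroFrom? c       []       = yes tt
ZeroFrom? zero    (x ∷ xs) = (x ℕ.≟ 0) ×-dec ZeroFrom? 0 xs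
ZeroFrom? (suc c) (x ∷ xs) = ZeroFrom? c xs

sum-∷ʳ0 : ∀ {L} (xs : Vec ℕ L) → sum (xs ∷ʳ 0) ≡ sum xs
sum-∷ʳ0 []       = ≡.refl
sum-∷ʳ0 (x ∷ xs) = ≡.cong (x ℕ.+_) (sum-∷ʳ0 xs)

⊑-∷ʳ0 : ∀ {L} (xs : Vec ℕ (suc L)) (ys : Vec ℕ L) → xs ⊑ ys ∷ʳ 0 → ∃ λ xs′ → xs ≡ xs′ ∷ʳ 0
⊑-∷ʳ0 (x ∷ [])     []       (le , _)  =
  [] , ≡.cong (_∷ []) (ℕ.n≤0⇒n≡0 (ℕ.m+n≤o⇒m≤o x le))
⊑-∷ʳ0 (x ∷ x′ ∷ xs) (y ∷ ys) (_ , xs⊑) with ⊑-∷ʳ0 (x′ ∷ xs) ys xs⊑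
... | xs′ , eq = x ∷ xs′ , ≡.cong (x ∷_) eq

-- Only the single entries are bounded, which makes the set a plain product. It contains all vectors
-- with sum below `N`, but also vectors with larger sums, for which separate vanishing arguments are
-- required.
box : ℕ → (L : ℕ) → List (Vec ℕ L)
box N L = words (upTo N) L

box-unique : ∀ N L → Unique (box N L)
box-unique N L = words-unique (Unique.upTo⁺ N) L

∈-box⁺ : ∀ {N L} (xs : Vec ℕ L) → sum xs < N → xs ∈ box N L
∈-box⁺ {N} xs lt = ∈-words⁺ (go xs lt)
  where
  go : ∀ {L} (xs : Vec ℕ L) → sum xs < N → VecAll.All (_∈ upTo N) xs
  go []       _  = VecAll.[]
  go (x ∷ xs) lt = ∈-upTo⁺ (ℕ.≤-trans (s≤s (ℕ.m≤m+n x (sum xs))) lt)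
    VecAll.∷ go xs (ℕ.≤-trans (s≤s (ℕ.m≤n+m (sum xs) x)) lt)

∷ʳ0∈box : ∀ {N L} (xs : Vec ℕ L) → xs ∷ʳ 0 ∈ box N (suc L) → xs ∈ box N L
∷ʳ0∈box xs xs0∈ = ∈-words⁺ (go xs (∈-words⁻ xs0∈))
  where
  go : ∀ {L} {A : List ℕ} (xs : Vec ℕ L) → VecAll.All (_∈ A) (xs ∷ʳ 0) → VecAll.All (_∈ A) xs
  go []       _               = VecAll.[]
  go (x ∷ xs) (x∈ VecAll.∷ r) = x∈ VecAll.∷ go xs r

∈box∷ʳ0 : ∀ {N L} (xs : Vec ℕ L) → xs ∈ box (suc N) L → xs ∷ʳ 0 ∈ box (suc N) (suc L)
∈box∷ʳ0 {N} xs xs∈ = ∈-words⁺ (go xs (∈-words⁻ xs∈))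
  where
  go : ∀ {L} (xs : Vec ℕ L) → VecAll.All (_∈ upTo (suc N)) xs → VecAll.All (_∈ upTo (suc N)) (xs ∷ʳ 0)
  go []       _               = ∈-upTo⁺ (s≤s z≤n) VecAll.∷ VecAll.[]
  go (x ∷ xs) (x∈ VecAll.∷ r) = x∈ VecAll.∷ go xs r

-- Rows of vertices as transfer kernels, and chains of kernels

module Rows {c ℓ₁ ℓ₂} (K : Field c ℓ₁ ℓ₂) (q : Field.Carrier K) where

  open Field K hiding (zero)
  open FieldProperties K
  open Functions K q
  open Sums K q
  open import Relation.Binary.Reasoning.Setoid setoid

  u*0 : ∀ {x y} → y ≈ 0# → x * y ≈ 0#
  u*0 y≈0 = trans (*-congˡ y≈0) (zeroʳ _)

  0*u : ∀ {x y} → x ≈ 0# → x * y ≈ 0#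
  0*u x≈0 = trans (*-congʳ x≈0) (zeroˡ _)

  -- ϖ c i j k l is the weight in column c, counted from 0, of a vertex with
  -- bottom, left, top and right labels i, j, k, l.
  Weights : Set c
  Weights = ℕ → ℕ → ℕ → ℕ → ℕ → Carrier

  Conservative : Weights → Set ℓ₁
  Conservative ϖ = ∀ c i j k l → i ℕ.+ j ≢ k ℕ.+ l → ϖ c i j k l ≈ 0#

  RightBounded : Weights → Set ℓ₁
  RightBounded ϖ = ∀ c i j k l → i < l → ϖ c i j k l ≈ 0#

  Normalised : Weights → Set ℓ₁
  Normalised ϖ = ∀ c → ϖ c 0 0 0 0 ≈ 1#

  -- For conservative weights the horizontal labels are determined by the vertical ones.
  row : ∀ {L} → Weights → ℕ → Vec ℕ L → Vec ℕ L → Carrier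
  row ϖ j []       []       = [ j ℕ.≟ 0 ]
  row ϖ j (k ∷ ks) (i ∷ is) = ϖ 0 i j k (i ℕ.+ j ∸ k) * row (ϖ ∘ suc) (i ℕ.+ j ∸ k) ks is

  row-cong : ∀ {L} {ϖ ϖ′ : Weights} → (∀ c i j k l → ϖ c i j k l ≈ ϖ′ c i j k l) →
             ∀ j (ks is : Vec ℕ L) → row ϖ j ks is ≈ row ϖ′ j ks is
  row-cong ϖ≈ j []       []       = refl
  row-cong ϖ≈ j (k ∷ ks) (i ∷ is) = *-cong (ϖ≈ 0 i j k _) (row-cong (λ c → ϖ≈ (suc c)) _ ks is)

  -- Conservation at each vertex adds up over every tail of the row: the label entering the tail is
  -- the difference of the two tail sums. Its nonnegativity in all tails is the containment.
  row-support : ∀ {L ϖ} → Conservative ϖ → ∀ j (ks is : Vec ℕ L) →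
                row ϖ j ks is ≈ 0# ⊎ (j ℕ.+ sum is ≡ sum ks × is ⊑ ks)
  row-support cons zero    [] [] = inj₂ (≡.refl , tt)
  row-support cons (suc j) [] [] = inj₁ refl
  row-support cons j (k ∷ ks) (i ∷ is)
    with i ℕ.+ j ℕ.≟ k ℕ.+ (i ℕ.+ j ∸ k) | row-support (λ c → cons (suc c)) (i ℕ.+ j ∸ k) ks is
  ... | no  neq | _                = inj₁ (0*u (cons 0 i j k _ neq))
  ... | yes _   | inj₁ row≈0       = inj₁ (u*0 row≈0)
  ... | yes eq  | inj₂ (eq′ , is⊑) = inj₂ (total , ℕ.≤-trans (ℕ.m≤n+m _ j) (ℕ.≤-reflexive total) , is⊑)
    where
    total : j ℕ.+ (i ℕ.+ sum is) ≡ k ℕ.+ sum ks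
    total = ≡.trans (ℕS.solve 3 (λ j i s → j ℕS.:+ (i ℕS.:+ s) ℕS.:= i ℕS.:+ j ℕS.:+ s) ≡.refl j i (sum is))
      (≡.trans (≡.cong (ℕ._+ sum is) eq) (≡.trans (ℕ.+-assoc k _ (sum is)) (≡.cong (k ℕ.+_) eq′)))

  row-no : ∀ {L ϖ} → Conservative ϖ → ∀ j (ks is : Vec ℕ L) → j ℕ.+ sum is ≢ sum ks → row ϖ j ks is ≈ 0#
  row-no cons j ks is neq with row-support cons j ks is
  ... | inj₁ row≈0    = row≈0
  ... | inj₂ (eq , _) = contradiction eq neq

  -- In the first column with bottom label zero the incoming label can still go to the top, but
  -- nothing leaves to the right. Hence the top row has at most one part more than the bottom row.
  row-ZeroFrom : ∀ {L ϖ} → Conservative ϖ → RightBounded ϖ → ∀ c j (ks is : Vec ℕ L) → ZeroFrom c is →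
                 row ϖ j ks is ≈ 0# ⊎ ZeroFrom (suc c) ks
  row-ZeroFrom cons rb c       j []       []       _   = inj₂ tt
  row-ZeroFrom cons rb (suc c) j (k ∷ ks) (i ∷ is) is0 =
    Sum.map₁ u*0 (row-ZeroFrom (λ c → cons (suc c)) (λ c → rb (suc c)) c _ ks is is0)
  row-ZeroFrom {ϖ = ϖ} cons rb zero j (k ∷ ks) (.0 ∷ is) (≡.refl , is0) with j ∸ k in eq
  ... | suc l = inj₁ (0*u (rb 0 0 j k (suc l) (s≤s z≤n)))
  ... | zero with row-support (λ c → cons (suc c)) 0 ks is
  ...   | inj₁ row≈0     = inj₁ (u*0 row≈0)
  ...   | inj₂ (eq′ , _) = inj₂ (sum≡0⇒ZeroFrom ks (≡.trans (≡.sym eq′) (ZeroFrom⇒sum≡0 is is0)))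

  row-∷ʳ0 : ∀ {L ϖ} → Conservative ϖ → Normalised ϖ → ∀ j (ks is : Vec ℕ L) →
            row ϖ j (ks ∷ʳ 0) (is ∷ʳ 0) ≈ row ϖ j ks is
  row-∷ʳ0 cons one zero    [] [] = trans (*-identityʳ _) (one 0)
  row-∷ʳ0 cons one (suc j) [] [] = u*0 refl
  row-∷ʳ0 cons one j (k ∷ ks) (i ∷ is) = *-congˡ (row-∷ʳ0 (λ c → cons (suc c)) (λ c → one (suc c)) _ ks is)

  Kernel : Set c
  Kernel = ∀ L → Vec ℕ L → Vec ℕ L → Carrier

  Descending : Kernel → Set ℓ₁
  Descending B = ∀ L ks is → B L ks is ≈ 0# ⊎ is ⊑ ks

  Stable : Kernel → Set ℓ₁
  Stable B = ∀ L ks is → B (suc L) (ks ∷ʳ 0) (is ∷ʳ 0) ≈ B L ks is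

  LengthBounded : ℕ → Kernel → Set ℓ₁
  LengthBounded n B = ∀ L c ks is → ZeroFrom c is → B L ks is ≈ 0# ⊎ ZeroFrom (n ℕ.+ c) ks

  -- A row together with its left boundary: an ingoing label a has weight v a.
  kernel : (ℕ → Carrier) → Weights → Kernel
  kernel v ϖ L ks is = v (sum ks ∸ sum is) * row ϖ (sum ks ∸ sum is) ks is

  kernel-row : ∀ {L} v ϖ a (ks is : Vec ℕ L) → a ℕ.+ sum is ≡ sum ks →
               kernel v ϖ L ks is ≈ v a * row ϖ a ks is
  kernel-row v ϖ a ks is eq =
    reflexive (≡.cong (λ a → v a * row ϖ a ks is) (≡.trans (≡.cong (_∸ sum is) (≡.sym eq)) (ℕ.m+n∸n≡m a (sum is))))

  kernel-descending : ∀ {v ϖ} → Conservative ϖ → Descending (kernel v ϖ)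
  kernel-descending cons L ks is = Sum.map u*0 proj₂ (row-support cons _ ks is)

  kernel-stable : ∀ {v ϖ} → Conservative ϖ → Normalised ϖ → Stable (kernel v ϖ)
  kernel-stable {v} {ϖ} cons one L ks is = trans
    (reflexive (≡.cong₂ (λ s t → v (s ∸ t) * row ϖ (s ∸ t) (ks ∷ʳ 0) (is ∷ʳ 0)) (sum-∷ʳ0 ks) (sum-∷ʳ0 is)))
    (*-congˡ (row-∷ʳ0 cons one _ ks is))

  kernel-lengthBounded : ∀ {v ϖ} → Conservative ϖ → RightBounded ϖ → LengthBounded 1 (kernel v ϖ)
  kernel-lengthBounded cons rb L c ks is is0 = Sum.map₁ u*0 (row-ZeroFrom cons rb c _ ks is is0)

  -- A matrix product with intermediate vectors cut off by a box. For descending kernels the cut-off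
  -- has no effect once `N` exceeds the sum of the top vector.
  chain : ℕ → ∀ n → (Fin n → Kernel) → Kernel
  chain N zero    B L ks is = [ ks ≟ᵛ is ]
  chain N (suc n) B L ks is = ∑[ js ∈ box N L ] (B Fin.zero L ks js * chain N n (B ∘ Fin.suc) L js is)

  chain-descending : ∀ N n {B} → (∀ i → Descending (B i)) → Descending (chain N n B)
  chain-descending N zero    desc L ks is with ks ≟ᵛ is
  ... | yes ≡.refl = inj₂ (⊑-refl ks)
  ... | no  _      = inj₁ refl
  chain-descending N (suc n) desc L ks is with is ⊑? ks
  ... | yes is⊑ks = inj₂ is⊑ks
  ... | no  is⋢ks = inj₁ (∑-zero-∈ (box N L) (λ js _ → term js))
    where
    term : ∀ js → _ ≈ 0#
    term js with desc Fin.zero L ks js | chain-descending N n (desc ∘ Fin.suc) L js is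
    ... | inj₁ B≈0   | _            = 0*u B≈0
    ... | inj₂ _     | inj₁ chain≈0 = u*0 chain≈0
    ... | inj₂ js⊑ks | inj₂ is⊑js   = contradiction (⊑-trans is js ks is⊑js js⊑ks) is⋢ks

  chain-lengthBounded : ∀ N n {B} → (∀ i → LengthBounded 1 (B i)) → LengthBounded n (chain N n B)
  chain-lengthBounded N zero    lb L c ks is is0 with ks ≟ᵛ is
  ... | yes ≡.refl = inj₂ is0
  ... | no  _      = inj₁ refl
  chain-lengthBounded N (suc n) lb L c ks is is0 with ZeroFrom? (suc n ℕ.+ c) ks
  ... | yes ks0 = inj₂ ks0
  ... | no  ks≢ = inj₁ (∑-zero-∈ (box N L) (λ js _ → term js))
    where
    term : ∀ js → _ ≈ 0#
    term js with chain-lengthBounded N n (lb ∘ Fin.suc) L c js is is0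
    ... | inj₁ chain≈0 = u*0 chain≈0
    ... | inj₂ js0 with lb Fin.zero L (n ℕ.+ c) ks js js0
    ...   | inj₁ B≈0 = 0*u B≈0
    ...   | inj₂ ks0 = contradiction ks0 ks≢

  chain-cong : ∀ N n {B B′ : Fin n → Kernel} → (∀ i L ks is → B i L ks is ≈ B′ i L ks is) →
               ∀ L ks is → chain N n B L ks is ≈ chain N n B′ L ks is
  chain-cong N zero    B≈ L ks is = refl
  chain-cong N (suc n) B≈ L ks is =
    ∑-cong (box N L) (λ js → *-cong (B≈ Fin.zero L ks js) (chain-cong N n (B≈ ∘ Fin.suc) L js is))

  -- Every intermediate vector with a nonzero term is contained in `ks` and therefore lies in both
  -- boxes.
  chain-enlarge : ∀ {N N′} n {B} → (∀ i → Descending (B i)) → ∀ L ks is → sum ks < N → sum ks < N′ →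
                  chain N n B L ks is ≈ chain N′ n B L ks is
  chain-enlarge {N} {N′} zero    desc L ks is lt lt′ = refl
  chain-enlarge {N} {N′} (suc n) {B} desc L ks is lt lt′ = begin
    ∑ (box N L) (λ js → B₀ js * chain N n (B ∘ Fin.suc) L js is)
      ≈⟨ ∑-cong (box N L) term ⟩
    ∑ (box N L) (λ js → B₀ js * chain N′ n (B ∘ Fin.suc) L js is)
      ≈⟨ ∑-support _≟ᵛ_ (box-unique N L) (box-unique N′ L)
           (λ js _ js∉ → vanish js (λ ⊑ks → js∉ (∈-box⁺ js (ℕ.≤-<-trans (⊑⇒sum≤ js ks ⊑ks) lt′))))
           (λ js _ js∉ → vanish js (λ ⊑ks → js∉ (∈-box⁺ js (ℕ.≤-<-trans (⊑⇒sum≤ js ks ⊑ks) lt)))) ⟩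
    ∑ (box N′ L) (λ js → B₀ js * chain N′ n (B ∘ Fin.suc) L js is) ∎
    where
    B₀ : Vec ℕ L → Carrier
    B₀ = B Fin.zero L ks
    term : ∀ js → B₀ js * chain N n (B ∘ Fin.suc) L js is ≈ B₀ js * chain N′ n (B ∘ Fin.suc) L js is
    term js with desc Fin.zero L ks js
    ... | inj₁ B≈0 = trans (0*u B≈0) (sym (0*u B≈0))
    ... | inj₂ js⊑ = *-congˡ (chain-enlarge n (desc ∘ Fin.suc) L js is
      (ℕ.≤-<-trans (⊑⇒sum≤ js ks js⊑) lt) (ℕ.≤-<-trans (⊑⇒sum≤ js ks js⊑) lt′))
    vanish : ∀ js → (js ⊑ ks → ⊥) → B₀ js * chain N′ n (B ∘ Fin.suc) L js is ≈ 0#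
    vanish js js⋢ with desc Fin.zero L ks js
    ... | inj₁ B≈0 = 0*u B≈0
    ... | inj₂ js⊑ = contradiction js⊑ js⋢

  -- Containment in `ks ∷ʳ 0` forces the last entry of every intermediate vector to be zero. The
  -- bound is a successor so that the box admits the entry zero.
  chain-stable : ∀ N n {B} → (∀ i → Descending (B i)) → (∀ i → Stable (B i)) → Stable (chain (suc N) n B)
  chain-stable N zero desc stable L ks is =
    []-⇔ (ks ∷ʳ 0 ≟ᵛ is ∷ʳ 0) (ks ≟ᵛ is) (Vec.∷ʳ-injectiveˡ ks is) (≡.cong (_∷ʳ 0))
  chain-stable N (suc n) {B} desc stable L ks is = begin
    ∑ (box (suc N) (suc L)) f
      ≈⟨ ∑-support _≟ᵛ_ (box-unique (suc N) (suc L))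
           (Unique.map⁺ (Vec.∷ʳ-injectiveˡ _ _) (box-unique (suc N) L)) outside inside ⟩
    ∑ (List.map (_∷ʳ 0) (box (suc N) L)) f
      ≈⟨ ∑-map (_∷ʳ 0) (box (suc N) L) f ⟩
    ∑ (box (suc N) L) (λ js → f (js ∷ʳ 0))
      ≈⟨ ∑-cong (box (suc N) L) (λ js → *-cong (stable Fin.zero L ks js)
           (chain-stable N n (desc ∘ Fin.suc) (stable ∘ Fin.suc) L js is)) ⟩
    ∑ (box (suc N) L) (λ js → B Fin.zero L ks js * chain (suc N) n (B ∘ Fin.suc) L js is) ∎
    where
    f : Vec ℕ (suc L) → Carrier
    f js = B Fin.zero (suc L) (ks ∷ʳ 0) js * chain (suc N) n (B ∘ Fin.suc) (suc L) js (is ∷ʳ 0)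
    outside : ∀ js → js ∈ box (suc N) (suc L) → js ∉ List.map (_∷ʳ 0) (box (suc N) L) → f js ≈ 0#
    outside js js∈ js∉ with desc Fin.zero (suc L) (ks ∷ʳ 0) js
    ... | inj₁ B≈0 = 0*u B≈0
    ... | inj₂ js⊑ with ⊑-∷ʳ0 js ks js⊑
    ...   | js′ , ≡.refl = contradiction (∈-map⁺ (_∷ʳ 0) (∷ʳ0∈box js′ js∈)) js∉
    inside : ∀ js → js ∈ List.map (_∷ʳ 0) (box (suc N) L) → js ∉ box (suc N) (suc L) → f js ≈ 0#
    inside js js∈ js∉ with ∈-map⁻ (_∷ʳ 0) js∈
    ... | js′ , js′∈ , ≡.refl = contradiction (∈box∷ʳ0 js′ js′∈) js∉

-- The cross vertex and its passage through the columns

-- The last entry is zero (and b is, if there is no entry): the condition under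
-- which the cross vertex disappears at the right end of a row ending with label b.
data Vacant : ∀ {L} → ℕ → Vec ℕ L → Set where
  []  : Vacant 0 []
  _∷_ : ∀ {L b} i {is : Vec ℕ L} → (∀ b′ → b′ ≤ i → Vacant b′ is) → Vacant b (i ∷ is)

ZeroFrom⇒Vacant : ∀ {L} c b (is : Vec ℕ L) → c < L → ZeroFrom c is → Vacant b is
ZeroFrom⇒Vacant zero    b (.0 ∷ [])      _        (≡.refl , _)   = 0 ∷ λ { .0 z≤n → [] }
ZeroFrom⇒Vacant zero    b (.0 ∷ i ∷ is)  _        (≡.refl , is0) =
  0 ∷ λ b′ _ → ZeroFrom⇒Vacant zero b′ (i ∷ is) (s≤s z≤n) is0
ZeroFrom⇒Vacant (suc c) b (i ∷ is)       (s≤s lt) is0            =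
  i ∷ λ b′ _ → ZeroFrom⇒Vacant c b′ is lt is0

-- Here β = a + 1 - j numbers the block of the ingoing pair of labels, and conservation makes i₂ + β
-- - i₁ the number of the outgoing block. The outgoing bit is at most one, so this number cannot be
-- negative.
no-transfer : ∀ {k a j i₂ i₁ β} → k ℕ.+ j ≤ suc i₂ → i₂ ℕ.+ β < i₁ → i₁ ≤ k ℕ.+ a →
              a ℕ.+ 1 ≡ β ℕ.+ j → ⊥
no-transfer {k} {a} {j} {i₂} {i₁} {β} le β< le′ eq = ℕ.<-irrefl ≡.refl (begin-strict
  k ℕ.+ j ℕ.+ β    ≤⟨ ℕ.+-monoˡ-≤ β le ⟩
  suc (i₂ ℕ.+ β)   ≤⟨ β< ⟩
  i₁               ≤⟨ le′ ⟩
  k ℕ.+ a          <⟨ ℕ.n<1+n _ ⟩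
  suc (k ℕ.+ a)    ≡⟨ ℕS.solve 2 (λ k a → ℕS.con 1 ℕS.:+ (k ℕS.:+ a) ℕS.:= k ℕS.:+ (a ℕS.:+ ℕS.con 1)) ≡.refl k a ⟩
  k ℕ.+ (a ℕ.+ 1)  ≡⟨ ≡.cong (k ℕ.+_) (≡.trans eq (ℕ.+-comm β j)) ⟩
  k ℕ.+ (j ℕ.+ β)  ≡⟨ ≡.sym (ℕ.+-assoc k j β) ⟩
  k ℕ.+ j ℕ.+ β    ∎)
  where open ℕ.≤-Reasoning

no-transfer′ : ∀ {k a j i₂ i₁ β} → i₁ ℕ.+ j ≤ suc k → i₂ ℕ.+ β < i₁ → k ≤ i₂ ℕ.+ a →
               a ℕ.+ 1 ≡ β ℕ.+ j → ⊥
no-transfer′ {k} {a} {j} {i₂} {i₁} {β} le β< le′ eq = ℕ.<-irrefl ≡.refl (begin-strict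
  i₂ ℕ.+ β ℕ.+ j    <⟨ ℕ.+-monoˡ-< j β< ⟩
  i₁ ℕ.+ j          ≤⟨ le ⟩
  suc k             ≤⟨ s≤s le′ ⟩
  suc (i₂ ℕ.+ a)    ≡⟨ ℕS.solve 2 (λ k a → ℕS.con 1 ℕS.:+ (k ℕS.:+ a) ℕS.:= k ℕS.:+ (a ℕS.:+ ℕS.con 1)) ≡.refl i₂ a ⟩
  i₂ ℕ.+ (a ℕ.+ 1)  ≡⟨ ≡.cong (i₂ ℕ.+_) eq ⟩
  i₂ ℕ.+ (β ℕ.+ j)  ≡⟨ ≡.sym (ℕ.+-assoc i₂ β j) ⟩
  i₂ ℕ.+ β ℕ.+ j    ∎)
  where open ℕ.≤-Reasoning

module Zipper {c ℓ₁ ℓ₂} (K : Field c ℓ₁ ℓ₂) (q : Field.Carrier K)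
  (qᵏ#1 : ∀ k → Field._#_ K (Field._^_ K q (suc k)) (Field.1# K)) where

  open Field K hiding (zero)
  open FieldProperties K
  open Functions K q
  open QWeights K q
  open Sums K q
  open Rows K q
  open import Relation.Binary.Reasoning.Setoid setoid

  num : (U y : Carrier) (g j l : ℕ) → Carrier
  num U y g 0 0 = 1# - U * q ^ g
  -- For `g = 0` conservation already excludes such a vertex, so the default value of `pred 0` never
  -- reaches a nonzero weight.
  num U y g 0 1 = - (y - U * q ^ pred g)
  num U y g 1 0 = 1# - q ^ suc g
  num U y g 1 1 = q ^ g - y
  num U y g _ _ = 0#

  -- The weights w in the gauge that turns sums over λ into matrix products.
  ŵ : (U y : Seq) → Weights
  ŵ U y c g j k l = if does (g ℕ.+ j ℕ.≟ k ℕ.+ l) then num (U c) (y c) g j l / (1# - U c) else 0#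

  private
    if-dec-yes : ∀ {p} {P : Set p} (P? : Dec P) {x : Carrier} → P → (if does P? then x else 0#) ≈ x
    if-dec-yes (yes _) _ = refl
    if-dec-yes (no ¬p) p = contradiction p ¬p

    if-dec-no : ∀ {p} {P : Set p} (P? : Dec P) {x : Carrier} → (P → ⊥) → (if does P? then x else 0#) ≈ 0#
    if-dec-no (yes p) ¬p = contradiction p ¬p
    if-dec-no (no _)  _  = refl

  if-yes : ∀ {m n : ℕ} {x : Carrier} → m ≡ n → (if does (m ℕ.≟ n) then x else 0#) ≈ x
  if-yes {m} {n} = if-dec-yes (m ℕ.≟ n)

  if-no : ∀ {m n : ℕ} {x : Carrier} → m ≢ n → (if does (m ℕ.≟ n) then x else 0#) ≈ 0#
  if-no {m} {n} = if-dec-no (m ℕ.≟ n)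

  ŵ-conservative : ∀ U y → Conservative (ŵ U y)
  ŵ-conservative U y c i j k l neq = if-no neq

  num-zero : ∀ U y g j l → num U y g j (suc (suc l)) ≈ 0#
  num-zero U y g 0             l = refl
  num-zero U y g 1             l = refl
  num-zero U y g (suc (suc j)) l = refl

  -- The right label is a bit, which leaves only two candidates for the top label.
  ŵ-zero : ∀ U y c g j k l → g ℕ.+ j ≢ k → g ℕ.+ j ≢ suc k → ŵ U y c g j k l ≈ 0#
  ŵ-zero U y c g j k 0 ≢k ≢1+k = if-no (λ eq → ≢k (≡.trans eq (ℕ.+-identityʳ k)))
  ŵ-zero U y c g j k 1 ≢k ≢1+k = if-no (λ eq → ≢1+k (≡.trans eq (ℕ.+-comm k 1)))
  ŵ-zero U y c g j k (suc (suc l)) ≢k ≢1+k with g ℕ.+ j ℕ.≟ k ℕ.+ suc (suc l)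
  ... | yes eq  = trans (if-yes eq) (0*u (num-zero (U c) (y c) g j l))
  ... | no  neq = if-no neq

  ∑-one : ∀ {N k} (f : ℕ → Carrier) → k < N → (∀ k′ → k′ ≢ k → f k′ ≈ 0#) → ∑ (upTo N) f ≈ f k
  ∑-one {N} f k<N f≈0 = ∑-single (Unique.upTo⁺ N) (∈-upTo⁺ k<N) (λ k′ _ → f≈0 k′)

  ∑-two : ∀ {N k} (f : ℕ → Carrier) → suc k < N → (∀ k′ → k′ ≢ k → k′ ≢ suc k → f k′ ≈ 0#) →
          ∑ (upTo N) f ≈ f k + f (suc k)
  ∑-two {N} {k} f k<N f≈0 = trans
    (∑-support ℕ._≟_ (Unique.upTo⁺ N) (((λ eq → ℕ.1+n≢n (≡.sym eq)) ∷ []) ∷ [] ∷ [])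
      (λ k′ _ k′∉ → f≈0 k′ (λ { ≡.refl → k′∉ (here ≡.refl) }) (λ { ≡.refl → k′∉ (there (here ≡.refl)) }))
      (λ { _ (here ≡.refl) ∉ → contradiction (∈-upTo⁺ (ℕ.<-trans (ℕ.n<1+n k) k<N)) ∉
         ; _ (there (here ≡.refl)) ∉ → contradiction (∈-upTo⁺ k<N) ∉ }))
    (+-congˡ (+-identityʳ _))

  -- Ω c is the spectral quantity u p_c of the w-row in column c, and v = u κ.
  record Parameters : Set (c Level.⊔ ℓ₁ Level.⊔ ℓ₂) where
    field
      x T y Ω : Seq
      v       : Carrier
      xTqᵏ#1  : ∀ c k → x c * T c * q ^ k # 1#
      Ω-suc   : ∀ c → Ω (suc c) ≈ y c * (x c * T c)
      v≈yx    : ∀ c → v ≈ y c * x c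
      Ω#1     : ∀ c → Ω c # 1#

  shift : Parameters → Parameters
  shift P = record
    { x = x ∘ suc ; T = T ∘ suc ; y = y ∘ suc ; Ω = Ω ∘ suc ; v = v
    ; xTqᵏ#1 = λ c → xTqᵏ#1 (suc c) ; Ω-suc = λ c → Ω-suc (suc c)
    ; v≈yx = λ c → v≈yx (suc c) ; Ω#1 = λ c → Ω#1 (suc c) }
    where open Parameters P

  module _ (x T : Seq) (xTqᵏ#1 : ∀ c k → x c * T c * q ^ k # 1#) where

    ω̂ : ℕ → ℕ → ℕ → Carrier
    ω̂ c = Weight.ω qᵏ#1 (x c) (T c) (xTqᵏ#1 c)

    Ŵ : Weights
    Ŵ c i j k l = if does (i ℕ.+ j ℕ.≟ k ℕ.+ l) then ω̂ c i l else 0#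

    Ŵ-conservative : Conservative Ŵ
    Ŵ-conservative c i j k l neq = if-no neq

    Ŵ-rightBounded : RightBounded Ŵ
    Ŵ-rightBounded c i j k l i<l with i ℕ.+ j ℕ.≟ k ℕ.+ l
    ... | yes eq  = trans (if-yes eq) (Weight.ω-> qᵏ#1 (x c) (T c) (xTqᵏ#1 c) i<l)
    ... | no  neq = if-no neq

  module _ (N : ℕ) where

    -- The two sides of the exchange of a w-row and a W-row with ingoing labels j and a.
    LH RH : ∀ {L} → Parameters → (a j : ℕ) (ν μ : Vec ℕ L) → Carrier
    LH {L} P a j ν μ = ∑[ ƛ ∈ box N L ] (row (ŵ Ω y) j ƛ ν * row (Ŵ x T xTqᵏ#1) a ƛ μ)
      where open Parameters P
    RH {L} P a j ν μ = ∑[ ƛ ∈ box N L ] (row (Ŵ x T xTqᵏ#1) a ν ƛ * row (ŵ (Ω ∘ suc) y) j μ ƛ)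
      where open Parameters P

    -- LH⁻ and RH⁻ complete the blocks {(β - 1, 0), (β, 1)} of labels (a, j).
    LH⁻ RH⁻ : ∀ {L} → Parameters → (β : ℕ) (ν μ : Vec ℕ L) → Carrier
    LH⁻ P zero    ν μ = 0#
    LH⁻ P (suc a) ν μ = LH P a 0 ν μ
    RH⁻ P zero    ν μ = 0#
    RH⁻ P (suc a) ν μ = RH P a 0 ν μ

    -- The first column is split off. Since the labels of the w-row are bits, the intermediate label
    -- `k` has at most two values, and the two outgoing pairs of labels belong to one block. The
    -- exchange thus becomes a relation between two-dimensional vectors.
    module Column (P : Parameters) {L : ℕ} (i₁ i₂ : ℕ) (ν μ : Vec ℕ L) where

      open Parameters P
      private
        Ŵ₀ = Ŵ x T xTqᵏ#1
        ω = ω̂ x T xTqᵏ#1 0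

      -- On the right-hand side the w-row has already passed the W-row and carries `Ω ∘ suc`; in the
      -- present column its spectral quantity is that of the next one.
      Θ : Carrier
      Θ = Ω 1

      LHf RHf : (a j k : ℕ) → Carrier
      LHf a j k = ŵ Ω y 0 i₁ j k (i₁ ℕ.+ j ∸ k) * Ŵ₀ 0 i₂ a k (i₂ ℕ.+ a ∸ k)
        * LH (shift P) (i₂ ℕ.+ a ∸ k) (i₁ ℕ.+ j ∸ k) ν μ
      RHf a j k = Ŵ₀ 0 k a i₁ (k ℕ.+ a ∸ i₁) * ŵ (Ω ∘ suc) y 0 k j i₂ (k ℕ.+ j ∸ i₂)
        * RH (shift P) (k ℕ.+ a ∸ i₁) (k ℕ.+ j ∸ i₂) ν μ

      private
        pull : ∀ {a} {A : Set a} (xs : List A) (α β : Carrier) (f g : A → Carrier) →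
               ∑ xs (λ x → α * f x * (β * g x)) ≈ α * β * ∑ xs (λ x → f x * g x)
        pull xs α β f g = trans
          (∑-cong xs (λ x → solve 4 (λ α f β g → α :* f :* (β :* g) := α :* β :* (f :* g)) refl α (f x) β (g x)))
          (sym (*-∑ (α * β) xs _))

      LH-∷ : ∀ a j → LH P a j (i₁ ∷ ν) (i₂ ∷ μ) ≈ ∑ (upTo N) (LHf a j)
      LH-∷ a j = trans (∑-words (upTo N) L _) (∑-cong (upTo N) (λ k → pull (box N L) _ _ _ _))

      RH-∷ : ∀ a j → RH P a j (i₁ ∷ ν) (i₂ ∷ μ) ≈ ∑ (upTo N) (RHf a j)
      RH-∷ a j = trans (∑-words (upTo N) L _) (∑-cong (upTo N) (λ k → pull (box N L) _ _ _ _))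

      private
        ∸-≡ : ∀ {m k b} → m ≡ k ℕ.+ b → m ∸ k ≡ b
        ∸-≡ {k = k} {b} eq = ≡.trans (≡.cong (_∸ k) eq) (ℕ.m+n∸m≡n k b)

        clear : ∀ {u n w r} → u # 0# → u * (n / u * w * r) ≈ w * n * r
        clear {u} {n} {w} {r} u#0 = begin
          u * (n * u ⁻¹ * w * r)
            ≈⟨ solve 5 (λ u n i w r → u :* (n :* i :* w :* r) := u :* i :* (w :* n :* r)) refl u n (u ⁻¹) w r ⟩
          u * u ⁻¹ * (w * n * r)  ≈⟨ *-congʳ (⁻¹-inverse u#0) ⟩
          1# * (w * n * r)        ≈⟨ *-identityˡ _ ⟩
          w * n * r               ∎

        clear′ : ∀ {u n w r} → u # 0# → u * (w * (n / u) * r) ≈ w * n * r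
        clear′ {u} {n} {w} {r} u#0 = trans (*-congˡ (*-congʳ (*-comm w (n / u)))) (clear u#0)

        LHf-≡ : ∀ {a j k b l} → i₂ ℕ.+ a ≡ k ℕ.+ b → i₁ ℕ.+ j ≡ k ℕ.+ l →
          (1# - Ω 0) * LHf a j k ≈ ω i₂ b * num (Ω 0) (y 0) i₁ j l * LH (shift P) b l ν μ
        LHf-≡ {a} {j} {k} {b} {l} eq eq′ = go (∸-≡ eq) (∸-≡ eq′)
          where
          go : ∀ {b′ l′} → b′ ≡ b → l′ ≡ l →
            (1# - Ω 0) * (ŵ Ω y 0 i₁ j k l′ * Ŵ₀ 0 i₂ a k b′ * LH (shift P) b′ l′ ν μ)
            ≈ ω i₂ b * num (Ω 0) (y 0) i₁ j l * LH (shift P) b l ν μ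
          go ≡.refl ≡.refl = trans (*-congˡ (*-congʳ (*-cong (if-yes eq′) (if-yes eq)))) (clear (1-x#0 (Ω#1 0)))

        RHf-≡ : ∀ {a j k b l} → k ℕ.+ a ≡ i₁ ℕ.+ b → k ℕ.+ j ≡ i₂ ℕ.+ l →
          (1# - Θ) * RHf a j k ≈ ω k b * num Θ (y 0) k j l * RH (shift P) b l ν μ
        RHf-≡ {a} {j} {k} {b} {l} eq eq′ = go (∸-≡ eq) (∸-≡ eq′)
          where
          go : ∀ {b′ l′} → b′ ≡ b → l′ ≡ l →
            (1# - Θ) * (Ŵ₀ 0 k a i₁ b′ * ŵ (Ω ∘ suc) y 0 k j i₂ l′ * RH (shift P) b′ l′ ν μ)
            ≈ ω k b * num Θ (y 0) k j l * RH (shift P) b l ν μ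
          go ≡.refl ≡.refl = trans (*-congˡ (*-congʳ (*-cong (if-yes eq) (if-yes eq′)))) (clear′ (1-x#0 (Ω#1 1)))

        LHf-0ˡ : ∀ {a j k} → i₁ ℕ.+ j ≢ k → i₁ ℕ.+ j ≢ suc k → LHf a j k ≈ 0#
        LHf-0ˡ {a} {j} {k} ≢k ≢1+k = 0*u (0*u (ŵ-zero Ω y 0 i₁ j k _ ≢k ≢1+k))

        RHf-0ʳ : ∀ {a j k} → k ℕ.+ j ≢ i₂ → k ℕ.+ j ≢ suc i₂ → RHf a j k ≈ 0#
        RHf-0ʳ {a} {j} {k} ≢i ≢1+i = 0*u (u*0 (ŵ-zero (Ω ∘ suc) y 0 k j i₂ _ ≢i ≢1+i))

        LHf-0ʳ : ∀ {a j k} → i₂ ℕ.+ a < k → LHf a j k ≈ 0#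
        LHf-0ʳ {a} {j} {k} lt = 0*u (u*0 (if-no
          (λ eq → ℕ.<⇒≱ lt (ℕ.≤-trans (ℕ.m≤m+n k _) (ℕ.≤-reflexive (≡.sym eq))))))

        RHf-0ˡ : ∀ {a j k} → k ℕ.+ a < i₁ → RHf a j k ≈ 0#
        RHf-0ˡ {a} {j} {k} lt = 0*u (0*u (if-no
          (λ eq → ℕ.<⇒≱ lt (ℕ.≤-trans (ℕ.m≤m+n i₁ _) (ℕ.≤-reflexive (≡.sym eq))))))

      module _ (i₁<N : suc i₁ < N) (i₂<N : suc i₂ < N) where

        private
          +0 : ∀ n → n ℕ.+ 0 ≡ n
          +0 = ℕ.+-identityʳ
          +1 : ∀ n → n ℕ.+ 1 ≡ suc n
          +1 n = ℕ.+-comm n 1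

          two : ∀ {k} {f : ℕ → Carrier} {u} → suc k < N → (∀ k′ → k′ ≢ k → k′ ≢ suc k → f k′ ≈ 0#) →
                u * ∑ (upTo N) f ≈ u * f k + u * f (suc k)
          two lt f≈0 = trans (*-congˡ (∑-two _ lt f≈0)) (distribˡ _ _ _)

          one : ∀ {k} {f : ℕ → Carrier} {u} → k < N → (∀ k′ → k′ ≢ k → f k′ ≈ 0#) →
                u * ∑ (upTo N) f ≈ u * f k
          one lt f≈0 = *-congˡ (∑-one _ lt f≈0)

          pred< : ∀ {n} → suc n < N → n < N
          pred< lt = ℕ.<-trans (ℕ.n<1+n _) lt

        -- The term with outgoing label β - 1; both sides vanish for β = 0.
        RHf-⁻ : ∀ {a j k β} → k ℕ.+ suc a ≡ i₁ ℕ.+ β → k ℕ.+ j ≡ i₂ ℕ.+ 0 →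
          (1# - Θ) * RHf a j k ≈ ω k (pred β) * num Θ (y 0) k j 0 * RH⁻ (shift P) β ν μ
        RHf-⁻ {a} {j} {k} {zero}  eq eq′ = trans (u*0 (RHf-0ˡ (ℕ.≤-reflexive
          (≡.trans (≡.sym (ℕ.+-suc k a)) (≡.trans eq (+0 i₁)))))) (sym (u*0 refl))
        RHf-⁻ {a} {j} {k} {suc b} eq eq′ = RHf-≡
          (ℕ.suc-injective (≡.trans (≡.sym (ℕ.+-suc k a)) (≡.trans eq (ℕ.+-suc i₁ b)))) eq′

        LHf-⁻ : ∀ {a j k β} → i₂ ℕ.+ suc a ≡ k ℕ.+ β → i₁ ℕ.+ j ≡ k ℕ.+ 0 →
          (1# - Ω 0) * LHf a j k ≈ ω i₂ (pred β) * num (Ω 0) (y 0) i₁ j 0 * LH⁻ (shift P) β ν μ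
        LHf-⁻ {a} {j} {k} {zero}  eq eq′ = trans (u*0 (LHf-0ʳ (ℕ.≤-reflexive
          (≡.trans (≡.sym (ℕ.+-suc i₂ a)) (≡.trans eq (+0 k)))))) (sym (u*0 refl))
        LHf-⁻ {a} {j} {k} {suc b} eq eq′ = LHf-≡
          (ℕ.suc-injective (≡.trans (≡.sym (ℕ.+-suc i₂ a)) (≡.trans eq (ℕ.+-suc k b)))) eq′

        RH₀ : ∀ {a β} → i₂ ℕ.+ suc a ≡ i₁ ℕ.+ β →
          (1# - Θ) * RH P a 0 (i₁ ∷ ν) (i₂ ∷ μ) ≈
            ω i₂ (pred β) * (1# - Θ * q ^ i₂) * RH⁻ (shift P) β ν μ
            + ω (suc i₂) β * - (y 0 - Θ * q ^ i₂) * RH (shift P) β 1 ν μ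
        RH₀ {a} {β} eq = trans (*-congˡ (RH-∷ a 0)) (trans
          (two i₂<N (λ k ≢i ≢1+i → RHf-0ʳ (λ e → ≢i (≡.trans (≡.sym (+0 k)) e)) (λ e → ≢1+i (≡.trans (≡.sym (+0 k)) e))))
          (+-cong (RHf-⁻ eq ≡.refl) (RHf-≡ (≡.trans (≡.sym (ℕ.+-suc i₂ a)) eq) (≡.trans (+0 (suc i₂)) (≡.sym (+1 i₂))))))

        RH₁ : ∀ {β β′} → i₂ ℕ.+ β ≡ i₁ ℕ.+ β′ →
          (1# - Θ) * RH P β 1 (i₁ ∷ ν) (i₂ ∷ μ) ≈
            ω (pred i₂) (pred β′) * (1# - q ^ i₂) * RH⁻ (shift P) β′ ν μ
            + ω i₂ β′ * (q ^ i₂ - y 0) * RH (shift P) β′ 1 ν μ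
        RH₁ {β} {β′} eq = trans (*-congˡ (RH-∷ β 1)) (go i₂ ≡.refl)
          where
          go : ∀ n → i₂ ≡ n → (1# - Θ) * ∑ (upTo N) (RHf β 1) ≈
            ω (pred i₂) (pred β′) * (1# - q ^ i₂) * RH⁻ (shift P) β′ ν μ
            + ω i₂ β′ * (q ^ i₂ - y 0) * RH (shift P) β′ 1 ν μ
          -- For `i₂ = 0` only `k = 0` contributes. The absent term is restored with the coefficient
          -- 1 - q^0, which is zero.
          go zero e = trans
            (one (ℕ.≤-<-trans z≤n i₂<N) (λ k k≢0 → RHf-0ʳ
              (λ e′ → ℕ.1+n≢0 (≡.trans (≡.sym (+1 k)) (≡.trans e′ e)))
              (λ e′ → k≢0 (ℕ.suc-injective (≡.trans (≡.sym (+1 k)) (≡.trans e′ (≡.cong suc e)))))))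
            (trans (RHf-≡ (≡.trans (≡.cong (ℕ._+ β) (≡.sym e)) eq) (≡.cong (ℕ._+ 1) (≡.sym e)))
              (trans (sym (+-identityˡ _)) (+-cong
                (sym (0*u (u*0 (trans (+-congˡ (-‿cong (reflexive (≡.cong (q ^_) e)))) (-‿inverseʳ 1#)))))
                (*-congʳ (reflexive (≡.cong (λ n → ω n β′ * (q ^ n - y 0)) (≡.sym e)))))))
          go (suc i′) e = trans
            (two (≡.subst (_< N) e (pred< i₂<N)) (λ k ≢i ≢1+i → RHf-0ʳ
              (λ e′ → ≢i (ℕ.suc-injective (≡.trans (≡.sym (+1 k)) (≡.trans e′ e))))
              (λ e′ → ≢1+i (≡.trans (ℕ.suc-injective (≡.trans (≡.sym (+1 k)) e′)) e))))
            (+-cong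
              (trans (RHf-⁻ {β = β′} (≡.trans (ℕ.+-suc i′ β) (≡.trans (≡.cong (ℕ._+ β) (≡.sym e)) eq))
                       (≡.trans (+1 i′) (≡.trans (≡.sym e) (≡.sym (+0 i₂)))))
                (*-congʳ (reflexive (≡.cong (λ n → ω (pred n) (pred β′) * (1# - q ^ n)) (≡.sym e)))))
              (trans (RHf-≡ (≡.trans (≡.cong (ℕ._+ β) (≡.sym e)) eq) (≡.cong (ℕ._+ 1) (≡.sym e)))
                (*-congʳ (reflexive (≡.cong (λ n → ω n β′ * (q ^ n - y 0)) (≡.sym e))))))

        LH₁ : ∀ {β β′} → i₂ ℕ.+ β ≡ i₁ ℕ.+ β′ →
          (1# - Ω 0) * LH P β 1 (i₁ ∷ ν) (i₂ ∷ μ) ≈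
            ω i₂ (pred β′) * (1# - q ^ suc i₁) * LH⁻ (shift P) β′ ν μ
            + ω i₂ β′ * (q ^ i₁ - y 0) * LH (shift P) β′ 1 ν μ
        LH₁ {β} {β′} eq = trans (*-congˡ (LH-∷ β 1)) (trans
          (two i₁<N (λ k ≢i ≢1+i → LHf-0ˡ (λ e → ≢1+i (≡.trans (≡.sym e) (+1 i₁)))
            (λ e → ≢i (ℕ.suc-injective (≡.trans (≡.sym e) (+1 i₁))))))
          (trans (+-comm _ _) (+-cong
            (LHf-⁻ {β = β′} (≡.trans (ℕ.+-suc i₂ β) (≡.cong suc eq)) (≡.trans (+1 i₁) (≡.sym (+0 (suc i₁)))))
            (LHf-≡ eq ≡.refl))))

        LH₀ : ∀ {a β} → i₂ ℕ.+ suc a ≡ i₁ ℕ.+ β →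
          (1# - Ω 0) * LH P a 0 (i₁ ∷ ν) (i₂ ∷ μ) ≈
            ω i₂ (pred β) * (1# - Ω 0 * q ^ i₁) * LH⁻ (shift P) β ν μ
            + ω i₂ β * - (y 0 - Ω 0 * q ^ pred i₁) * LH (shift P) β 1 ν μ
        LH₀ {a} {β} eq = trans (*-congˡ (LH-∷ a 0)) (go i₁ ≡.refl)
          where
          go : ∀ n → i₁ ≡ n → (1# - Ω 0) * ∑ (upTo N) (LHf a 0) ≈
            ω i₂ (pred β) * (1# - Ω 0 * q ^ i₁) * LH⁻ (shift P) β ν μ
            + ω i₂ β * - (y 0 - Ω 0 * q ^ pred i₁) * LH (shift P) β 1 ν μ
          -- For `i₁ = 0` only `k = 0` contributes. The absent term is restored with the factor
          -- `ω i₂ β`, which vanishes because β = i₂ + a + 1 exceeds `i₂`.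
          go zero e = trans
            (one (pred< i₁<N) (λ k k≢i₁ → LHf-0ˡ (λ e′ → k≢i₁ (≡.trans (≡.sym e′) (+0 i₁)))
              (λ e′ → ℕ.1+n≢0 (≡.trans (≡.sym e′) (≡.trans (+0 i₁) e)))))
            (trans (LHf-⁻ {β = β} eq ≡.refl) (trans (sym (+-identityʳ _)) (+-congˡ
              (sym (0*u (0*u (Weight.ω-> qᵏ#1 (x 0) (T 0) (xTqᵏ#1 0)
                (ℕ.≤-trans (s≤s (ℕ.m≤m+n i₂ a)) (ℕ.≤-reflexive
                  (≡.trans (≡.sym (ℕ.+-suc i₂ a)) (≡.trans eq (≡.cong (ℕ._+ β) e))))))))))))
          go (suc i′) e = trans
            (two (≡.subst (_< N) e (pred< i₁<N)) (λ k ≢i ≢1+i → LHf-0ˡ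
              (λ e′ → ≢1+i (≡.trans (≡.sym e′) (≡.trans (+0 i₁) e)))
              (λ e′ → ≢i (ℕ.suc-injective (≡.trans (≡.sym e′) (≡.trans (+0 i₁) e))))))
            (trans (+-comm _ _) (+-cong
              (LHf-⁻ {β = β} (≡.trans eq (≡.cong (ℕ._+ β) e)) (≡.cong (ℕ._+ 0) e))
              (LHf-≡ (ℕ.suc-injective (≡.trans (≡.sym (ℕ.+-suc i₂ a)) (≡.trans eq (≡.cong (ℕ._+ β) e))))
                (≡.trans (+0 i₁) (≡.trans e (≡.sym (+1 i′)))))))

      -- No transfer is possible if the conservation law would require a negative outgoing block.
      module _ {β} (β< : i₂ ℕ.+ β < i₁) where

        RH-vanishes : ∀ a j → a ℕ.+ 1 ≡ β ℕ.+ j → RH P a j (i₁ ∷ ν) (i₂ ∷ μ) ≈ 0#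
        RH-vanishes a j eq = trans (RH-∷ a j) (∑-zero-∈ (upTo N) (λ k _ → term k))
          where
          term : ∀ k → RHf a j k ≈ 0#
          term k with k ℕ.+ a ℕ.<? i₁
          ... | yes lt = RHf-0ˡ lt
          ... | no ≮ = RHf-0ʳ (λ e → absurd (ℕ.≤-trans (ℕ.≤-reflexive e) (ℕ.n≤1+n i₂))) (λ e → absurd (ℕ.≤-reflexive e))
            where
            absurd : k ℕ.+ j ≤ suc i₂ → ⊥
            absurd le = no-transfer {k} {a} {j} le β< (ℕ.≮⇒≥ ≮) eq

        LH-vanishes : ∀ a j → a ℕ.+ 1 ≡ β ℕ.+ j → LH P a j (i₁ ∷ ν) (i₂ ∷ μ) ≈ 0#
        LH-vanishes a j eq = trans (LH-∷ a j) (∑-zero-∈ (upTo N) (λ k _ → term k))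
          where
          term : ∀ k → LHf a j k ≈ 0#
          term k with i₂ ℕ.+ a ℕ.<? k
          ... | yes lt = LHf-0ʳ lt
          ... | no ≮ = LHf-0ˡ (λ e → absurd (ℕ.≤-trans (ℕ.≤-reflexive e) (ℕ.n≤1+n k))) (λ e → absurd (ℕ.≤-reflexive e))
            where
            absurd : i₁ ℕ.+ j ≤ suc k → ⊥
            absurd le = no-transfer′ {a = a} le β< (ℕ.≮⇒≥ ≮) eq

    private
      -- Both sides are expanded in `X₀` and `X₁`, the right-hand sums over the remaining columns,
      -- and `h₀` and `h₁` compare coefficients. The block β = 0 has only one pair of labels: `h₀`
      -- keeps the factor `X₀`, which is zero when the outgoing block is that one, and the
      -- hypothesis on `R₀` keeps the factor `r`, which is zero when the ingoing block is that one.
      assemble : ∀ {u t r s R₀ R₁ Λ X₀ X₁ Y₀ Y₁ w₀ w₁ a₀ a₁ b₀ b₁ c₀ c₁ d₀ d₁ e₀ e₁} → u # 0# →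
        r * (u * R₀) ≈ r * (a₀ * X₀ + a₁ * X₁) → u * R₁ ≈ b₀ * X₀ + b₁ * X₁ →
        t * Λ ≈ w₀ * c₀ * Y₀ + w₁ * c₁ * Y₁ →
        u * (w₀ * Y₀) ≈ d₀ * X₀ + d₁ * X₁ → u * (w₁ * Y₁) ≈ e₀ * X₀ + e₁ * X₁ →
        (r * a₀ + s * b₀) * X₀ ≈ (c₀ * d₀ + c₁ * e₀) * X₀ → r * a₁ + s * b₁ ≈ c₀ * d₁ + c₁ * e₁ →
        r * R₀ + s * R₁ ≈ t * Λ
      assemble {u} {t} {r} {s} {R₀} {R₁} {Λ} {X₀} {X₁} {Y₀} {Y₁} {w₀} {w₁} {a₀} {a₁} {b₀} {b₁} {c₀} {c₁} {d₀} {d₁} {e₀} {e₁}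
        u#0 hR₀ hR₁ hΛ hY₀ hY₁ h₀ h₁ = *-cancelˡ u#0 (begin
        u * (r * R₀ + s * R₁)
          ≈⟨ solve 5 (λ u r s R₀ R₁ → u :* (r :* R₀ :+ s :* R₁) := r :* (u :* R₀) :+ s :* (u :* R₁)) refl u r s R₀ R₁ ⟩
        r * (u * R₀) + s * (u * R₁)
          ≈⟨ +-cong hR₀ (*-congˡ hR₁) ⟩
        r * (a₀ * X₀ + a₁ * X₁) + s * (b₀ * X₀ + b₁ * X₁)
          ≈⟨ solve 8 (λ r s a₀ a₁ b₀ b₁ X₀ X₁ → r :* (a₀ :* X₀ :+ a₁ :* X₁) :+ s :* (b₀ :* X₀ :+ b₁ :* X₁)
               := (r :* a₀ :+ s :* b₀) :* X₀ :+ (r :* a₁ :+ s :* b₁) :* X₁) refl r s a₀ a₁ b₀ b₁ X₀ X₁ ⟩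
        (r * a₀ + s * b₀) * X₀ + (r * a₁ + s * b₁) * X₁
          ≈⟨ +-cong h₀ (*-congʳ h₁) ⟩
        (c₀ * d₀ + c₁ * e₀) * X₀ + (c₀ * d₁ + c₁ * e₁) * X₁
          ≈⟨ solve 8 (λ r s a₀ a₁ b₀ b₁ X₀ X₁ → r :* (a₀ :* X₀ :+ a₁ :* X₁) :+ s :* (b₀ :* X₀ :+ b₁ :* X₁)
               := (r :* a₀ :+ s :* b₀) :* X₀ :+ (r :* a₁ :+ s :* b₁) :* X₁) refl c₀ c₁ d₀ d₁ e₀ e₁ X₀ X₁ ⟨
        c₀ * (d₀ * X₀ + d₁ * X₁) + c₁ * (e₀ * X₀ + e₁ * X₁)
          ≈⟨ +-cong (*-congˡ hY₀) (*-congˡ hY₁) ⟨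
        c₀ * (u * (w₀ * Y₀)) + c₁ * (u * (w₁ * Y₁))
          ≈⟨ solve 7 (λ u c₀ c₁ w₀ w₁ Y₀ Y₁ → c₀ :* (u :* (w₀ :* Y₀)) :+ c₁ :* (u :* (w₁ :* Y₁))
               := u :* (w₀ :* c₀ :* Y₀ :+ w₁ :* c₁ :* Y₁)) refl u c₀ c₁ w₀ w₁ Y₀ Y₁ ⟩
        u * (w₀ * c₀ * Y₀ + w₁ * c₁ * Y₁)
          ≈⟨ *-congˡ hΛ ⟨
        u * (t * Λ) ∎)

    -- `zip₀′` and `zip₁′` are the induction hypotheses for the remaining columns. The second is
    -- restricted to the labels that a W-vertex with bottom label `i₂` can send to the right; for
    -- all other β the factor `ω i₂ β` is zero. Through this restriction the condition `Vacant` is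
    -- propagated.
    module Step (P : Parameters) {L : ℕ} (i₁ i₂ : ℕ) (ν μ : Vec ℕ L)
      (i₁<N : suc i₁ < N) (i₂<N : suc i₂ < N)
      (zip₀′ : ∀ a → (1# - Parameters.Ω P 1 * q ^ a) * RH (shift P) a 0 ν μ + - (Parameters.v P - Parameters.Ω P 1 * q ^ a) * RH (shift P) (suc a) 1 ν μ
                     ≈ (1# - Parameters.Ω P 1) * LH (shift P) a 0 ν μ)
      (zip₁′ : ∀ β → β ≤ i₂ → (1# - q ^ β) * RH⁻ (shift P) β ν μ + (q ^ β - Parameters.v P) * RH (shift P) β 1 ν μ
                     ≈ (1# - Parameters.Ω P 1) * LH (shift P) β 1 ν μ) where

      open Parameters P
      open Column P i₁ i₂ ν μ
      private
        module W₀ = Weight qᵏ#1 (x 0) (T 0) (xTqᵏ#1 0)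
        open W₀ using (ω; ω->; ω′; ω′-zero; ω′-suc)
        open W₀.YangBaxter (y 0) (Ω 0)

        -- Since `x 0 * T 0` is s² of the W-vertex, this ties the spectral quantity behind the
        -- column to the weights in it. Together with v = y x it lets the Yang-Baxter equation
        -- apply.
        Θ≈ : Θ ≈ y 0 * (x 0 * T 0)
        Θ≈ = Ω-suc 0

        Θ#0 : 1# - Θ # 0#
        Θ#0 = 1-x#0 (Ω#1 1)

        X₀ Y₀ X₁ Y₁ : ℕ → Carrier
        X₀ β = RH⁻ (shift P) β ν μ
        Y₀ β = LH⁻ (shift P) β ν μ
        X₁ β = RH (shift P) β 1 ν μ
        Y₁ β = LH (shift P) β 1 ν μ

        -- Multiplication by the vertex weight turns v - Θ q^(β-1) into `ω′`, an expression that
        -- also makes sense at β = 0, where it vanishes together with the rest.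
        ih₀ : ∀ β → (1# - Θ) * (ω i₂ (pred β) * Y₀ β)
                    ≈ ω i₂ (pred β) * (1# - Θ * q ^ pred β) * X₀ β + - ω′ (y 0) i₂ β * X₁ β
        ih₀ zero = begin
          (1# - Θ) * (ω i₂ 0 * 0#)
            ≈⟨ solve 4 (λ t w s X → (:1 :- t) :* (w :* :0) := w :* s :* :0 :+ :- :0 :* X) refl Θ (ω i₂ 0) (1# - Θ * q ^ 0) (X₁ 0) ⟩
          ω i₂ 0 * (1# - Θ * q ^ 0) * 0# + - 0# * X₁ 0
            ≈⟨ +-congˡ (*-congʳ (-‿cong (ω′-zero (y 0) i₂))) ⟨
          ω i₂ 0 * (1# - Θ * q ^ 0) * 0# + - ω′ (y 0) i₂ 0 * X₁ 0 ∎
        ih₀ (suc b) = begin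
          (1# - Θ) * (ω i₂ b * Y₀ (suc b))
            ≈⟨ solve 3 (λ u w Y → u :* (w :* Y) := w :* (u :* Y)) refl _ _ _ ⟩
          ω i₂ b * ((1# - Θ) * Y₀ (suc b))
            ≈⟨ *-congˡ (zip₀′ b) ⟨
          ω i₂ b * ((1# - Θ * q ^ b) * X₀ (suc b) + - (v - Θ * q ^ b) * X₁ (suc b))
            ≈⟨ solve 5 (λ w r s X₀ X₁ → w :* (r :* X₀ :+ :- s :* X₁) := w :* r :* X₀ :+ :- (w :* s) :* X₁) refl _ _ _ _ _ ⟩
          ω i₂ b * (1# - Θ * q ^ b) * X₀ (suc b) + - (ω i₂ b * (v - Θ * q ^ b)) * X₁ (suc b)
            ≈⟨ +-congˡ (*-congʳ (-‿cong (*-congˡ (+-cong (v≈yx 0) (-‿cong (*-congʳ Θ≈)))))) ⟩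
          ω i₂ b * (1# - Θ * q ^ b) * X₀ (suc b) + - (ω i₂ b * (y 0 * x 0 - y 0 * (x 0 * T 0) * q ^ b)) * X₁ (suc b)
            ≈⟨ +-congˡ (*-congʳ (-‿cong (ω′-suc (y 0) i₂ b))) ⟨
          ω i₂ b * (1# - Θ * q ^ b) * X₀ (suc b) + - ω′ (y 0) i₂ (suc b) * X₁ (suc b) ∎

        ih₁ : ∀ β → (1# - Θ) * (ω i₂ β * Y₁ β)
                    ≈ ω i₂ β * (1# - q ^ β) * X₀ β + ω i₂ β * (q ^ β - v) * X₁ β
        ih₁ β = begin
          (1# - Θ) * (ω i₂ β * Y₁ β)    ≈⟨ solve 3 (λ u w Y → u :* (w :* Y) := w :* (u :* Y)) refl _ _ _ ⟩
          ω i₂ β * ((1# - Θ) * Y₁ β)    ≈⟨ inside ⟨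
          ω i₂ β * ((1# - q ^ β) * X₀ β + (q ^ β - v) * X₁ β)
            ≈⟨ solve 5 (λ w r s X₀ X₁ → w :* (r :* X₀ :+ s :* X₁) := w :* r :* X₀ :+ w :* s :* X₁) refl _ _ _ _ _ ⟩
          ω i₂ β * (1# - q ^ β) * X₀ β + ω i₂ β * (q ^ β - v) * X₁ β ∎
          where
          inside : ω i₂ β * ((1# - q ^ β) * X₀ β + (q ^ β - v) * X₁ β) ≈ ω i₂ β * ((1# - Θ) * Y₁ β)
          inside with β ℕ.≤? i₂
          ... | yes β≤ = *-congˡ (zip₁′ β β≤)
          ... | no  β≰ = trans (0*u (ω-> (ℕ.≰⇒> β≰))) (sym (0*u (ω-> (ℕ.≰⇒> β≰))))

        ≈Θ : ∀ {Q} → 1# - Θ * Q ≈ 1# - y 0 * (x 0 * T 0) * Q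
        ≈Θ = +-congˡ (-‿cong (*-congʳ Θ≈))

        -Θ : ∀ {Q} → y 0 - Θ * Q ≈ y 0 - y 0 * (x 0 * T 0) * Q
        -Θ = +-congˡ (-‿cong (*-congʳ Θ≈))

        -v : ∀ {z} → z - v ≈ z - y 0 * x 0
        -v = +-congˡ (-‿cong (v≈yx 0))

        entry₀₀ : ∀ a β → i₂ ℕ.+ suc a ≡ i₁ ℕ.+ β →
          ((1# - Ω 0 * q ^ a) * (ω i₂ (pred β) * (1# - Θ * q ^ i₂))
            + - (v - Ω 0 * q ^ a) * (ω (pred i₂) (pred β) * (1# - q ^ i₂))) * X₀ β
          ≈ ((1# - Ω 0 * q ^ i₁) * (ω i₂ (pred β) * (1# - Θ * q ^ pred β))
            + - (y 0 - Ω 0 * q ^ pred i₁) * (ω i₂ β * (1# - q ^ β))) * X₀ β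
        entry₀₀ a zero    eq = trans (u*0 refl) (sym (u*0 refl))
        entry₀₀ a (suc b) eq = *-congʳ (begin
          (1# - Ω 0 * q ^ a) * (ω i₂ b * (1# - Θ * q ^ i₂)) + - (v - Ω 0 * q ^ a) * (ω (pred i₂) b * (1# - q ^ i₂))
            ≈⟨ +-cong (*-congˡ (*-congˡ ≈Θ)) (*-congʳ (-‿cong (+-congʳ (v≈yx 0)))) ⟩
          _ ≈⟨ solve 3 (λ r s t → r :+ :- s :* t := r :- s :* t) refl _ _ _ ⟩
          _ ≈⟨ yb₀₀ i₂ a i₁ b (ℕ.suc-injective (≡.trans (≡.sym (ℕ.+-suc i₂ a)) (≡.trans eq (ℕ.+-suc i₁ b)))) ⟩
          _ ≈⟨ solve 3 (λ r s t → r :+ :- s :* t := r :- s :* t) refl _ _ _ ⟨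
          _ ≈⟨ +-congʳ (*-congˡ (*-congˡ ≈Θ)) ⟨
          (1# - Ω 0 * q ^ i₁) * (ω i₂ b * (1# - Θ * q ^ b)) + - (y 0 - Ω 0 * q ^ pred i₁) * (ω i₂ (suc b) * (1# - q ^ suc b)) ∎)

        entry₀₁ : ∀ a β → i₂ ℕ.+ suc a ≡ i₁ ℕ.+ β →
          (1# - Ω 0 * q ^ a) * (ω (suc i₂) β * - (y 0 - Θ * q ^ i₂)) + - (v - Ω 0 * q ^ a) * (ω i₂ β * (q ^ i₂ - y 0))
          ≈ (1# - Ω 0 * q ^ i₁) * - ω′ (y 0) i₂ β + - (y 0 - Ω 0 * q ^ pred i₁) * (ω i₂ β * (q ^ β - v))
        entry₀₁ a β eq = begin
          _ ≈⟨ +-cong (*-congˡ (*-congˡ (-‿cong -Θ))) (*-congʳ (-‿cong (+-congʳ (v≈yx 0)))) ⟩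
          _ ≈⟨ solve 5 (λ r w z s t → r :* (w :* :- z) :+ :- s :* t := :- (r :* (w :* z)) :- s :* t) refl _ _ _ _ _ ⟩
          _ ≈⟨ yb₀₁ i₂ a i₁ β eq ⟩
          _ ≈⟨ solve 4 (λ r w s t → r :* :- w :+ :- s :* t := :- (r :* w) :- s :* t) refl _ _ _ _ ⟨
          _ ≈⟨ +-congˡ (*-congˡ (*-congˡ -v)) ⟨
          _ ∎

        entry₁₀ : ∀ β β′ → i₂ ℕ.+ β ≡ i₁ ℕ.+ β′ →
          ((1# - q ^ β) * (ω i₂ (pred β′) * (1# - Θ * q ^ i₂))
            + (q ^ β - v) * (ω (pred i₂) (pred β′) * (1# - q ^ i₂))) * X₀ β′
          ≈ ((1# - q ^ suc i₁) * (ω i₂ (pred β′) * (1# - Θ * q ^ pred β′))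
            + (q ^ i₁ - y 0) * (ω i₂ β′ * (1# - q ^ β′))) * X₀ β′
        entry₁₀ β zero    eq = trans (u*0 refl) (sym (u*0 refl))
        entry₁₀ β (suc b) eq = *-congʳ (begin
          _ ≈⟨ +-cong (*-congˡ (*-congˡ ≈Θ)) (*-congʳ -v) ⟩
          _ ≈⟨ yb₁₀ i₂ β i₁ b eq ⟩
          _ ≈⟨ +-congʳ (*-congˡ (*-congˡ ≈Θ)) ⟨
          _ ∎)

        entry₁₁ : ∀ β β′ → i₂ ℕ.+ β ≡ i₁ ℕ.+ β′ →
          (1# - q ^ β) * (ω (suc i₂) β′ * - (y 0 - Θ * q ^ i₂)) + (q ^ β - v) * (ω i₂ β′ * (q ^ i₂ - y 0))
          ≈ (1# - q ^ suc i₁) * - ω′ (y 0) i₂ β′ + (q ^ i₁ - y 0) * (ω i₂ β′ * (q ^ β′ - v))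
        entry₁₁ β β′ eq = begin
          _ ≈⟨ +-cong (*-congˡ (*-congˡ (-‿cong -Θ))) (*-congʳ -v) ⟩
          _ ≈⟨ solve 4 (λ r w z t → r :* (w :* :- z) :+ t := :- (r :* (w :* z)) :+ t) refl _ _ _ _ ⟩
          _ ≈⟨ yb₁₁ i₂ β i₁ β′ eq ⟩
          _ ≈⟨ solve 3 (λ r w t → r :* :- w :+ t := :- (r :* w) :+ t) refl _ _ _ ⟨
          _ ≈⟨ +-congˡ (*-congˡ (*-congˡ -v)) ⟨
          _ ∎

      step₀ : ∀ a → (1# - Ω 0 * q ^ a) * RH P a 0 (i₁ ∷ ν) (i₂ ∷ μ) + - (v - Ω 0 * q ^ a) * RH P (suc a) 1 (i₁ ∷ ν) (i₂ ∷ μ)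
                    ≈ (1# - Ω 0) * LH P a 0 (i₁ ∷ ν) (i₂ ∷ μ)
      step₀ a with i₁ ℕ.≤? i₂ ℕ.+ suc a
      ... | yes le = assemble Θ#0 (*-congˡ (RH₀ i₁<N i₂<N {β = β} eq)) (RH₁ i₁<N i₂<N eq) (LH₀ i₁<N i₂<N eq)
                       (ih₀ β) (ih₁ β) (entry₀₀ a β eq) (entry₀₁ a β eq)
        where
        -- The ingoing pair (a, 0) lies in block a + 1, and conservation in the column yields this
        -- outgoing block. If the difference were negative, both sides would vanish, as in the other
        -- case.
        β : ℕ
        β = i₂ ℕ.+ suc a ∸ i₁
        eq : i₂ ℕ.+ suc a ≡ i₁ ℕ.+ β
        eq = ≡.sym (ℕ.m+[n∸m]≡n le)
      ... | no ≰ = trans (+-cong (u*0 (RH-vanishes (ℕ.≰⇒> ≰) a 0 a+1≡)) (u*0 (RH-vanishes (ℕ.≰⇒> ≰) (suc a) 1 ≡.refl)))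
          (trans (+-identityˡ _) (sym (u*0 (LH-vanishes (ℕ.≰⇒> ≰) a 0 a+1≡))))
        where
        a+1≡ : a ℕ.+ 1 ≡ suc a ℕ.+ 0
        a+1≡ = ≡.trans (ℕ.+-comm a 1) (≡.sym (ℕ.+-identityʳ (suc a)))

      step₁ : ∀ β → (1# - q ^ β) * RH⁻ P β (i₁ ∷ ν) (i₂ ∷ μ) + (q ^ β - v) * RH P β 1 (i₁ ∷ ν) (i₂ ∷ μ)
                    ≈ (1# - Ω 0) * LH P β 1 (i₁ ∷ ν) (i₂ ∷ μ)
      step₁ β with i₁ ℕ.≤? i₂ ℕ.+ β
      ... | yes le = assemble Θ#0 (first β eq) (RH₁ i₁<N i₂<N eq) (LH₁ i₁<N i₂<N eq)
                       (ih₀ β′) (ih₁ β′) (entry₁₀ β β′ eq) (entry₁₁ β β′ eq)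
        where
        β′ : ℕ
        β′ = i₂ ℕ.+ β ∸ i₁
        eq : i₂ ℕ.+ β ≡ i₁ ℕ.+ β′
        eq = ≡.sym (ℕ.m+[n∸m]≡n le)
        first : ∀ β {β′} → i₂ ℕ.+ β ≡ i₁ ℕ.+ β′ → (1# - q ^ β) * ((1# - Θ) * RH⁻ P β (i₁ ∷ ν) (i₂ ∷ μ)) ≈ (1# - q ^ β) *
          (ω i₂ (pred β′) * (1# - Θ * q ^ i₂) * X₀ β′ + ω (suc i₂) β′ * - (y 0 - Θ * q ^ i₂) * X₁ β′)
        -- Block 0 contains no pair with bit 0; the factor 1 - q^0 removes the corresponding term on
        -- both sides.
        first zero    _  = trans (0*u (-‿inverseʳ 1#)) (sym (0*u (-‿inverseʳ 1#)))
        first (suc a) eq = *-congˡ (RH₀ i₁<N i₂<N eq)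
      ... | no ≰ = trans (+-cong (u*0 (first β (ℕ.≰⇒> ≰))) (u*0 (RH-vanishes (ℕ.≰⇒> ≰) β 1 ≡.refl)))
          (trans (+-identityˡ _) (sym (u*0 (LH-vanishes (ℕ.≰⇒> ≰) β 1 ≡.refl))))
        where
        first : ∀ β → i₂ ℕ.+ β < i₁ → RH⁻ P β (i₁ ∷ ν) (i₂ ∷ μ) ≈ 0#
        first zero    _  = refl
        first (suc a) lt = RH-vanishes lt a 0 (≡.trans (ℕ.+-comm a 1) (≡.sym (ℕ.+-identityʳ (suc a))))

    module _ where
      private
        <-tail : ∀ i s → suc (i ℕ.+ s) < N → suc s < N
        <-tail i s lt = ℕ.≤-<-trans (s≤s (ℕ.m≤n+m s i)) lt
        <-head : ∀ i s → suc (i ℕ.+ s) < N → suc i < N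
        <-head i s lt = ℕ.≤-<-trans (s≤s (ℕ.m≤m+n i s)) lt

      -- The cross vertex can be moved through the columns from right to left.
      mutual
        zip₀ : ∀ {L} (P : Parameters) a (ν μ : Vec ℕ L) {b} → Vacant b μ →
          suc (sum ν) < N → suc (sum μ) < N → let open Parameters P in
          (1# - Ω 0 * q ^ a) * RH P a 0 ν μ + - (v - Ω 0 * q ^ a) * RH P (suc a) 1 ν μ ≈ (1# - Ω 0) * LH P a 0 ν μ
        zip₀ P zero [] [] _ _ _ = solve 2 (λ Ω v →
          (:1 :- Ω :* :1) :* (:1 :* :1 :+ :0) :+ :- (v :- Ω :* :1) :* (:0 :* :0 :+ :0) := (:1 :- Ω) :* (:1 :* :1 :+ :0)) refl _ _
        zip₀ P (suc a) [] [] _ _ _ = solve 3 (λ Ω v Q →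
          (:1 :- Ω :* Q) :* (:0 :* :1 :+ :0) :+ :- (v :- Ω :* Q) :* (:0 :* :0 :+ :0) := (:1 :- Ω) :* (:1 :* :0 :+ :0)) refl _ _ _
        zip₀ P a (i₁ ∷ ν) (i₂ ∷ μ) (.i₂ ∷ vacant) lt lt′ = Step.step₀ P i₁ i₂ ν μ (<-head i₁ _ lt) (<-head i₂ _ lt′)
          (λ b → zip₀ (shift P) b ν μ (vacant 0 z≤n) (<-tail i₁ _ lt) (<-tail i₂ _ lt′))
          (λ β β≤ → zip₁ (shift P) β ν μ (vacant β β≤) (<-tail i₁ _ lt) (<-tail i₂ _ lt′)) a

        zip₁ : ∀ {L} (P : Parameters) β (ν μ : Vec ℕ L) → Vacant β μ →
          suc (sum ν) < N → suc (sum μ) < N → let open Parameters P in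
          (1# - q ^ β) * RH⁻ P β ν μ + (q ^ β - v) * RH P β 1 ν μ ≈ (1# - Ω 0) * LH P β 1 ν μ
        -- `Vacant` leaves only β = 0 at the right end. For β = 1 the left-hand side would be 1 - q
        -- and the right-hand side 0.
        zip₁ P .0 [] [] [] _ _ = solve 2 (λ Ω v →
          (:1 :- :1) :* :0 :+ (:1 :- v) :* (:1 :* :0 :+ :0) := (:1 :- Ω) :* (:0 :* :1 :+ :0)) refl _ _
        zip₁ P β (i₁ ∷ ν) (i₂ ∷ μ) (.i₂ ∷ vacant) lt lt′ = Step.step₁ P i₁ i₂ ν μ (<-head i₁ _ lt) (<-head i₂ _ lt′)
          (λ b → zip₀ (shift P) b ν μ (vacant 0 z≤n) (<-tail i₁ _ lt) (<-tail i₂ _ lt′))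
          (λ β β≤ → zip₁ (shift P) β ν μ (vacant β β≤) (<-tail i₁ _ lt) (<-tail i₂ _ lt′)) β

-- Commuting chains of rows by repeated exchange

module Commutation {c ℓ₁ ℓ₂} (K : Field c ℓ₁ ℓ₂) (q : Field.Carrier K) where

  open Field K hiding (zero)
  open FieldProperties K
  open Functions K q
  open Sums K q
  open Rows K q
  open import Relation.Binary.Reasoning.Setoid setoid

  -- Property of a w-row: its left label is a bit, so the first part increases by at most one from
  -- bottom to top.
  Growing : Kernel → Set ℓ₁
  Growing D = ∀ L ks is → D L ks is ≈ 0# ⊎ sum ks ≤ suc (sum is)

  private
    assocˡ : ∀ {x y z} → x * (y * z) ≈ x * y * z
    assocˡ = sym (*-assoc _ _ _)

  module _ (N c L : ℕ) where

    -- One w-row is moved down through the W-rows one at a time; `D r` is this row after `r`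
    -- exchanges. The bound `n + c ≤ L` reserves one column for each W-row, so that an exchange
    -- always finds a last column that is empty at the bottom.
    commute-rows : ∀ n (B : Fin n → Kernel) (D : ℕ → Kernel) (k : Fin n → Carrier) →
      (∀ i → Descending (B i)) → (∀ i → LengthBounded 1 (B i)) →
      (∀ i c ν μ → c < L → ZeroFrom c μ → suc (suc (sum ν)) < N →
        (∑[ ƛ ∈ box N L ] (D (toℕ i) L ƛ ν * B i L ƛ μ)) ≈ k i * (∑[ ƛ ∈ box N L ] (B i L ν ƛ * D (suc (toℕ i)) L μ ƛ))) →
      n ℕ.+ c ≤ L → ∀ ν μ → ZeroFrom c μ → suc (suc (sum ν)) < N → sum μ < N →
      (∑[ ƛ ∈ box N L ] (D 0 L ƛ ν * chain N n B L ƛ μ)) ≈ ∏ n k * (∑[ ƛ ∈ box N L ] (chain N n B L ν ƛ * D n L μ ƛ))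
    commute-rows zero B D k desc lb com le ν μ μ0 ν<N μ<N = begin
      ∑ (box N L) (λ ƛ → D 0 L ƛ ν * [ ƛ ≟ᵛ μ ])  ≈⟨ ∑-δʳ _≟ᵛ_ (λ ƛ → D 0 L ƛ ν) (box-unique N L) (∈-box⁺ μ μ<N) ⟩
      D 0 L μ ν
        ≈⟨ ∑-δ _≟ᵛ_ (λ ƛ → D 0 L μ ƛ) (box-unique N L) (∈-box⁺ ν (ℕ.<-trans (ℕ.n<1+n _) (ℕ.<-trans (ℕ.n<1+n _) ν<N))) ⟨
      ∑ (box N L) (λ ƛ → [ ν ≟ᵛ ƛ ] * D 0 L μ ƛ)  ≈⟨ *-identityˡ _ ⟨
      1# * ∑ (box N L) (λ ƛ → [ ν ≟ᵛ ƛ ] * D 0 L μ ƛ) ∎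
    commute-rows (suc n) B D k desc lb com le ν μ μ0 ν<N μ<N = begin
      ∑ X (λ ƛ → D 0 L ƛ ν * ∑ X (λ ƛ₁ → B₀ ƛ ƛ₁ * C ƛ₁ μ))
        ≈⟨ ∑-cong X (λ ƛ → trans (*-∑ _ X _) (∑-cong X (λ ƛ₁ → assocˡ))) ⟩
      ∑ X (λ ƛ → ∑ X (λ ƛ₁ → D 0 L ƛ ν * B₀ ƛ ƛ₁ * C ƛ₁ μ))
        ≈⟨ ∑-swap X X _ ⟩
      ∑ X (λ ƛ₁ → ∑ X (λ ƛ → D 0 L ƛ ν * B₀ ƛ ƛ₁ * C ƛ₁ μ))
        ≈⟨ ∑-cong X (λ ƛ₁ → sym (∑-* (C ƛ₁ μ) X _)) ⟩
      ∑ X (λ ƛ₁ → ∑ X (λ ƛ → D 0 L ƛ ν * B₀ ƛ ƛ₁) * C ƛ₁ μ)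
        ≈⟨ ∑-cong X first ⟩
      ∑ X (λ ƛ₁ → k Fin.zero * ∑ X (λ ƛ → B₀ ν ƛ * D 1 L ƛ₁ ƛ) * C ƛ₁ μ)
        ≈⟨ ∑-cong X (λ ƛ₁ → trans (*-assoc _ _ _) (*-congˡ (∑-* _ X _))) ⟩
      ∑ X (λ ƛ₁ → k Fin.zero * ∑ X (λ ƛ → B₀ ν ƛ * D 1 L ƛ₁ ƛ * C ƛ₁ μ))
        ≈⟨ *-∑ _ X _ ⟨
      k Fin.zero * ∑ X (λ ƛ₁ → ∑ X (λ ƛ → B₀ ν ƛ * D 1 L ƛ₁ ƛ * C ƛ₁ μ))
        ≈⟨ *-congˡ (∑-swap X X _) ⟩
      k Fin.zero * ∑ X (λ ƛ → ∑ X (λ ƛ₁ → B₀ ν ƛ * D 1 L ƛ₁ ƛ * C ƛ₁ μ))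
        ≈⟨ *-congˡ (∑-cong X (λ ƛ → trans (∑-cong X (λ ƛ₁ → *-assoc _ _ _)) (sym (*-∑ _ X _)))) ⟩
      k Fin.zero * ∑ X (λ ƛ → B₀ ν ƛ * ∑ X (λ ƛ₁ → D 1 L ƛ₁ ƛ * C ƛ₁ μ))
        ≈⟨ *-congˡ (∑-cong X second) ⟩
      k Fin.zero * ∑ X (λ ƛ → B₀ ν ƛ * (κ * ∑ X (λ ƛ₂ → C ƛ ƛ₂ * D (suc n) L μ ƛ₂)))
        ≈⟨ *-congˡ (trans (∑-cong X (λ ƛ → solve 3 (λ b κ s → b :* (κ :* s) := κ :* (b :* s)) refl _ _ _)) (sym (*-∑ κ X _))) ⟩
      k Fin.zero * (κ * ∑ X (λ ƛ → B₀ ν ƛ * ∑ X (λ ƛ₂ → C ƛ ƛ₂ * D (suc n) L μ ƛ₂)))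
        ≈⟨ assocˡ ⟩
      k Fin.zero * κ * ∑ X (λ ƛ → B₀ ν ƛ * ∑ X (λ ƛ₂ → C ƛ ƛ₂ * D (suc n) L μ ƛ₂))
        ≈⟨ *-congˡ (∑-cong X (λ ƛ → trans (*-∑ _ X _) (∑-cong X (λ ƛ₂ → assocˡ)))) ⟩
      k Fin.zero * κ * ∑ X (λ ƛ → ∑ X (λ ƛ₂ → B₀ ν ƛ * C ƛ ƛ₂ * D (suc n) L μ ƛ₂))
        ≈⟨ *-congˡ (∑-swap X X _) ⟩
      k Fin.zero * κ * ∑ X (λ ƛ₂ → ∑ X (λ ƛ → B₀ ν ƛ * C ƛ ƛ₂ * D (suc n) L μ ƛ₂))
        ≈⟨ *-congˡ (∑-cong X (λ ƛ₂ → sym (∑-* _ X _))) ⟩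
      k Fin.zero * κ * ∑ X (λ ƛ₂ → ∑ X (λ ƛ → B₀ ν ƛ * C ƛ ƛ₂) * D (suc n) L μ ƛ₂) ∎
      where
      X : List (Vec ℕ L)
      X = box N L
      B₀ C : Vec ℕ L → Vec ℕ L → Carrier
      B₀ = B Fin.zero L
      C = chain N n (B ∘ Fin.suc) L
      κ : Carrier
      κ = ∏ n (k ∘ Fin.suc)
      -- The exchange is available only if `ƛ₁` leaves the last column empty. In all other terms `C`
      -- vanishes, since its rows lengthen `μ` by at most one part each.
      first : ∀ ƛ₁ → ∑ X (λ ƛ → D 0 L ƛ ν * B₀ ƛ ƛ₁) * C ƛ₁ μ
                     ≈ k Fin.zero * ∑ X (λ ƛ → B₀ ν ƛ * D 1 L ƛ₁ ƛ) * C ƛ₁ μ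
      first ƛ₁ with chain-lengthBounded N n (lb ∘ Fin.suc) L c ƛ₁ μ μ0
      ... | inj₁ C≈0 = trans (u*0 C≈0) (sym (u*0 C≈0))
      ... | inj₂ ƛ₁0 = *-congʳ (com Fin.zero (n ℕ.+ c) ν ƛ₁ le ƛ₁0 ν<N)
      second : ∀ ƛ → B₀ ν ƛ * ∑ X (λ ƛ₁ → D 1 L ƛ₁ ƛ * C ƛ₁ μ)
                     ≈ B₀ ν ƛ * (κ * ∑ X (λ ƛ₂ → C ƛ ƛ₂ * D (suc n) L μ ƛ₂))
      second ƛ with desc Fin.zero L ν ƛ
      ... | inj₁ B≈0 = trans (0*u B≈0) (sym (0*u B≈0))
      ... | inj₂ ƛ⊑ν = *-congˡ (commute-rows n (B ∘ Fin.suc) (D ∘ suc) (k ∘ Fin.suc) (desc ∘ Fin.suc) (lb ∘ Fin.suc)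
        (com ∘ Fin.suc) (ℕ.≤-trans (ℕ.n≤1+n _) le) ƛ μ μ0 (ℕ.≤-<-trans (s≤s (s≤s (⊑⇒sum≤ ƛ ν ƛ⊑ν))) ν<N) μ<N)

  chain-growing : ∀ N m {D : Fin m → Kernel} → (∀ j → Growing (D j)) → ∀ L ks is →
                  chain N m D L ks is ≈ 0# ⊎ sum ks ≤ m ℕ.+ sum is
  chain-growing N zero    grow L ks is with ks ≟ᵛ is
  ... | yes ≡.refl = inj₂ ℕ.≤-refl
  ... | no  _      = inj₁ refl
  chain-growing N (suc m) grow L ks is with sum ks ℕ.≤? suc m ℕ.+ sum is
  ... | yes ks≤ = inj₂ ks≤
  ... | no  ks≰ = inj₁ (∑-zero-∈ (box N L) (λ js _ → term js))
    where
    term : ∀ js → _ ≈ 0#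
    term js with grow Fin.zero L ks js | chain-growing N m (grow ∘ Fin.suc) L js is
    ... | inj₁ D≈0 | _            = 0*u D≈0
    ... | inj₂ _   | inj₁ chain≈0 = u*0 chain≈0
    ... | inj₂ ks≤ | inj₂ js≤     = contradiction (ℕ.≤-trans ks≤ (s≤s js≤)) ks≰

  module _ (N c L : ℕ) (C : Vec ℕ L → Vec ℕ L → Carrier) where

    -- D j and D′ j are the kernels of the j-th row before and after it has passed C.
    commute-columns : ∀ m (D D′ : Fin m → Kernel) (k : Fin m → Carrier) →
      (∀ j → Growing (D j)) → (∀ j → Descending (D′ j)) →
      (∀ j ν μ → ZeroFrom c μ → suc (suc (sum ν)) < N → sum μ < N →
        (∑[ ƛ ∈ box N L ] (D j L ƛ ν * C ƛ μ)) ≈ k j * (∑[ ƛ ∈ box N L ] (C ν ƛ * D′ j L μ ƛ))) →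
      ∀ ν μ → ZeroFrom c μ → suc (m ℕ.+ sum ν) < N → sum μ < N →
      (∑[ ƛ ∈ box N L ] (chain N m D L ƛ ν * C ƛ μ)) ≈ ∏ m k * (∑[ ƛ ∈ box N L ] (C ν ƛ * chain N m D′ L μ ƛ))
    commute-columns zero D D′ k grow desc com ν μ μ0 ν<N μ<N = begin
      ∑ (box N L) (λ ƛ → [ ƛ ≟ᵛ ν ] * C ƛ μ)
        ≈⟨ ∑-cong (box N L) (λ ƛ → *-congʳ ([]-⇔ (ƛ ≟ᵛ ν) (ν ≟ᵛ ƛ) ≡.sym ≡.sym)) ⟩
      ∑ (box N L) (λ ƛ → [ ν ≟ᵛ ƛ ] * C ƛ μ)
        ≈⟨ ∑-δ _≟ᵛ_ (λ ƛ → C ƛ μ) (box-unique N L) (∈-box⁺ ν (ℕ.<-trans (ℕ.n<1+n _) ν<N)) ⟩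
      C ν μ
        ≈⟨ ∑-δʳ _≟ᵛ_ (C ν) (box-unique N L) (∈-box⁺ μ μ<N) ⟨
      ∑ (box N L) (λ ƛ → C ν ƛ * [ ƛ ≟ᵛ μ ])
        ≈⟨ ∑-cong (box N L) (λ ƛ → *-congˡ ([]-⇔ (ƛ ≟ᵛ μ) (μ ≟ᵛ ƛ) ≡.sym ≡.sym)) ⟩
      ∑ (box N L) (λ ƛ → C ν ƛ * [ μ ≟ᵛ ƛ ])
        ≈⟨ *-identityˡ _ ⟨
      1# * ∑ (box N L) (λ ƛ → C ν ƛ * [ μ ≟ᵛ ƛ ]) ∎
    commute-columns (suc m) D D′ k grow desc com ν μ μ0 ν<N μ<N = begin
      ∑ X (λ ƛ → ∑ X (λ ƛ′ → D₀ ƛ ƛ′ * E ƛ′ ν) * C ƛ μ)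
        ≈⟨ ∑-cong X (λ ƛ → trans (∑-* _ X _) (∑-cong X (λ ƛ′ →
             solve 3 (λ d e c → d :* e :* c := e :* (d :* c)) refl _ _ _))) ⟩
      ∑ X (λ ƛ → ∑ X (λ ƛ′ → E ƛ′ ν * (D₀ ƛ ƛ′ * C ƛ μ)))
        ≈⟨ ∑-swap X X _ ⟩
      ∑ X (λ ƛ′ → ∑ X (λ ƛ → E ƛ′ ν * (D₀ ƛ ƛ′ * C ƛ μ)))
        ≈⟨ ∑-cong X (λ ƛ′ → sym (*-∑ _ X _)) ⟩
      ∑ X (λ ƛ′ → E ƛ′ ν * ∑ X (λ ƛ → D₀ ƛ ƛ′ * C ƛ μ))
        ≈⟨ ∑-cong X first ⟩
      ∑ X (λ ƛ′ → E ƛ′ ν * (k Fin.zero * ∑ X (λ ƛ → C ƛ′ ƛ * D₀′ μ ƛ)))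
        ≈⟨ ∑-cong X (λ ƛ′ → trans (solve 3 (λ e k s → e :* (k :* s) := k :* (e :* s)) refl _ _ _)
             (*-congˡ (*-∑ _ X _))) ⟩
      ∑ X (λ ƛ′ → k Fin.zero * ∑ X (λ ƛ → E ƛ′ ν * (C ƛ′ ƛ * D₀′ μ ƛ)))
        ≈⟨ *-∑ _ X _ ⟨
      k Fin.zero * ∑ X (λ ƛ′ → ∑ X (λ ƛ → E ƛ′ ν * (C ƛ′ ƛ * D₀′ μ ƛ)))
        ≈⟨ *-congˡ (∑-swap X X _) ⟩
      k Fin.zero * ∑ X (λ ƛ → ∑ X (λ ƛ′ → E ƛ′ ν * (C ƛ′ ƛ * D₀′ μ ƛ)))
        ≈⟨ *-congˡ (∑-cong X (λ ƛ → trans (∑-cong X (λ ƛ′ → assocˡ)) (sym (∑-* _ X _)))) ⟩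
      k Fin.zero * ∑ X (λ ƛ → ∑ X (λ ƛ′ → E ƛ′ ν * C ƛ′ ƛ) * D₀′ μ ƛ)
        ≈⟨ *-congˡ (∑-cong X second) ⟩
      k Fin.zero * ∑ X (λ ƛ → κ * ∑ X (λ ƛ″ → C ν ƛ″ * E′ ƛ ƛ″) * D₀′ μ ƛ)
        ≈⟨ *-congˡ (trans (∑-cong X (λ ƛ → trans (*-assoc _ _ _) (*-congˡ (∑-* _ X _)))) (sym (*-∑ κ X _))) ⟩
      k Fin.zero * (κ * ∑ X (λ ƛ → ∑ X (λ ƛ″ → C ν ƛ″ * E′ ƛ ƛ″ * D₀′ μ ƛ)))
        ≈⟨ trans assocˡ (*-congˡ (∑-swap X X _)) ⟩
      k Fin.zero * κ * ∑ X (λ ƛ″ → ∑ X (λ ƛ → C ν ƛ″ * E′ ƛ ƛ″ * D₀′ μ ƛ))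
        ≈⟨ *-congˡ (∑-cong X (λ ƛ″ → trans (∑-cong X (λ ƛ →
             solve 3 (λ c e d → c :* e :* d := c :* (d :* e)) refl _ _ _)) (sym (*-∑ _ X _)))) ⟩
      k Fin.zero * κ * ∑ X (λ ƛ″ → C ν ƛ″ * ∑ X (λ ƛ → D₀′ μ ƛ * E′ ƛ ƛ″)) ∎
      where
      X : List (Vec ℕ L)
      X = box N L
      D₀ D₀′ E E′ : Vec ℕ L → Vec ℕ L → Carrier
      D₀ = D Fin.zero L
      D₀′ = D′ Fin.zero L
      E = chain N m (D ∘ Fin.suc) L
      E′ = chain N m (D′ ∘ Fin.suc) L
      κ : Carrier
      κ = ∏ m (k ∘ Fin.suc)
      -- Wherever `E` does not vanish, it raises the first part by at most one for each of its rows;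
      -- this supplies the size bound that `com` requires.
      first : ∀ ƛ′ → E ƛ′ ν * ∑ X (λ ƛ → D₀ ƛ ƛ′ * C ƛ μ) ≈ E ƛ′ ν * (k Fin.zero * ∑ X (λ ƛ → C ƛ′ ƛ * D₀′ μ ƛ))
      first ƛ′ with chain-growing N m (grow ∘ Fin.suc) L ƛ′ ν
      ... | inj₁ E≈0 = trans (0*u E≈0) (sym (0*u E≈0))
      ... | inj₂ ƛ′≤ = *-congˡ (com Fin.zero ƛ′ μ μ0 (ℕ.≤-<-trans (s≤s (s≤s ƛ′≤)) ν<N) μ<N)
      second : ∀ ƛ → ∑ X (λ ƛ′ → E ƛ′ ν * C ƛ′ ƛ) * D₀′ μ ƛ ≈ κ * ∑ X (λ ƛ″ → C ν ƛ″ * E′ ƛ ƛ″) * D₀′ μ ƛ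
      second ƛ with desc Fin.zero L μ ƛ
      ... | inj₁ D≈0 = trans (u*0 D≈0) (sym (u*0 D≈0))
      ... | inj₂ ƛ⊑μ = *-congʳ (commute-columns m (D ∘ Fin.suc) (D′ ∘ Fin.suc) (k ∘ Fin.suc) (grow ∘ Fin.suc) (desc ∘ Fin.suc)
        (com ∘ Fin.suc) ν ƛ (⊑-ZeroFrom c ƛ μ ƛ⊑μ μ0) (ℕ.≤-trans (ℕ.n≤1+n _) ν<N) (ℕ.≤-<-trans (⊑⇒sum≤ ƛ μ ƛ⊑μ) μ<N))

-- Exchange of one w-row and one W-row, with their left boundaries

module SingleExchange {c ℓ₁ ℓ₂} (K : Field c ℓ₁ ℓ₂) (q : Field.Carrier K)
  (qᵏ#1 : ∀ k → Field._#_ K (Field._^_ K q (suc k)) (Field.1# K)) where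

  open Field K hiding (zero)
  open FieldProperties K
  open Functions K q
  open Sums K q
  open Rows K q
  open Commutation K q using (Growing)
  open Zipper K q qᵏ#1
  open import Relation.Binary.Reasoning.Setoid setoid

  row-ŵ-zero : ∀ {L} U y j (ks is : Vec ℕ L) → row (ŵ U y) (suc (suc j)) ks is ≈ 0#
  row-ŵ-zero U y j []       []       = refl
  row-ŵ-zero U y j (k ∷ ks) (i ∷ is) = 0*u (weight (i ℕ.+ suc (suc j) ∸ k))
    where
    weight : ∀ l → ŵ U y 0 i (suc (suc j)) k l ≈ 0#
    weight l with i ℕ.+ suc (suc j) ℕ.≟ k ℕ.+ l
    ... | yes eq  = trans (if-yes eq) (0*u refl)
    ... | no  neq = if-no neq

  -- Rows whose left label does not match the sizes vanish, so both bits can be written side by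
  -- side. This displays the boundary weights as a vector on which the cross vertex acts.
  kernel-ŵ : ∀ {L} v U y (ks is : Vec ℕ L) →
             kernel v (ŵ U y) L ks is ≈ v 0 * row (ŵ U y) 0 ks is + v 1 * row (ŵ U y) 1 ks is
  kernel-ŵ {L} v U y ks is = go (sum ks ∸ sum is) ≡.refl
    where
    ϖ = ŵ U y
    excluded : ∀ j → sum ks ∸ sum is ≢ j → row ϖ j ks is ≈ 0#
    excluded j ≢j = row-no (ŵ-conservative U y) j ks is
      (λ eq → ≢j (≡.trans (≡.cong (_∸ sum is) (≡.sym eq)) (ℕ.m+n∸n≡m j (sum is))))
    go : ∀ j → sum ks ∸ sum is ≡ j → v j * row ϖ j ks is ≈ v 0 * row ϖ 0 ks is + v 1 * row ϖ 1 ks is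
    go 0 eq = sym (trans (+-congˡ (u*0 (excluded 1 (λ e → ℕ.1+n≢0 (≡.trans (≡.sym e) eq))))) (+-identityʳ _))
    go 1 eq = sym (trans (+-congʳ (u*0 (excluded 0 (λ e → ℕ.1+n≢0 (≡.trans (≡.sym eq) e))))) (+-identityˡ _))
    go (suc (suc j)) eq = trans (u*0 (row-ŵ-zero U y j ks is)) (sym (trans
      (+-cong (u*0 (excluded 0 (λ e → ℕ.1+n≢0 (≡.trans (≡.sym eq) e))))
              (u*0 (excluded 1 (λ e → ℕ.1+n≢0 (ℕ.suc-injective (≡.trans (≡.sym eq) e))))))
      (+-identityˡ _)))

  kernel-ŵ-growing : ∀ v U y → Growing (kernel v (ŵ U y))
  kernel-ŵ-growing v U y L ks is with sum ks ℕ.≤? suc (sum is)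
  ... | yes ks≤ = inj₂ ks≤
  ... | no  ks≰ = inj₁ (trans (kernel-ŵ v U y ks is) (trans
    (+-cong (u*0 (row-no (ŵ-conservative U y) 0 ks is (λ e → ks≰ (ℕ.≤-trans (ℕ.≤-reflexive (≡.sym e)) (ℕ.n≤1+n _)))))
            (u*0 (row-no (ŵ-conservative U y) 1 ks is (λ e → ks≰ (ℕ.≤-reflexive (≡.sym e))))))
    (+-identityˡ _)))

  module _ (P : Parameters) (vD vW : ℕ → Carrier)
    (boundary : ∀ a → vD 0 * vW a * (Parameters.v P - Parameters.Ω P 0 * q ^ a)
                      + vD 1 * vW (suc a) * (1# - q ^ suc a) ≈ 0#)
    (N : ℕ) where

    open Parameters P

    private
      D D′ B : Kernel
      D  = kernel vD (ŵ Ω y)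
      D′ = kernel vD (ŵ (Ω ∘ suc) y)
      B  = kernel vW (Ŵ x T xTqᵏ#1)

      -- Boundary weight of the pair (β - 1, 0) of block β, a pair that block 0 does not contain.
      vW⁻ : ℕ → Carrier
      vW⁻ zero    = 0#
      vW⁻ (suc a) = vW a

      B-conservative : Conservative (Ŵ x T xTqᵏ#1)
      B-conservative = Ŵ-conservative x T xTqᵏ#1

      module _ {L : ℕ} (ν μ : Vec ℕ L) where

        private
          X : List (Vec ℕ L)
          X = box N L

        -- Where the w-row does not vanish, its conservation law fixes the size of `ƛ`, and hence
        -- the left label of the W-row below it.
        D*B : ∀ {a} j ƛ → a ℕ.+ sum μ ≡ j ℕ.+ sum ν →
              row (ŵ Ω y) j ƛ ν * B L ƛ μ ≈ vW a * (row (ŵ Ω y) j ƛ ν * row (Ŵ x T xTqᵏ#1) a ƛ μ)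
        D*B {a} j ƛ eq with row-support (ŵ-conservative Ω y) j ƛ ν
        ... | inj₁ row≈0    = trans (0*u row≈0) (sym (u*0 (0*u row≈0)))
        ... | inj₂ (eq′ , _) = trans (*-congˡ (kernel-row vW _ a ƛ μ (≡.trans eq eq′)))
          (solve 3 (λ r w s → r :* (w :* s) := w :* (r :* s)) refl _ _ _)

        B*D : ∀ {a} j ƛ → a ℕ.+ sum μ ≡ j ℕ.+ sum ν →
              row (ŵ (Ω ∘ suc) y) j μ ƛ * B L ν ƛ ≈ vW a * (row (Ŵ x T xTqᵏ#1) a ν ƛ * row (ŵ (Ω ∘ suc) y) j μ ƛ)
        B*D {a} j ƛ eq with row-support (ŵ-conservative (Ω ∘ suc) y) j μ ƛ
        ... | inj₁ row≈0    = trans (0*u row≈0) (sym (u*0 (u*0 row≈0)))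
        ... | inj₂ (eq′ , _) = trans (*-congˡ (kernel-row vW _ a ν ƛ (ℕ.+-cancelˡ-≡ j _ _ balance)))
          (solve 3 (λ r w s → r :* (w :* s) := w :* (s :* r)) refl _ _ _)
          where
          balance : j ℕ.+ (a ℕ.+ sum ƛ) ≡ j ℕ.+ sum ν
          balance = ≡.trans (ℕS.solve 3 (λ j a s → j ℕS.:+ (a ℕS.:+ s) ℕS.:= a ℕS.:+ (j ℕS.:+ s)) ≡.refl j a (sum ƛ))
            (≡.trans (≡.cong (a ℕ.+_) eq′) eq)

        D*B⁻ : ∀ β ƛ → β ℕ.+ sum μ ≡ suc (sum ν) →
               row (ŵ Ω y) 0 ƛ ν * B L ƛ μ ≈ vW⁻ β * (row (ŵ Ω y) 0 ƛ ν * row (Ŵ x T xTqᵏ#1) (β ∸ 1) ƛ μ)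
        D*B⁻ (suc a) ƛ eq = D*B 0 ƛ (ℕ.suc-injective eq)
        -- Here the w-row gives `ƛ` the size of `ν`, one less than the size of `μ`, so `μ` cannot be
        -- contained in `ƛ` and the W-row vanishes.
        D*B⁻ zero    ƛ eq = trans zero-term (sym (zeroˡ _))
          where
          zero-term : row (ŵ Ω y) 0 ƛ ν * B L ƛ μ ≈ 0#
          zero-term with row-support (ŵ-conservative Ω y) 0 ƛ ν | kernel-descending {vW} B-conservative L ƛ μ
          ... | inj₁ row≈0     | _        = 0*u row≈0
          ... | inj₂ _         | inj₁ B≈0 = u*0 B≈0
          ... | inj₂ (eq′ , _) | inj₂ μ⊑ƛ = contradiction
            (ℕ.≤-trans (⊑⇒sum≤ μ ƛ μ⊑ƛ) (ℕ.≤-reflexive (≡.sym eq′))) (ℕ.<⇒≱ (ℕ.≤-reflexive (≡.sym eq)))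

        B*D⁻ : ∀ β ƛ → β ℕ.+ sum μ ≡ suc (sum ν) →
               row (ŵ (Ω ∘ suc) y) 0 μ ƛ * B L ν ƛ ≈
               vW⁻ β * (row (Ŵ x T xTqᵏ#1) (β ∸ 1) ν ƛ * row (ŵ (Ω ∘ suc) y) 0 μ ƛ)
        B*D⁻ (suc a) ƛ eq = B*D 0 ƛ (ℕ.suc-injective eq)
        B*D⁻ zero    ƛ eq = trans zero-term (sym (zeroˡ _))
          where
          zero-term : row (ŵ (Ω ∘ suc) y) 0 μ ƛ * B L ν ƛ ≈ 0#
          zero-term with row-support (ŵ-conservative (Ω ∘ suc) y) 0 μ ƛ | kernel-descending {vW} B-conservative L ν ƛ
          ... | inj₁ row≈0     | _        = 0*u row≈0
          ... | inj₂ _         | inj₁ B≈0 = u*0 B≈0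
          ... | inj₂ (eq′ , _) | inj₂ ƛ⊑ν = contradiction
            (ℕ.≤-trans (ℕ.≤-reflexive (≡.sym eq′)) (⊑⇒sum≤ ƛ ν ƛ⊑ν)) (ℕ.<⇒≱ (ℕ.≤-reflexive (≡.sym eq)))

        vW⁻-LH : ∀ β → vW⁻ β * LH N P (β ∸ 1) 0 ν μ ≈ vW⁻ β * LH⁻ N P β ν μ
        vW⁻-LH zero    = trans (zeroˡ _) (sym (zeroˡ _))
        vW⁻-LH (suc a) = refl

        vW⁻-RH : ∀ β → vW⁻ β * RH N P (β ∸ 1) 0 ν μ ≈ vW⁻ β * RH⁻ N P β ν μ
        vW⁻-RH zero    = trans (zeroˡ _) (sym (zeroˡ _))
        vW⁻-RH (suc a) = refl

        private
          collect : ∀ {x₀ x₁ w₀ w₁} (f g f′ g′ : Vec ℕ L → Carrier) →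
            (∀ ƛ → f ƛ ≈ w₀ * f′ ƛ) → (∀ ƛ → g ƛ ≈ w₁ * g′ ƛ) →
            ∑ X (λ ƛ → x₀ * f ƛ + x₁ * g ƛ) ≈ x₀ * (w₀ * ∑ X f′) + x₁ * (w₁ * ∑ X g′)
          collect {x₀} {x₁} f g f′ g′ f≈ g≈ = trans (∑-+ X _ _) (+-cong
            (trans (sym (*-∑ x₀ X f)) (*-congˡ (trans (∑-cong X f≈) (sym (*-∑ _ X f′)))))
            (trans (sym (*-∑ x₁ X g)) (*-congˡ (trans (∑-cong X g≈) (sym (*-∑ _ X g′))))))

        ∑DB : ∀ β → β ℕ.+ sum μ ≡ suc (sum ν) →
          (∑[ ƛ ∈ X ] (D L ƛ ν * B L ƛ μ)) ≈ vD 0 * (vW⁻ β * LH⁻ N P β ν μ) + vD 1 * (vW β * LH N P β 1 ν μ)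
        ∑DB β eq = begin
          ∑ X (λ ƛ → D L ƛ ν * B L ƛ μ)
            ≈⟨ ∑-cong X (λ ƛ → trans (*-congʳ (kernel-ŵ vD Ω y ƛ ν))
                 (solve 5 (λ a r b s B → (a :* r :+ b :* s) :* B := a :* (r :* B) :+ b :* (s :* B)) refl _ _ _ _ _)) ⟩
          ∑ X (λ ƛ → vD 0 * (row (ŵ Ω y) 0 ƛ ν * B L ƛ μ) + vD 1 * (row (ŵ Ω y) 1 ƛ ν * B L ƛ μ))
            ≈⟨ collect _ _ _ _ (λ ƛ → D*B⁻ β ƛ eq) (λ ƛ → D*B 1 ƛ eq) ⟩
          vD 0 * (vW⁻ β * LH N P (β ∸ 1) 0 ν μ) + vD 1 * (vW β * LH N P β 1 ν μ)
            ≈⟨ +-congʳ (*-congˡ (vW⁻-LH β)) ⟩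
          vD 0 * (vW⁻ β * LH⁻ N P β ν μ) + vD 1 * (vW β * LH N P β 1 ν μ) ∎

        ∑BD : ∀ β → β ℕ.+ sum μ ≡ suc (sum ν) →
          (∑[ ƛ ∈ X ] (B L ν ƛ * D′ L μ ƛ)) ≈ vD 0 * (vW⁻ β * RH⁻ N P β ν μ) + vD 1 * (vW β * RH N P β 1 ν μ)
        ∑BD β eq = begin
          ∑ X (λ ƛ → B L ν ƛ * D′ L μ ƛ)
            ≈⟨ ∑-cong X (λ ƛ → trans (*-congˡ (kernel-ŵ vD (Ω ∘ suc) y μ ƛ))
                 (solve 5 (λ a r b s B → B :* (a :* r :+ b :* s) := a :* (r :* B) :+ b :* (s :* B)) refl _ _ _ _ _)) ⟩
          ∑ X (λ ƛ → vD 0 * (row (ŵ (Ω ∘ suc) y) 0 μ ƛ * B L ν ƛ) + vD 1 * (row (ŵ (Ω ∘ suc) y) 1 μ ƛ * B L ν ƛ))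
            ≈⟨ collect _ _ _ _ (λ ƛ → B*D⁻ β ƛ eq) (λ ƛ → B*D 1 ƛ eq) ⟩
          vD 0 * (vW⁻ β * RH N P (β ∸ 1) 0 ν μ) + vD 1 * (vW β * RH N P β 1 ν μ)
            ≈⟨ +-congʳ (*-congˡ (vW⁻-RH β)) ⟩
          vD 0 * (vW⁻ β * RH⁻ N P β ν μ) + vD 1 * (vW β * RH N P β 1 ν μ) ∎

        -- The boundary weights form a left eigenvector of the cross vertex.
        eigen : ∀ β {b} → Vacant b μ → Vacant β μ → suc (sum ν) < N → suc (sum μ) < N →
          (1# - Ω 0) * (vD 0 * (vW⁻ β * LH⁻ N P β ν μ) + vD 1 * (vW β * LH N P β 1 ν μ)) ≈
          (1# - v) * (vD 0 * (vW⁻ β * RH⁻ N P β ν μ) + vD 1 * (vW β * RH N P β 1 ν μ))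
        eigen zero vac vac′ lt lt′ = begin
          (1# - Ω 0) * (vD 0 * (0# * 0#) + vD 1 * (vW 0 * LH N P 0 1 ν μ))
            ≈⟨ solve 4 (λ Ω d e l → (:1 :- Ω) :* (d :* (:0 :* :0) :+ e :* l) := e :* ((:1 :- Ω) :* l)) refl (Ω 0) (vD 0) (vD 1) _ ⟩
          vD 1 * ((1# - Ω 0) * (vW 0 * LH N P 0 1 ν μ))
            ≈⟨ *-congˡ (solve 3 (λ u w l → u :* (w :* l) := w :* (u :* l)) refl _ _ _) ⟩
          vD 1 * (vW 0 * ((1# - Ω 0) * LH N P 0 1 ν μ))
            ≈⟨ *-congˡ (*-congˡ (zip₁ N P 0 ν μ vac′ lt lt′)) ⟨
          vD 1 * (vW 0 * ((1# - 1#) * 0# + (1# - v) * RH N P 0 1 ν μ))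
            ≈⟨ solve 5 (λ d e w v r → e :* (w :* ((:1 :- :1) :* :0 :+ (:1 :- v) :* r))
                 := (:1 :- v) :* (d :* (:0 :* :0) :+ e :* (w :* r))) refl (vD 0) (vD 1) (vW 0) v _ ⟩
          (1# - v) * (vD 0 * (0# * 0#) + vD 1 * (vW 0 * RH N P 0 1 ν μ)) ∎
        eigen (suc a) vac vac′ lt lt′ = begin
          (1# - Ω 0) * (vD 0 * (vW a * LH N P a 0 ν μ) + vD 1 * (vW (suc a) * LH N P (suc a) 1 ν μ))
            ≈⟨ solve 7 (λ u d w l d′ w′ l′ → u :* (d :* (w :* l) :+ d′ :* (w′ :* l′))
                 := d :* w :* (u :* l) :+ d′ :* w′ :* (u :* l′)) refl _ _ _ _ _ _ _ ⟩
          vD 0 * vW a * ((1# - Ω 0) * LH N P a 0 ν μ) + vD 1 * vW (suc a) * ((1# - Ω 0) * LH N P (suc a) 1 ν μ)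
            ≈⟨ +-cong (*-congˡ (zip₀ N P a ν μ vac lt lt′)) (*-congˡ (zip₁ N P (suc a) ν μ vac′ lt lt′)) ⟨
          vD 0 * vW a * ((1# - Ω 0 * q ^ a) * R₀ + - (v - Ω 0 * q ^ a) * R₁)
            + vD 1 * vW (suc a) * ((1# - q ^ suc a) * R₀ + (q ^ suc a - v) * R₁)
            -- Both rows of the two-by-two block of the cross vertex sum to 1 - v. The deviation of
            -- the boundary vector from an eigenvector is therefore a single scalar, the expression
            -- in `boundary`, times `R₀ - R₁`.
            ≈⟨ solve 7 (λ V V′ Q O v R₀ R₁ →
                 V :* ((:1 :- O) :* R₀ :+ :- (v :- O) :* R₁) :+ V′ :* ((:1 :- Q) :* R₀ :+ (Q :- v) :* R₁)
                 := (:1 :- v) :* (V :* R₀ :+ V′ :* R₁) :+ (V :* (v :- O) :+ V′ :* (:1 :- Q)) :* (R₀ :- R₁)) refl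
                 (vD 0 * vW a) (vD 1 * vW (suc a)) (q ^ suc a) (Ω 0 * q ^ a) v R₀ R₁ ⟩
          (1# - v) * (vD 0 * vW a * R₀ + vD 1 * vW (suc a) * R₁)
            + (vD 0 * vW a * (v - Ω 0 * q ^ a) + vD 1 * vW (suc a) * (1# - q ^ suc a)) * (R₀ - R₁)
            ≈⟨ trans (+-congˡ (0*u (boundary a))) (+-identityʳ _) ⟩
          (1# - v) * (vD 0 * vW a * R₀ + vD 1 * vW (suc a) * R₁)
            ≈⟨ *-congˡ (+-cong (*-assoc _ _ _) (*-assoc _ _ _)) ⟩
          (1# - v) * (vD 0 * (vW a * R₀) + vD 1 * (vW (suc a) * R₁)) ∎
          where
          R₀ R₁ : Carrier
          R₀ = RH N P a 0 ν μ
          R₁ = RH N P (suc a) 1 ν μ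

    exchange : ∀ {L} c (ν μ : Vec ℕ L) → c < L → ZeroFrom c μ → suc (suc (sum ν)) < N →
      (1# - Ω 0) * (∑[ ƛ ∈ box N L ] (D L ƛ ν * B L ƛ μ)) ≈ (1# - v) * (∑[ ƛ ∈ box N L ] (B L ν ƛ * D′ L μ ƛ))
    exchange {L} c ν μ c<L μ0 ν<N with sum μ ℕ.≤? suc (sum ν)
    ... | yes μ≤ = trans (*-congˡ (∑DB ν μ β eq)) (trans
        (eigen ν μ β (vacant 0) (vacant β) (ℕ.<-trans (ℕ.n<1+n _) ν<N) (ℕ.≤-<-trans (s≤s μ≤) ν<N))
        (*-congˡ (sym (∑BD ν μ β eq))))
      where
      -- The sizes of `ν` and `μ` determine the difference a - j of the two left labels, and with it
      -- the block β = a - j + 1.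
      β : ℕ
      β = suc (sum ν) ∸ sum μ
      eq : β ℕ.+ sum μ ≡ suc (sum ν)
      eq = ℕ.m∸n+n≡m μ≤
      vacant : ∀ b → Vacant b μ
      vacant b = ZeroFrom⇒Vacant c b μ c<L μ0
    ... | no μ≰ = trans (u*0 (∑-zero-∈ (box N L) (λ ƛ _ → left ƛ))) (sym (u*0 (∑-zero-∈ (box N L) (λ ƛ _ → right ƛ))))
      where
      left : ∀ ƛ → D L ƛ ν * B L ƛ μ ≈ 0#
      left ƛ with kernel-ŵ-growing vD Ω y L ƛ ν | kernel-descending {vW} B-conservative L ƛ μ
      ... | inj₁ D≈0 | _        = 0*u D≈0
      ... | inj₂ _   | inj₁ B≈0 = u*0 B≈0
      ... | inj₂ ƛ≤  | inj₂ μ⊑ƛ = contradiction (ℕ.≤-trans (⊑⇒sum≤ μ ƛ μ⊑ƛ) ƛ≤) μ≰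
      right : ∀ ƛ → B L ν ƛ * D′ L μ ƛ ≈ 0#
      right ƛ with kernel-ŵ-growing vD (Ω ∘ suc) y L μ ƛ | kernel-descending {vW} B-conservative L ν ƛ
      ... | inj₁ D≈0 | _        = u*0 D≈0
      ... | inj₂ _   | inj₁ B≈0 = 0*u B≈0
      ... | inj₂ μ≤  | inj₂ ƛ⊑ν = contradiction (ℕ.≤-trans μ≤ (s≤s (⊑⇒sum≤ ƛ ν ƛ⊑ν))) μ≰

-- Lattice partition functions as chains of rows

module Lattice {c ℓ₁ ℓ₂} (K : Field c ℓ₁ ℓ₂) (q : Field.Carrier K) where

  open Field K hiding (zero)
  open FieldProperties K
  open Functions K q
  open Sums K q
  open Rows K q
  open Data.List.Membership.DecPropositional ℕ._≟_ using (_∈?_)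
  open import Relation.Binary.Reasoning.Setoid setoid

  []-∷ : ∀ {L} x y (xs ys : Vec ℕ L) → [ x ∷ xs ≟ᵛ y ∷ ys ] ≈ [ x ℕ.≟ y ] * [ xs ≟ᵛ ys ]
  []-∷ x y xs ys = trans
    ([]-⇔ (x ∷ xs ≟ᵛ y ∷ ys) (x ℕ.≟ y ×-dec xs ≟ᵛ ys) Vec.∷-injective (λ { (≡.refl , ≡.refl) → ≡.refl }))
    ([]-× (x ℕ.≟ y) (xs ≟ᵛ ys))

  rowProduct : ∀ {L} → Weights → Vec ℕ (suc L) → Vec ℕ L → Vec ℕ L → Carrier
  rowProduct {L} ϖ h ks is = ∏[ c < L ]
    ϖ (toℕ c) (lookup is c) (lookup h (inject₁ c)) (lookup ks c) (lookup h (Fin.suc c))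

  module _ {hs : List ℕ} (hs! : Unique hs) where

    private
      determined : ∀ {i j k l} → l ≢ i ℕ.+ j ∸ k → i ℕ.+ j ≢ k ℕ.+ l
      determined {i} {j} {k} {l} l≢ eq = l≢ (≡.sym (≡.trans (≡.cong (_∸ k) eq) (ℕ.m+n∸m≡n k l)))

    -- Conservation determines every right label from the three other labels of its vertex, so each
    -- sum over a horizontal label has at most one nonzero term. If the determined label is missing
    -- from the list, the hypothesis says that its weight is zero.
    ∑-rowProduct : ∀ {vs : List ℕ} {L} {ϖ} → Conservative ϖ →
      (∀ c i j k l → i ∈ vs → l ∉ hs → ϖ c i j k l ≈ 0#) → ∀ j (ks is : Vec ℕ L) → VecAll.All (_∈ vs) is →
      (∑[ h ∈ words hs L ] ([ Vec.last (j ∷ h) ℕ.≟ 0 ] * rowProduct ϖ (j ∷ h) ks is)) ≈ row ϖ j ks is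
    ∑-rowProduct cons closed j [] [] _ = trans (+-identityʳ _) (*-identityʳ _)
    ∑-rowProduct {L = suc L} {ϖ} cons closed j (k ∷ ks) (i ∷ is) (i∈ VecAll.∷ is∈) = begin
      ∑ (words hs (suc L)) (λ h → [ Vec.last (j ∷ h) ℕ.≟ 0 ] * rowProduct ϖ (j ∷ h) (k ∷ ks) (i ∷ is))
        ≈⟨ ∑-words hs L _ ⟩
      ∑ hs (λ l → ∑ (words hs L) (λ h → [ Vec.last (l ∷ h) ℕ.≟ 0 ] * (ϖ 0 i j k l * rowProduct (ϖ ∘ suc) (l ∷ h) ks is)))
        ≈⟨ ∑-cong hs (λ l → trans
             (∑-cong (words hs L) (λ h → solve 3 (λ x y z → x :* (y :* z) := y :* (x :* z)) refl _ _ _))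
             (trans (sym (*-∑ _ (words hs L) _)) (*-congˡ (∑-rowProduct (λ c → cons (suc c)) (λ c → closed (suc c)) l ks is is∈)))) ⟩
      ∑ hs (λ l → ϖ 0 i j k l * row (ϖ ∘ suc) l ks is)
        ≈⟨ pick ⟩
      ϖ 0 i j k (i ℕ.+ j ∸ k) * row (ϖ ∘ suc) (i ℕ.+ j ∸ k) ks is ∎
      where
      pick : ∑ hs (λ l → ϖ 0 i j k l * row (ϖ ∘ suc) l ks is)
             ≈ ϖ 0 i j k (i ℕ.+ j ∸ k) * row (ϖ ∘ suc) (i ℕ.+ j ∸ k) ks is
      pick with i ℕ.+ j ∸ k ∈? hs
      ... | yes l∈ = ∑-single hs! l∈ (λ l _ l≢ → 0*u (cons 0 i j k l (determined {i} {j} {k} {l} l≢)))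
      ... | no  l∉ = trans
        (∑-zero-∈ hs (λ l l∈ → 0*u (cons 0 i j k l (determined {i} {j} {k} {l} (λ { ≡.refl → l∉ l∈ })))))
        (sym (0*u (closed 0 i j k _ i∈ l∉)))

    module _ (N : ℕ) where

      fixedRows : ∀ {n} → (Fin n → Weights) → Vec ℕ n → Fin n → Kernel
      fixedRows ϖ a r L ks is = row (ϖ r) (lookup a r) ks is

      private
        Closed : ∀ {n} → (Fin n → Weights) → Set ℓ₁
        Closed ϖ = ∀ r c i j k l → i ∈ upTo N → l ∉ hs → ϖ r c i j k l ≈ 0#

        summand : ∀ {n L} → (Fin n → Weights) → Vec ℕ L → Vec ℕ L → Vec ℕ n →
                  Vec (Vec ℕ L) n → Vec (Vec ℕ (suc L)) n → Carrier
        summand {n} ϖ v₀ bot a v h =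
          [ Vec.last (v₀ ∷ v) ≟ᵛ bot ] * ([ Vec.map Vec.head h ≟ᵛ a ] * [ Vec.map Vec.last h ≟ᵛ replicate n 0 ])
          * (∏[ r < n ] rowProduct (ϖ r) (lookup h r) (lookup (v₀ ∷ v) (inject₁ r)) (lookup v r))

        Z : ∀ {n L} → (Fin n → Weights) → Vec ℕ L → Vec ℕ L → Vec ℕ n → Carrier
        Z {n} {L} ϖ v₀ bot a =
          ∑[ v ∈ words (box N L) n ] ∑[ h ∈ words (words hs (suc L)) n ] summand ϖ v₀ bot a v h

        first-row : ∀ {L ϖ} → Conservative ϖ → (∀ c i j k l → i ∈ upTo N → l ∉ hs → ϖ c i j k l ≈ 0#) →
          ∀ {a} (ks is : Vec ℕ L) → a ∈ hs → is ∈ box N L →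
          (∑[ h ∈ words hs (suc L) ] ([ Vec.head h ℕ.≟ a ] * [ Vec.last h ℕ.≟ 0 ] * rowProduct ϖ h ks is)) ≈ row ϖ a ks is
        first-row {L} {ϖ} cons closed {a} ks is a∈ is∈ = begin
          ∑ (words hs (suc L)) (λ h → [ Vec.head h ℕ.≟ a ] * [ Vec.last h ℕ.≟ 0 ] * rowProduct ϖ h ks is)
            ≈⟨ ∑-words hs L _ ⟩
          ∑ hs (λ j → ∑ (words hs L) (λ h → [ j ℕ.≟ a ] * [ Vec.last (j ∷ h) ℕ.≟ 0 ] * rowProduct ϖ (j ∷ h) ks is))
            ≈⟨ ∑-cong hs (λ j → trans (∑-cong (words hs L) (λ h → *-assoc _ _ _)) (sym (*-∑ _ (words hs L) _))) ⟩
          ∑ hs (λ j → [ j ℕ.≟ a ] * ∑ (words hs L) (λ h → [ Vec.last (j ∷ h) ℕ.≟ 0 ] * rowProduct ϖ (j ∷ h) ks is))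
            ≈⟨ ∑-cong hs (λ j → *-cong ([]-⇔ (j ℕ.≟ a) (a ℕ.≟ j) ≡.sym ≡.sym) (∑-rowProduct cons closed j ks is (∈-words⁻ is∈))) ⟩
          ∑ hs (λ j → [ a ℕ.≟ j ] * row ϖ j ks is)
            ≈⟨ ∑-δ ℕ._≟_ (λ j → row ϖ j ks is) hs! a∈ ⟩
          row ϖ a ks is ∎

        -- The first row shares only the vertical labels below it with the other rows. For fixed
        -- labels there the sum factorises, and the horizontal labels of the first row are summed on
        -- their own.
        Z-chain : ∀ {n L} (ϖ : Fin n → Weights) → (∀ r → Conservative (ϖ r)) → Closed ϖ →
                  ∀ (v₀ bot : Vec ℕ L) a → VecAll.All (_∈ hs) a → Z ϖ v₀ bot a ≈ chain N n (fixedRows ϖ a) L v₀ bot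
        Z-chain {zero} ϖ cons closed v₀ bot [] _ = trans (+-identityʳ _) (trans (+-identityʳ _)
          (solve 1 (λ x → x :* (:1 :* :1) :* :1 := x) refl _))
        Z-chain {suc n} {L} ϖ cons closed v₀ bot (a ∷ as) (a∈ VecAll.∷ as∈) = begin
          ∑ (words X (suc n)) (λ v → ∑ (words Y (suc n)) (summand ϖ v₀ bot (a ∷ as) v))
            ≈⟨ ∑-words X n _ ⟩
          ∑ X (λ v₁ → ∑ (words X n) (λ v → ∑ (words Y (suc n)) (summand ϖ v₀ bot (a ∷ as) (v₁ ∷ v))))
            ≈⟨ ∑-cong X (λ v₁ → ∑-cong (words X n) (λ v → trans (∑-words Y n _)
                 (∑-cong Y (λ h → ∑-cong (words Y n) (λ hs → split v₁ v h hs))))) ⟩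
          ∑ X (λ v₁ → ∑ (words X n) (λ v → ∑ Y (λ h → ∑ (words Y n) (λ hs → f v₁ h * g v₁ v hs))))
            ≈⟨ ∑-cong X (λ v₁ → ∑-cong (words X n) (λ v → trans
                 (∑-cong Y (λ h → sym (*-∑ _ (words Y n) _))) (sym (∑-* _ Y _)))) ⟩
          ∑ X (λ v₁ → ∑ (words X n) (λ v → ∑ Y (f v₁) * ∑ (words Y n) (g v₁ v)))
            ≈⟨ ∑-cong X (λ v₁ → sym (*-∑ _ (words X n) _)) ⟩
          ∑ X (λ v₁ → ∑ Y (f v₁) * Z (ϖ ∘ Fin.suc) v₁ bot as)
            ≈⟨ ∑-cong-∈ X (λ v₁ v₁∈ → *-cong (first-row (cons Fin.zero) (closed Fin.zero) v₀ v₁ a∈ v₁∈)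
                 (Z-chain (ϖ ∘ Fin.suc) (cons ∘ Fin.suc) (closed ∘ Fin.suc) v₁ bot as as∈)) ⟩
          ∑ X (λ v₁ → row (ϖ Fin.zero) a v₀ v₁ * chain N n (fixedRows (ϖ ∘ Fin.suc) as) L v₁ bot) ∎
          where
          X = box N L
          Y = words hs (suc L)
          f : Vec ℕ L → Vec ℕ (suc L) → Carrier
          f v₁ h = [ Vec.head h ℕ.≟ a ] * [ Vec.last h ℕ.≟ 0 ] * rowProduct (ϖ Fin.zero) h v₀ v₁
          g : Vec ℕ L → Vec (Vec ℕ L) n → Vec (Vec ℕ (suc L)) n → Carrier
          g v₁ v hs = summand (ϖ ∘ Fin.suc) v₁ bot as v hs
          split : ∀ v₁ v h hs → summand ϖ v₀ bot (a ∷ as) (v₁ ∷ v) (h ∷ hs) ≈ f v₁ h * g v₁ v hs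
          split v₁ v h hs = trans
            (*-congʳ (*-congˡ (*-cong ([]-∷ (Vec.head h) a (Vec.map Vec.head hs) as) ([]-∷ (Vec.last h) 0 (Vec.map Vec.last hs) (replicate n 0)))))
            (solve 7 (λ x y z s t u w → x :* ((y :* z) :* (s :* t)) :* (u :* w) := y :* s :* u :* (x :* (z :* t) :* w))
              refl _ _ _ _ _ _ _)

      latticeSum-chain : ∀ {n L} (weight : Fin n → ℕ → ℕ → ℕ → ℕ → ℕ → Carrier) →
        let ϖ = λ r c → weight r (suc c) in (∀ r → Conservative (ϖ r)) → Closed ϖ →
        ∀ (top bot : Vec ℕ L) a → top ∈ box N L → VecAll.All (_∈ hs) a →
        latticeSum (upTo N) hs top bot a weight ≈ chain N n (fixedRows ϖ a) L top bot
      latticeSum-chain {n} {L} weight cons closed top bot a top∈ a∈ = begin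
        ∑ (filter (boundary? top bot a) (cartesianProduct (arrays (upTo N) (suc n) L) (arrays hs n (suc L)))) F
          ≈⟨ ∑-filter (boundary? top bot a) (cartesianProduct (arrays (upTo N) (suc n) L) (arrays hs n (suc L))) F ⟩
        ∑ (cartesianProduct (words X (suc n)) Y) (λ vh → [ boundary? top bot a vh ] * F vh)
          ≈⟨ ∑-cartesianProductWith _,_ (words X (suc n)) Y _ ⟩
        ∑ (words X (suc n)) (λ v → ∑ Y (λ h → [ boundary? top bot a (v , h) ] * F (v , h)))
          ≈⟨ ∑-words X n _ ⟩
        ∑ X (λ v₀ → ∑ (words X n) (λ v → ∑ Y (λ h → [ boundary? top bot a (v₀ ∷ v , h) ] * F (v₀ ∷ v , h))))
          ≈⟨ ∑-cong X (λ v₀ → ∑-cong (words X n) (λ v → ∑-cong Y (λ h → split v₀ v h))) ⟩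
        ∑ X (λ v₀ → ∑ (words X n) (λ v → ∑ Y (λ h → [ top ≟ᵛ v₀ ] * summand ϖ v₀ bot a v h)))
          ≈⟨ ∑-cong X (λ v₀ → trans (∑-cong (words X n) (λ v → sym (*-∑ _ Y _))) (sym (*-∑ _ (words X n) _))) ⟩
        ∑ X (λ v₀ → [ top ≟ᵛ v₀ ] * Z ϖ v₀ bot a)
          ≈⟨ ∑-δ _≟ᵛ_ (λ v₀ → Z ϖ v₀ bot a) (box-unique N L) top∈ ⟩
        Z ϖ top bot a
          ≈⟨ Z-chain ϖ cons closed top bot a a∈ ⟩
        chain N n (fixedRows ϖ a) L top bot ∎
        where
        ϖ : Fin n → Weights
        ϖ r c = weight r (suc c)
        X = box N L
        Y = arrays hs n (suc L)
        F : Vec (Vec ℕ L) (suc n) × Vec (Vec ℕ (suc L)) n → Carrier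
        F (v , h) = ∏[ r < n ] ∏[ c < L ] weight r (suc (toℕ c))
          (lookup (lookup v (Fin.suc r)) c) (lookup (lookup h r) (inject₁ c))
          (lookup (lookup v (inject₁ r)) c) (lookup (lookup h r) (Fin.suc c))
        split : ∀ v₀ v h → [ boundary? top bot a (v₀ ∷ v , h) ] * F (v₀ ∷ v , h)
                           ≈ [ top ≟ᵛ v₀ ] * summand ϖ v₀ bot a v h
        split v₀ v h = trans
          (*-congʳ (trans ([]-× top? (bot? ×-dec head? ×-dec last?)) (*-cong ([]-⇔ top? (top ≟ᵛ v₀) ≡.sym ≡.sym)
            (trans ([]-× bot? (head? ×-dec last?)) (*-congˡ ([]-× head? last?))))))
          (*-assoc _ _ _)
          where
          top? = v₀ ≟ᵛ top
          bot? = Vec.last (v₀ ∷ v) ≟ᵛ bot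
          head? = Vec.map Vec.head h ≟ᵛ a
          last? = Vec.map Vec.last h ≟ᵛ replicate n 0

      -- Every row contributes its left label to the difference between the top and bottom sums.
      fixedRows-balance : ∀ {n L} (ϖ : Fin n → Weights) → (∀ r → Conservative (ϖ r)) → ∀ (top bot : Vec ℕ L) a →
        sum a ℕ.+ sum bot ≢ sum top → chain N n (fixedRows ϖ a) L top bot ≈ 0#
      fixedRows-balance {zero} ϖ cons top bot [] neq = []-no (top ≟ᵛ bot) (λ { ≡.refl → neq ≡.refl })
      fixedRows-balance {suc n} {L} ϖ cons top bot (a ∷ as) neq = ∑-zero-∈ (box N L) (λ mid _ → term mid)
        where
        term : ∀ mid → row (ϖ Fin.zero) a top mid * chain N n (fixedRows (ϖ ∘ Fin.suc) as) L mid bot ≈ 0#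
        term mid with a ℕ.+ sum mid ℕ.≟ sum top
        ... | no  neq′ = 0*u (row-no (cons Fin.zero) a top mid neq′)
        ... | yes eq   = u*0 (fixedRows-balance (ϖ ∘ Fin.suc) (cons ∘ Fin.suc) mid bot as
          (λ eq′ → neq (≡.trans (ℕ.+-assoc a (sum as) (sum bot)) (≡.trans (≡.cong (a ℕ.+_) eq′) eq))))

      ∑-kernel : ∀ {L} v {ϖ} → Conservative ϖ → (ks is : Vec ℕ L) →
        (sum ks ∸ sum is ∉ hs → row ϖ (sum ks ∸ sum is) ks is ≈ 0#) →
        (∑[ a ∈ hs ] (v a * row ϖ a ks is)) ≈ kernel v ϖ L ks is
      ∑-kernel v {ϖ} cons ks is start with sum ks ∸ sum is ∈? hs
      ... | yes a∈ = ∑-single hs! a∈ (λ a _ a≢ → u*0 (row-no cons a ks is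
        (λ eq → a≢ (≡.sym (≡.trans (≡.cong (_∸ sum is) (≡.sym eq)) (ℕ.m+n∸n≡m a (sum is)))))))
      ... | no  a∉ = trans
        (∑-zero-∈ hs (λ a a∈ → u*0 (row-no cons a ks is
          (λ eq → a∉ (≡.subst (_∈ hs) (≡.trans (≡.sym (ℕ.m+n∸n≡m a (sum is))) (≡.cong (_∸ sum is) eq)) a∈)))))
        (sym (u*0 (start a∉)))

      -- The boundary weight is a product over rows, so the sum over all left labels can be carried
      -- out row by row, and in each row conservation selects one label. A selected label outside
      -- the list gives a vanishing row.
      ∑-fixedRows : ∀ {n L} (ϖ : Fin n → Weights) (v : Fin n → ℕ → Carrier) → (∀ r → Conservative (ϖ r)) →
        (∀ {L} r (ks is : Vec ℕ L) → sum ks < N → sum ks ∸ sum is ∉ hs → row (ϖ r) (sum ks ∸ sum is) ks is ≈ 0#) →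
        ∀ (top bot : Vec ℕ L) → sum top < N →
        (∑[ a ∈ words hs n ] (∏[ i < n ] v i (lookup a i)) * chain N n (fixedRows ϖ a) L top bot)
        ≈ chain N n (λ r → kernel (v r) (ϖ r)) L top bot
      ∑-fixedRows {zero} ϖ v cons start top bot _ = trans (+-identityʳ _) (*-identityˡ _)
      ∑-fixedRows {suc n} {L} ϖ v cons start top bot top<N = begin
        ∑ (words hs (suc n)) (λ a → (∏[ i < suc n ] v i (lookup a i)) * chain N (suc n) (fixedRows ϖ a) L top bot)
          ≈⟨ ∑-words hs n _ ⟩
        ∑ hs (λ a → ∑ A* (λ as → v₀ a * p as * ∑ X (λ mid → r a mid * C as mid)))
          ≈⟨ ∑-cong hs (λ a → ∑-cong A* (λ as → trans (*-∑ _ X _) (∑-cong X (λ mid →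
               solve 4 (λ v p r c → v :* p :* (r :* c) := v :* r :* (p :* c)) refl _ _ _ _)))) ⟩
        ∑ hs (λ a → ∑ A* (λ as → ∑ X (λ mid → v₀ a * r a mid * (p as * C as mid))))
          ≈⟨ ∑-cong hs (λ a → ∑-swap A* X _) ⟩
        ∑ hs (λ a → ∑ X (λ mid → ∑ A* (λ as → v₀ a * r a mid * (p as * C as mid))))
          ≈⟨ ∑-swap hs X _ ⟩
        ∑ X (λ mid → ∑ hs (λ a → ∑ A* (λ as → v₀ a * r a mid * (p as * C as mid))))
          ≈⟨ ∑-cong X (λ mid → trans (∑-cong hs (λ a → sym (*-∑ _ A* _))) (sym (∑-* _ hs _))) ⟩
        ∑ X (λ mid → ∑ hs (λ a → v₀ a * r a mid) * ∑ A* (λ as → p as * C as mid))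
          ≈⟨ ∑-cong X (λ mid → *-congʳ (∑-kernel v₀ (cons Fin.zero) top mid (start Fin.zero top mid top<N))) ⟩
        ∑ X (λ mid → kernel v₀ (ϖ Fin.zero) L top mid * ∑ A* (λ as → p as * C as mid))
          ≈⟨ ∑-cong X rest ⟩
        ∑ X (λ mid → kernel v₀ (ϖ Fin.zero) L top mid * chain N n (λ r → kernel (v (Fin.suc r)) (ϖ (Fin.suc r))) L mid bot) ∎
        where
        X = box N L
        A* = words hs n
        v₀ = v Fin.zero
        p : Vec ℕ n → Carrier
        p as = ∏[ i < n ] v (Fin.suc i) (lookup as i)
        r : ℕ → Vec ℕ L → Carrier
        r a mid = row (ϖ Fin.zero) a top mid
        C : Vec ℕ n → Vec ℕ L → Carrier
        C as mid = chain N n (fixedRows (ϖ ∘ Fin.suc) as) L mid bot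
        rest : ∀ mid → kernel v₀ (ϖ Fin.zero) L top mid * ∑ A* (λ as → p as * C as mid)
                       ≈ kernel v₀ (ϖ Fin.zero) L top mid * chain N n (λ r → kernel (v (Fin.suc r)) (ϖ (Fin.suc r))) L mid bot
        rest mid with kernel-descending {v₀} (cons Fin.zero) L top mid
        ... | inj₁ k≈0 = trans (0*u k≈0) (sym (0*u k≈0))
        ... | inj₂ mid⊑ = *-congˡ (∑-fixedRows (ϖ ∘ Fin.suc) (v ∘ Fin.suc) (cons ∘ Fin.suc) (start ∘ Fin.suc) mid bot
          (ℕ.≤-<-trans (⊑⇒sum≤ mid top mid⊑) top<N))

-- Partitions and the multiplicities of their conjugates

multiplicities : List ℕ → (L : ℕ) → Vec ℕ L
multiplicities xs L = tabulate {n = L} (λ i → entry xs (toℕ i) ∸ entry xs (suc (toℕ i)))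

entry≤ : ∀ {x xs} → Linked _≥_ (x ∷ xs) → entry xs 0 ≤ x
entry≤ [-]        = z≤n
entry≤ (x≥y ∷ _) = x≥y

sum-[] : ∀ L → sum (multiplicities [] L) ≡ 0
sum-[] zero    = ≡.refl
sum-[] (suc L) = sum-[] L

sum-mult : ∀ {xs} → Linked _≥_ xs → ∀ {L} → length xs ≤ L → sum (multiplicities xs L) ≡ entry xs 0
sum-mult {[]}     _  {L}     _        = sum-[] L
sum-mult {x ∷ xs} ds {suc L} (s≤s le) = ≡.trans
  (≡.cong (x ∸ entry xs 0 ℕ.+_) (sum-mult (Linked.tail ds) le)) (ℕ.m∸n+n≡m (entry≤ ds))

mult-∷ʳ0 : ∀ xs {L} → length xs ≤ L → multiplicities xs (suc L) ≡ multiplicities xs L ∷ʳ 0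
mult-∷ʳ0 []       {zero}  _        = ≡.refl
mult-∷ʳ0 []       {suc L} _        = ≡.cong (0 ∷_) (mult-∷ʳ0 [] z≤n)
mult-∷ʳ0 (x ∷ xs) {suc L} (s≤s le) = ≡.cong (x ∸ entry xs 0 ∷_) (mult-∷ʳ0 xs le)

mult-ZeroFrom : ∀ xs L → ZeroFrom (length xs) (multiplicities xs L)
mult-ZeroFrom []       L       = sum≡0⇒ZeroFrom (multiplicities [] L) (sum-[] L)
mult-ZeroFrom (x ∷ xs) zero    = tt
mult-ZeroFrom (x ∷ xs) (suc L) = mult-ZeroFrom xs L

ZeroFrom-length : ∀ {xs} → Linked _≥_ xs → All (0 <_) xs → ∀ c {L} → length xs ≤ L →
                  ZeroFrom c (multiplicities xs L) → length xs ≤ c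
ZeroFrom-length {[]}     _  _          c       _        _       = z≤n
ZeroFrom-length {x ∷ xs} ds (0<x ∷ _)  zero    {suc L} (s≤s le) (h , t) = contradiction
  (≡.trans (≡.sym (sum-mult ds (s≤s le))) (≡.cong₂ ℕ._+_ h (zeros (multiplicities xs L) t))) (ℕ.>⇒≢ 0<x)
  where
  zeros : ∀ {L} (v : Vec ℕ L) → ZeroFrom 0 v → sum v ≡ 0
  zeros []      _       = ≡.refl
  zeros (x ∷ v) (h , t) = ≡.cong₂ ℕ._+_ h (zeros v t)
ZeroFrom-length {x ∷ xs} ds (_ ∷ pos)  (suc c) (s≤s le) z       = s≤s (ZeroFrom-length (Linked.tail ds) pos c le z)

-- A zero suffix sum means that all later suffix sums are zero as well, so the list of nonzero parts
-- ends there.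
consPositive : ℕ → List ℕ → List ℕ
consPositive zero    xs = []
consPositive (suc s) xs = suc s ∷ xs

-- The part λ_i is the sum of the multiplicities m_j(λ′) over j ≥ i.
toParts : ∀ {L} → Vec ℕ L → List ℕ
toParts []      = []
toParts (m ∷ v) = consPositive (m ℕ.+ sum v) (toParts v)

toParts-entry : ∀ {L} (v : Vec ℕ L) → entry (toParts v) 0 ≡ sum v
toParts-entry []      = ≡.refl
toParts-entry (m ∷ v) with m ℕ.+ sum v
... | zero  = ≡.refl
... | suc s = ≡.refl

toParts-length : ∀ {L} (v : Vec ℕ L) → length (toParts v) ≤ L
toParts-length []      = z≤n
toParts-length (m ∷ v) with m ℕ.+ sum v
... | zero  = z≤n
... | suc s = s≤s (toParts-length v)

consPositive-linked : ∀ s xs → entry xs 0 ≤ s → Linked _≥_ xs → Linked _≥_ (consPositive s xs)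
consPositive-linked zero    xs       _  _  = []
consPositive-linked (suc s) []       _  _  = [-]
consPositive-linked (suc s) (x ∷ xs) le ds = le ∷ ds

toParts-linked : ∀ {L} (v : Vec ℕ L) → Linked _≥_ (toParts v)
toParts-linked []      = []
toParts-linked (m ∷ v) = consPositive-linked (m ℕ.+ sum v) (toParts v)
  (ℕ.≤-trans (ℕ.≤-reflexive (toParts-entry v)) (ℕ.m≤n+m (sum v) m)) (toParts-linked v)

toParts-positive : ∀ {L} (v : Vec ℕ L) → All (0 <_) (toParts v)
toParts-positive []      = []
toParts-positive (m ∷ v) with m ℕ.+ sum v
... | zero  = []
... | suc s = s≤s z≤n ∷ toParts-positive v

mult-[] : ∀ {L} (v : Vec ℕ L) → sum v ≡ 0 → multiplicities [] L ≡ v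
mult-[] []      _  = ≡.refl
mult-[] (m ∷ v) eq = ≡.cong₂ _∷_ (≡.sym (ℕ.m+n≡0⇒m≡0 m eq)) (mult-[] v (ℕ.m+n≡0⇒n≡0 m eq))

mult-toParts : ∀ {L} (v : Vec ℕ L) → multiplicities (toParts v) L ≡ v
mult-toParts []      = ≡.refl
mult-toParts (m ∷ v) with m ℕ.+ sum v in eq
... | zero  = mult-[] (m ∷ v) eq
... | suc s = ≡.cong₂ _∷_
  (≡.trans (≡.cong₂ _∸_ (≡.sym eq) (toParts-entry v)) (ℕ.m+n∸n≡m m (sum v))) (mult-toParts v)

toParts-mult : ∀ {xs} → Linked _≥_ xs → All (0 <_) xs → ∀ {L} → length xs ≤ L → toParts (multiplicities xs L) ≡ xs
toParts-mult {[]}         _  _         {L}     _        = toParts-[] L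
  where
  toParts-[] : ∀ L → toParts (multiplicities [] L) ≡ []
  toParts-[] zero    = ≡.refl
  toParts-[] (suc L) = ≡.cong (λ s → consPositive s (toParts (multiplicities [] L))) (sum-[] L)
toParts-mult {suc x ∷ xs} ds (_ ∷ pos) {suc L} (s≤s le) = ≡.cong₂ consPositive
  (sum-mult ds (s≤s le)) (toParts-mult (Linked.tail ds) pos le)

-- The stored proof is irrelevant; decidability of the property recovers one that can be used.
decreasing : ∀ ƛ → Linked _≥_ (parts ƛ)
decreasing (partition xs ds _) = recompute (Linked.linked? (λ x y → y ℕ.≤? x) xs) ds

positive : ∀ ƛ → All (0 <_) (parts ƛ)
positive (partition xs _ ps) = recompute (All.all? (0 ℕ.<?_) xs) ps

parts-injective : ∀ {ƛ μ} → parts ƛ ≡ parts μ → ƛ ≡ μ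
parts-injective {partition xs _ _} {partition .xs _ _} ≡.refl = ≡.refl

labels : (ƛ : Partition) (L : ℕ) → Vec ℕ L
labels ƛ = multiplicities (parts ƛ)

sum-labels : ∀ ƛ {L} → ℓ ƛ ≤ L → Vec.sum (labels ƛ L) ≡ part ƛ 0
sum-labels ƛ = sum-mult (decreasing ƛ)

labels-∷ʳ0 : ∀ ƛ {L} → ℓ ƛ ≤ L → labels ƛ (suc L) ≡ labels ƛ L ∷ʳ 0
labels-∷ʳ0 ƛ = mult-∷ʳ0 (parts ƛ)

labels-ZeroFrom : ∀ ƛ L → ZeroFrom (ℓ ƛ) (labels ƛ L)
labels-ZeroFrom ƛ = mult-ZeroFrom (parts ƛ)

ZeroFrom⇒ℓ≤ : ∀ ƛ c {L} → ℓ ƛ ≤ L → ZeroFrom c (labels ƛ L) → ℓ ƛ ≤ c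
ZeroFrom⇒ℓ≤ ƛ = ZeroFrom-length (decreasing ƛ) (positive ƛ)

fromLabels : ∀ {L} → Vec ℕ L → Partition
fromLabels v = partition (toParts v) (toParts-linked v) (toParts-positive v)

ℓ-fromLabels : ∀ {L} (v : Vec ℕ L) → ℓ (fromLabels v) ≤ L
ℓ-fromLabels = toParts-length

labels-fromLabels : ∀ {L} (v : Vec ℕ L) → labels (fromLabels v) L ≡ v
labels-fromLabels = mult-toParts

fromLabels-labels : ∀ ƛ {L} → ℓ ƛ ≤ L → fromLabels (labels ƛ L) ≡ ƛ
fromLabels-labels ƛ le = parts-injective (toParts-mult (decreasing ƛ) (positive ƛ) le)

-- The change of gauge between the weights w and ŵ

module Gauge {c ℓ₁ ℓ₂} (K : Field c ℓ₁ ℓ₂) (q : Field.Carrier K)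
  (qᵏ#1 : ∀ k → Field._#_ K (Field._^_ K q (suc k)) (Field.1# K)) where

  open Field K hiding (zero)
  open FieldProperties K
  open Functions K q
  open QWeights K q
  open Sums K q
  open Rows K q
  open Zipper K q qᵏ#1
  open SingleExchange K q qᵏ#1
  open Lattice K q
  open CommutativeRing commutativeRing using (commutativeSemiring)
  open Algebra.Properties.CommutativeSemiring.Exp commutativeSemiring using (^-distrib-*)
  open import Relation.Binary.Reasoning.Setoid setoid

  -- For the vector of multiplicities of λ′, σ S is the square of (−S)^λ and
  -- γ (S ∘ suc) is c_S(λ).
  σ σ⁺ : ∀ {L} → Seq → Vec ℕ L → Carrier
  σ  S v       = (S 0 * S 0) ^ sum v * σ⁺ S v
  σ⁺ S []      = 1#
  σ⁺ S (_ ∷ v) = σ (S ∘ suc) v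

  γ : ∀ {L} → Seq → Vec ℕ L → Carrier
  γ S []      = 1#
  γ S (m ∷ v) = poch-ratio (S 0 ^ 2) q m * γ (S ∘ suc) v

  ^#0 : ∀ {x} n → x # 0# → x ^ n # 0#
  ^#0 zero    x#0 = 1#0
  ^#0 (suc n) x#0 = x*y#0 x#0 (^#0 n x#0)

  σ-zero : ∀ {L} S (v : Vec ℕ L) → sum v ≡ 0 → σ S v ≈ 1#
  σ-zero S []      _  = *-identityˡ 1#
  σ-zero S (m ∷ v) eq = trans (*-cong (reflexive (≡.cong ((S 0 * S 0) ^_) eq))
    (σ-zero (S ∘ suc) v (ℕ.m+n≡0⇒n≡0 m eq))) (*-identityˡ 1#)

  private
    neg² : ∀ s n → (- s) ^ n * (- s) ^ n ≈ (s * s) ^ n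
    neg² s n = trans (sym (^-distrib-* (- s) (- s) n))
      (^-congˡ n (solve 1 (λ s → :- s :* :- s := s :* s) refl s))

  -- In the square the signs disappear, and each exponent, a part of the partition, is a suffix sum
  -- of multiplicities.
  negPow² : ∀ S ƛ {L} → ℓ ƛ ≤ L → negPow S ƛ * negPow S ƛ ≈ σ S (labels ƛ L)
  negPow² S ƛ = go S (parts ƛ) (decreasing ƛ)
    where
    np : Seq → List ℕ → Carrier
    np S xs = ∏[ i < length xs ] ((- S (toℕ i)) ^ entry xs (toℕ i))
    go : ∀ S xs → Linked _≥_ xs → ∀ {L} → length xs ≤ L → np S xs * np S xs ≈ σ S (multiplicities xs L)
    go S []       ds {L}     _        = trans (*-identityˡ 1#) (sym (σ-zero S (multiplicities [] L) (sum-[] L)))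
    go S (x ∷ xs) ds {suc L} (s≤s le) = begin
      (- S 0) ^ x * np (S ∘ suc) xs * ((- S 0) ^ x * np (S ∘ suc) xs)
        ≈⟨ solve 2 (λ a b → a :* b :* (a :* b) := a :* a :* (b :* b)) refl _ _ ⟩
      (- S 0) ^ x * (- S 0) ^ x * (np (S ∘ suc) xs * np (S ∘ suc) xs)
        ≈⟨ *-cong (neg² (S 0) x) (go (S ∘ suc) xs (Linked.tail ds) le) ⟩
      (S 0 * S 0) ^ x * σ (S ∘ suc) (multiplicities xs L)
        ≡⟨ ≡.cong (λ n → (S 0 * S 0) ^ n * σ (S ∘ suc) (multiplicities xs L)) (≡.sym (sum-mult ds (s≤s le))) ⟩
      σ S (multiplicities (x ∷ xs) (suc L)) ∎

  𝖼-γ : ∀ S ƛ {L} → ℓ ƛ ≤ L → 𝖼 S ƛ ≈ γ (S ∘ suc) (labels ƛ L)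
  𝖼-γ S ƛ = go (S ∘ suc) (parts ƛ)
    where
    cs : Seq → List ℕ → Carrier
    cs S xs = ∏[ i < length xs ]
      (poch (S (toℕ i) ^ 2) (entry xs (toℕ i) ∸ entry xs (suc (toℕ i))) / poch q (entry xs (toℕ i) ∸ entry xs (suc (toℕ i))))
    go : ∀ S xs {L} → length xs ≤ L → cs S xs ≈ γ S (multiplicities xs L)
    go S []       {zero}  _        = refl
    go S []       {suc L} _        = sym (trans (*-cong (poch-ratio-zero (S 0 ^ 2) q) (sym (go (S ∘ suc) [] {L} z≤n))) (*-identityˡ 1#))
    go S (x ∷ xs) {suc L} (s≤s le) = *-congˡ (go (S ∘ suc) xs le)

  negPow#0 : ∀ {S} ƛ → (∀ i → S i # 0#) → negPow S ƛ # 0#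
  negPow#0 ƛ S#0 = ∏#0 (ℓ ƛ) (λ i → ^#0 (part ƛ (toℕ i)) (-x#0 (S#0 (toℕ i))))

  𝖼#0 : ∀ {S} ƛ → (∀ i k → S (suc i) ^ 2 * q ^ k # 1#) → 𝖼 S ƛ # 0#
  𝖼#0 ƛ S#1 = ∏#0 (ℓ ƛ) (λ i → x*y#0 (poch#0 (conjMult ƛ (toℕ i)) (S#1 (toℕ i)))
    (x⁻¹#0 (poch#0 (conjMult ƛ (toℕ i)) qᵏ#1)))

  -- Column c of the lattice, counted from 0, carries the parameters with index c + 1.
  wRow : Carrier → Seq → Seq → Weights
  wRow u Ξ S c = w (u * Ξ (suc c)) (S (suc c))

  w-conservative : ∀ u Ξ S → Conservative (wRow u Ξ S)
  w-conservative u Ξ S c i j k l neq = if-no neq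

  if-zero : ∀ m n {x} → x ≈ 0# → (if does (m ℕ.≟ n) then x else 0#) ≈ 0#
  if-zero m n x≈0 with m ℕ.≟ n
  ... | yes eq  = trans (if-yes eq) x≈0
  ... | no  neq = if-no neq

  w-zeroʳ : ∀ u s g j k l → w u s g j k (suc (suc l)) ≈ 0#
  w-zeroʳ u s g 0             k l = if-zero (g ℕ.+ 0) (k ℕ.+ suc (suc l)) (0*u refl)
  w-zeroʳ u s g 1             k l = if-zero (g ℕ.+ 1) (k ℕ.+ suc (suc l)) (0*u refl)
  w-zeroʳ u s g (suc (suc j)) k l = if-zero (g ℕ.+ suc (suc j)) (k ℕ.+ suc (suc l)) (0*u refl)

  w-zeroˡ : ∀ u s g j k l → w u s g (suc (suc j)) k l ≈ 0#
  w-zeroˡ u s g j k l = if-zero (g ℕ.+ suc (suc j)) (k ℕ.+ l) (0*u refl)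

  row-w-zero : ∀ {L} u Ξ S j (ks is : Vec ℕ L) → row (wRow u Ξ S) (suc (suc j)) ks is ≈ 0#
  row-w-zero u Ξ S j []       []       = refl
  row-w-zero u Ξ S j (k ∷ ks) (i ∷ is) = 0*u (w-zeroˡ _ _ i j k _)

  module Local {u s y : Carrier} (y*s² : y * (s * s) ≈ s * u) (s²qᵏ#1 : ∀ k → s ^ 2 * q ^ k # 1#) where

    private
      g : ℕ → Carrier
      g = poch-ratio (s ^ 2) q

      g-suc : ∀ k → g (suc k) * (1# - q ^ suc k) ≈ g k * (1# - s ^ 2 * q ^ k)
      g-suc = poch-ratio-suc qᵏ#1

      numʷ : ℕ → ℕ → ℕ → Carrier
      numʷ g 0 0 = 1# - s * u * q ^ g
      numʷ g 0 1 = (q ^ g - 1#) * (s * u)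
      numʷ g 1 0 = 1# - s ^ 2 * q ^ g
      numʷ g 1 1 = s ^ 2 * q ^ g - s * u
      numʷ g _ _ = 0#

      cancel-/ : ∀ {n m a b d} → n * a ≈ m * b → n / d * a ≈ m / d * b
      cancel-/ {n} {m} {a} {b} {d} eq = begin
        n * d ⁻¹ * a    ≈⟨ solve 3 (λ n d a → n :* d :* a := d :* (n :* a)) refl _ _ _ ⟩
        d ⁻¹ * (n * a)  ≈⟨ *-congˡ eq ⟩
        d ⁻¹ * (m * b)  ≈⟨ solve 3 (λ n d a → n :* d :* a := d :* (n :* a)) refl _ _ _ ⟨
        m * d ⁻¹ * b    ∎

      numerators : ∀ i j k l → i ℕ.+ j ≡ k ℕ.+ l →
                   num (s * u) y i j l * (g k * (s * s) ^ l) ≈ numʷ i j l * g i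
      numerators i 0 k 0 eq with ≡.trans (≡.sym (ℕ.+-identityʳ i)) (≡.trans eq (ℕ.+-identityʳ k))
      ... | ≡.refl = *-congˡ (*-identityʳ _)
      numerators i 0 k 1 eq with ≡.trans (≡.sym (ℕ.+-identityʳ i)) (≡.trans eq (ℕ.+-comm k 1))
      ... | ≡.refl = begin
        - (y - s * u * q ^ k) * (g k * (s * s * 1#))
          ≈⟨ solve 5 (λ y a Q g ss → :- (y :- a :* Q) :* (g :* (ss :* :1)) := :- (g :* (y :* ss :- a :* (ss :* Q))))
               refl y (s * u) (q ^ k) (g k) (s * s) ⟩
        - (g k * (y * (s * s) - s * u * (s * s * q ^ k)))
          ≈⟨ -‿cong (*-congˡ (+-congʳ y*s²)) ⟩
        - (g k * (s * u - s * u * (s * s * q ^ k)))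
          ≈⟨ solve 4 (λ g s u Q → :- (g :* (s :* u :- s :* u :* (s :* s :* Q)))
               := :- (s :* u :* (g :* (:1 :- s :* (s :* :1) :* Q)))) refl (g k) s u (q ^ k) ⟩
        - (s * u * (g k * (1# - s ^ 2 * q ^ k)))
          ≈⟨ -‿cong (*-congˡ (g-suc k)) ⟨
        - (s * u * (g (suc k) * (1# - q ^ suc k)))
          ≈⟨ solve 3 (λ a g Q → :- (a :* (g :* (:1 :- Q))) := (Q :- :1) :* a :* g) refl (s * u) (g (suc k)) (q ^ suc k) ⟩
        (q ^ suc k - 1#) * (s * u) * g (suc k) ∎
      numerators i 0 k (suc (suc l)) eq = trans (zeroˡ _) (sym (zeroˡ _))
      numerators i 1 k 0 eq with ≡.trans (ℕ.+-comm 1 i) (≡.trans eq (ℕ.+-identityʳ k))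
      ... | ≡.refl = begin
        (1# - q ^ suc i) * (g (suc i) * 1#)  ≈⟨ trans (*-congˡ (*-identityʳ _)) (*-comm _ _) ⟩
        g (suc i) * (1# - q ^ suc i)         ≈⟨ g-suc i ⟩
        g i * (1# - s ^ 2 * q ^ i)           ≈⟨ *-comm _ _ ⟩
        (1# - s ^ 2 * q ^ i) * g i           ∎
      numerators i 1 k 1 eq with ℕ.+-cancelʳ-≡ 1 i k eq
      ... | ≡.refl = begin
        (q ^ i - y) * (g i * (s * s * 1#))
          ≈⟨ solve 4 (λ Q y g s → (Q :- y) :* (g :* (s :* s :* :1)) := (s :* (s :* :1) :* Q :- y :* (s :* s)) :* g)
               refl (q ^ i) y (g i) s ⟩
        (s ^ 2 * q ^ i - y * (s * s)) * g i
          ≈⟨ *-congʳ (+-congˡ (-‿cong y*s²)) ⟩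
        (s ^ 2 * q ^ i - s * u) * g i ∎
      numerators i 1 k (suc (suc l)) eq = trans (zeroˡ _) (sym (zeroˡ _))
      numerators i (suc (suc j)) k l eq = trans (zeroˡ _) (sym (zeroˡ _))

      w-numʷ : ∀ i j k l → i ℕ.+ j ≡ k ℕ.+ l → w u s i j k l ≈ numʷ i j l / (1# - s * u)
      w-numʷ i 0 k 0 eq = if-yes eq
      w-numʷ i 0 k 1 eq = if-yes eq
      w-numʷ i 0 k (suc (suc l)) eq = if-yes eq
      w-numʷ i 1 k 0 eq = if-yes eq
      w-numʷ i 1 k 1 eq = if-yes eq
      w-numʷ i 1 k (suc (suc l)) eq = if-yes eq
      w-numʷ i (suc (suc j)) k l eq = if-yes eq

    -- The recursion g(k+1)(1 - q^(k+1)) = g(k)(1 - s²q^k) trades the two kinds of factors in the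
    -- numerators, while a factor s² for the right label turns y into s u. The diagonal case needs
    -- neither, as its numerators agree.
    vertex-gauge : ∀ i j k l → ŵ (λ _ → s * u) (λ _ → y) 0 i j k l * (g k * (s * s) ^ l) ≈ w u s i j k l * g i
    vertex-gauge i j k l with i ℕ.+ j ℕ.≟ k ℕ.+ l
    ... | no  neq = trans (0*u (if-no neq)) (sym (0*u (if-no neq)))
    ... | yes eq  = trans (*-congʳ (if-yes eq)) (trans (cancel-/ (numerators i j k l eq)) (sym (*-congʳ (w-numʷ i j k l eq))))

  -- `θ` stands for the ratio ξ/s. It is a separate parameter because one and the same sequence
  -- serves for Ξ, S and for their shifts by τ.
  module _ (u : Carrier) (Ξ S θ : Seq) where

    Û Ŷ : Seq
    Û i = S (suc i) * (u * Ξ (suc i))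
    Ŷ i = u * θ (suc i)

    ŵRow : Weights
    ŵRow = ŵ Û Ŷ

    -- The two left boundary weights have quotient s₀² when the label is 1; the factor of index 0 in
    -- `σ` absorbs it.
    v-w v-ŵ : ℕ → Carrier
    v-w a = (- (u * Ξ 0 * S 0)) ^ a
    v-ŵ a = (- (u * θ 0)) ^ a

  private
    θ-relation : ∀ {u ξ s t} → t * s ≈ ξ → u * t * (s * s) ≈ s * (u * ξ)
    θ-relation {u} {ξ} {s} {t} ts≈ξ = trans
      (solve 3 (λ u t s → u :* t :* (s :* s) := s :* (u :* (t :* s))) refl u t s) (*-congˡ (*-congˡ ts≈ξ))

  -- In the columns to the right conservation reads sum ks = l + sum is. The power of s² attached to
  -- `ks` thus splits into the power attached to `is` and the factor (s²)^l that `vertex-gauge`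
  -- consumes.
  row-gauge : ∀ {L} u (Ξ S θ : Seq) → (∀ i → θ i * S i ≈ Ξ i) → (∀ i k → S (suc i) ^ 2 * q ^ k # 1#) →
    ∀ j (ks is : Vec ℕ L) →
    row (ŵRow u Ξ S θ) j ks is * (σ⁺ S ks * γ (S ∘ suc) ks) ≈ row (wRow u Ξ S) j ks is * (σ⁺ S is * γ (S ∘ suc) is)
  row-gauge u Ξ S θ θS s²qᵏ#1 j []       []       = refl
  row-gauge u Ξ S θ θS s²qᵏ#1 j (k ∷ ks) (i ∷ is) with i ℕ.+ j ∸ k
  ... | l with l ℕ.+ sum is ℕ.≟ sum ks
  ...   | no  neq = trans (0*u (u*0 (row-no (ŵ-conservative _ _) l ks is neq)))
    (sym (0*u (u*0 (row-no (w-conservative u (Ξ ∘ suc) (S ∘ suc)) l ks is neq))))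
  ...   | yes eq = begin
    x * r * (s² ^ sum ks * σk * (gk * γk))
      ≈⟨ *-congˡ (*-congʳ (*-congʳ (trans (reflexive (≡.cong (s² ^_) (≡.sym eq))) (^-homo-* s² l (sum is))))) ⟩
    x * r * (s² ^ l * s² ^ sum is * σk * (gk * γk))
      ≈⟨ solve 7 (λ x r sl si σk gk γk → x :* r :* (sl :* si :* σk :* (gk :* γk)) := x :* (gk :* sl) :* si :* (r :* (σk :* γk)))
           refl x r (s² ^ l) (s² ^ sum is) σk gk γk ⟩
    x * (gk * s² ^ l) * s² ^ sum is * (r * (σk * γk))
      ≈⟨ *-cong (*-congʳ (vertex-gauge i j k l)) (row-gauge u (Ξ ∘ suc) (S ∘ suc) (θ ∘ suc) (θS ∘ suc) (s²qᵏ#1 ∘ suc) l ks is) ⟩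
    x′ * gi * s² ^ sum is * (r′ * (σi * γi))
      ≈⟨ solve 6 (λ x r si σk gk γk → x :* gk :* si :* (r :* (σk :* γk)) := x :* r :* (si :* σk :* (gk :* γk)))
           refl x′ r′ (s² ^ sum is) σi gi γi ⟩
    x′ * r′ * (s² ^ sum is * σi * (gi * γi)) ∎
    where
    open Local {u * Ξ 1} {S 1} {u * θ 1} (θ-relation (θS 1)) (s²qᵏ#1 0)
    s² = S 1 * S 1
    x = ŵRow u Ξ S θ 0 i j k l
    x′ = wRow u Ξ S 0 i j k l
    r = row (ŵRow u Ξ S θ ∘ suc) l ks is
    r′ = row (wRow u Ξ S ∘ suc) l ks is
    σk = σ⁺ (S ∘ suc) ks
    σi = σ⁺ (S ∘ suc) is
    gk = poch-ratio (S 1 ^ 2) q k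
    gi = poch-ratio (S 1 ^ 2) q i
    γk = γ (S ∘ suc ∘ suc) ks
    γi = γ (S ∘ suc ∘ suc) is

  gauge : ∀ {L} → Seq → Vec ℕ L → Carrier
  gauge S v = σ S v * γ (S ∘ suc) v

  kernel-gauge : ∀ u (Ξ S θ : Seq) → (∀ i → θ i * S i ≈ Ξ i) → (∀ i k → S (suc i) ^ 2 * q ^ k # 1#) → ∀ L (ks is : Vec ℕ L) →
    kernel (v-ŵ u Ξ S θ) (ŵRow u Ξ S θ) L ks is * gauge S ks ≈ kernel (v-w u Ξ S θ) (wRow u Ξ S) L ks is * gauge S is
  kernel-gauge u Ξ S θ θS s²qᵏ#1 L ks is with sum ks ∸ sum is in eqᵃ
  ... | a with a ℕ.+ sum is ℕ.≟ sum ks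
  ...   | no  neq = trans (0*u (u*0 (row-no (ŵ-conservative _ _) a ks is neq)))
    (sym (0*u (u*0 (row-no (w-conservative u Ξ S) a ks is neq))))
  ...   | yes eq = begin
    v-ŵ u Ξ S θ a * r * (s² ^ sum ks * σk * γk)
      ≈⟨ *-congˡ (*-congʳ (*-congʳ (trans (reflexive (≡.cong (s² ^_) (≡.sym eq))) (^-homo-* s² a (sum is))))) ⟩
    v-ŵ u Ξ S θ a * r * (s² ^ a * s² ^ sum is * σk * γk)
      ≈⟨ solve 6 (λ v r sl si σk γk → v :* r :* (sl :* si :* σk :* γk) := v :* sl :* si :* (r :* (σk :* γk)))
           refl (v-ŵ u Ξ S θ a) r (s² ^ a) (s² ^ sum is) σk γk ⟩
    v-ŵ u Ξ S θ a * s² ^ a * s² ^ sum is * (r * (σk * γk))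
      ≈⟨ *-cong (*-congʳ boundary) (row-gauge u Ξ S θ θS s²qᵏ#1 a ks is) ⟩
    v-w u Ξ S θ a * s² ^ sum is * (r′ * (σ⁺ S is * γ (S ∘ suc) is))
      ≈⟨ solve 5 (λ v r si σk γk → v :* si :* (r :* (σk :* γk)) := v :* r :* (si :* σk :* γk))
           refl (v-w u Ξ S θ a) r′ (s² ^ sum is) (σ⁺ S is) (γ (S ∘ suc) is) ⟩
    v-w u Ξ S θ a * r′ * (s² ^ sum is * σ⁺ S is * γ (S ∘ suc) is) ∎
    where
    s² = S 0 * S 0
    r = row (ŵRow u Ξ S θ) a ks is
    r′ = row (wRow u Ξ S) a ks is
    σk = σ⁺ S ks
    γk = γ (S ∘ suc) ks
    boundary : v-ŵ u Ξ S θ a * s² ^ a ≈ v-w u Ξ S θ a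
    boundary = trans (sym (^-distrib-* (- (u * θ 0)) s² a)) (^-congˡ a (begin
      - (u * θ 0) * (S 0 * S 0)  ≈⟨ solve 3 (λ u t s → :- (u :* t) :* (s :* s) := :- (u :* (t :* s) :* s)) refl u (θ 0) (S 0) ⟩
      - (u * (θ 0 * S 0) * S 0)  ≈⟨ -‿cong (*-congʳ (*-congˡ (θS 0))) ⟩
      - (u * Ξ 0 * S 0)          ∎))

  chain-gauge : ∀ N m {B B′ : Fin m → Kernel} (g : ∀ {L} → Vec ℕ L → Carrier) →
    (∀ r L (ks is : Vec ℕ L) → B r L ks is * g ks ≈ B′ r L ks is * g is) →
    ∀ L ks is → chain N m B L ks is * g ks ≈ chain N m B′ L ks is * g is
  chain-gauge N zero    g eqs L ks is with ks ≟ᵛ is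
  ... | yes ≡.refl = refl
  ... | no  _      = trans (zeroˡ _) (sym (zeroˡ _))
  chain-gauge N (suc m) {B} {B′} g eqs L ks is = begin
    ∑ (box N L) (λ js → B Fin.zero L ks js * chain N m (B ∘ Fin.suc) L js is) * g ks
      ≈⟨ ∑-* (g ks) (box N L) _ ⟩
    ∑ (box N L) (λ js → B Fin.zero L ks js * chain N m (B ∘ Fin.suc) L js is * g ks)
      ≈⟨ ∑-cong (box N L) term ⟩
    ∑ (box N L) (λ js → B′ Fin.zero L ks js * chain N m (B′ ∘ Fin.suc) L js is * g is)
      ≈⟨ ∑-* (g is) (box N L) _ ⟨
    ∑ (box N L) (λ js → B′ Fin.zero L ks js * chain N m (B′ ∘ Fin.suc) L js is) * g is ∎
    where
    term : ∀ js → B Fin.zero L ks js * chain N m (B ∘ Fin.suc) L js is * g ks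
                  ≈ B′ Fin.zero L ks js * chain N m (B′ ∘ Fin.suc) L js is * g is
    term js = begin
      B Fin.zero L ks js * C * g ks   ≈⟨ solve 3 (λ b c g → b :* c :* g := b :* g :* c) refl _ _ _ ⟩
      B Fin.zero L ks js * g ks * C   ≈⟨ *-congʳ (eqs Fin.zero L ks js) ⟩
      B′ Fin.zero L ks js * g js * C  ≈⟨ solve 3 (λ b g c → b :* g :* c := b :* (c :* g)) refl _ _ _ ⟩
      B′ Fin.zero L ks js * (C * g js)
        ≈⟨ *-congˡ (chain-gauge N m g (eqs ∘ Fin.suc) L js is) ⟩
      B′ Fin.zero L ks js * (C′ * g is)  ≈⟨ *-assoc _ _ _ ⟨
      B′ Fin.zero L ks js * C′ * g is ∎
      where
      C = chain N m (B ∘ Fin.suc) L js is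
      C′ = chain N m (B′ ∘ Fin.suc) L js is

-- The functions of the theorem as entries of chains

module Reduction {c ℓ₁ ℓ₂} (K : Field c ℓ₁ ℓ₂) (q : Field.Carrier K)
  (qᵏ#1 : ∀ k → Field._#_ K (Field._^_ K q (suc k)) (Field.1# K)) where

  open Field K hiding (zero)
  open FieldProperties K
  open Functions K q
  open QWeights K q
  open Sums K q
  open Rows K q
  open Zipper K q qᵏ#1
  open SingleExchange K q qᵏ#1
  open Lattice K q
  open Gauge K q qᵏ#1
  open import Relation.Binary.Reasoning.Setoid setoid

  module _ {n} {B : Fin n → Kernel} (desc : ∀ r → Descending (B r)) (stable : ∀ r → Stable (B r)) (ƛ μ : Partition) where

    private
      M : ℕ
      M = ℓ ƛ ⊔ ℓ μ

      at : ℕ → ℕ → Carrier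
      at N L = chain N n B L (labels ƛ L) (labels μ L)

      drop-columns : ∀ N d → at (suc N) (d ℕ.+ M) ≈ at (suc N) M
      drop-columns N zero    = refl
      drop-columns N (suc d) = trans
        (reflexive (≡.cong₂ (chain (suc N) n B (suc (d ℕ.+ M)))
          (labels-∷ʳ0 ƛ (ℕ.≤-trans (ℕ.m≤m⊔n (ℓ ƛ) (ℓ μ)) (ℕ.m≤n+m M d)))
          (labels-∷ʳ0 μ (ℕ.≤-trans (ℕ.m≤n⊔m (ℓ ƛ) (ℓ μ)) (ℕ.m≤n+m M d)))))
        (trans (chain-stable N n desc stable (d ℕ.+ M) (labels ƛ (d ℕ.+ M)) (labels μ (d ℕ.+ M))) (drop-columns N d))

      at-M : ∀ N {L} → M ≤ L → at (suc N) L ≈ at (suc N) M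
      at-M N M≤L = trans (reflexive (≡.cong (at (suc N)) (≡.sym (ℕ.m∸n+n≡m M≤L)))) (drop-columns N _)

    chain-labels : ∀ {N N′ L L′} → part ƛ 0 < N → part ƛ 0 < N′ → M ≤ L → M ≤ L′ →
                   chain N n B L (labels ƛ L) (labels μ L) ≈ chain N′ n B L′ (labels ƛ L′) (labels μ L′)
    chain-labels {suc N} {suc N′} {L} {L′} lt lt′ le le′ = begin
      at (suc N) L    ≈⟨ at-M N le ⟩
      at (suc N) M    ≈⟨ chain-enlarge n desc M (labels ƛ M) (labels μ M) (smaller lt) (smaller lt′) ⟩
      at (suc N′) M   ≈⟨ at-M N′ le′ ⟨
      at (suc N′) L′  ∎
      where
      smaller : ∀ {N} → part ƛ 0 < N → sum (labels ƛ M) < N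
      smaller = ℕ.≤-trans (s≤s (ℕ.≤-reflexive (sum-labels ƛ (ℕ.m≤m⊔n (ℓ ƛ) (ℓ μ)))))

  -- The normalisation that survives the gauge. `F~*` carries it for its upper partition in the
  -- numerator and `𝔽` in the denominator, so the summation variable drops out of the prefactors.
  h : Seq → Partition → Carrier
  h S ƛ = negPow S ƛ * 𝖼 S ƛ

  ⁻¹-* : ∀ {x y} → x # 0# → y # 0# → (x * y) ⁻¹ ≈ x ⁻¹ * y ⁻¹
  ⁻¹-* {x} {y} x#0 y#0 = sym (⁻¹-unique (trans
    (solve 4 (λ x y i j → x :* y :* (i :* j) := (x :* i) :* (y :* j)) refl x y (x ⁻¹) (y ⁻¹))
    (trans (*-cong (⁻¹-inverse x#0) (⁻¹-inverse y#0)) (*-identityˡ 1#))))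

  private
    bits-unique : Unique bits
    bits-unique = ((λ ()) ∷ []) ∷ [] ∷ []

    ∉bits : ∀ {p} {P : ℕ → Set p} → (∀ l → P (suc (suc l))) → ∀ l → l ∉ bits → P l
    ∉bits f 0             l∉ = contradiction (here ≡.refl) l∉
    ∉bits f 1             l∉ = contradiction (there (here ≡.refl)) l∉
    ∉bits f (suc (suc l)) l∉ = f l

  ŵ-normalised : ∀ U y → (∀ i → U i # 1#) → Normalised (ŵ U y)
  ŵ-normalised U y U#1 i = trans (*-congʳ (+-congˡ (-‿cong (*-identityʳ (U i))))) (⁻¹-inverse (1-x#0 (U#1 i)))

  h#0 : ∀ {S} ƛ → (∀ i → S i # 0#) → (∀ i k → S (suc i) ^ 2 * q ^ k # 1#) → h S ƛ # 0#
  h#0 {S} ƛ S#0 s²qᵏ#1 = x*y#0 (negPow#0 {S} ƛ S#0) (𝖼#0 {S} ƛ s²qᵏ#1)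

  module _ {m} (u : Vector m) (Ξ S θ : Seq) (θS : ∀ i → θ i * S i ≈ Ξ i) (S#0 : ∀ i → S i # 0#)
    (s²qᵏ#1 : ∀ i k → S (suc i) ^ 2 * q ^ k # 1#) (Û#1 : ∀ j i → Û (u j) Ξ S θ i # 1#) where

    F-kernel : Fin m → Kernel
    F-kernel j = kernel (v-ŵ (u j) Ξ S θ) (ŵRow (u j) Ξ S θ)

    private
      F-descending : ∀ j → Descending (F-kernel j)
      F-descending j = kernel-descending {v-ŵ (u j) Ξ S θ} (ŵ-conservative _ _)

      F-stable : ∀ j → Stable (F-kernel j)
      F-stable j = kernel-stable {v-ŵ (u j) Ξ S θ} (ŵ-conservative _ _) (ŵ-normalised (Û (u j) Ξ S θ) (Ŷ (u j) Ξ S θ) (Û#1 j))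

      w-start : ∀ {L} j (ks is : Vec ℕ L) a → a ∉ bits → row (wRow (u j) Ξ S) a ks is ≈ 0#
      w-start j ks is = ∉bits {P = λ a → row (wRow (u j) Ξ S) a ks is ≈ 0#} (λ a → row-w-zero (u j) Ξ S a ks is)

    module _ (ƛ μ : Partition) where

      private
        N₀ C : ℕ
        N₀ = suc (part ƛ 0)
        C = columns ƛ μ
        top bot : Vec ℕ C
        top = labels ƛ C
        bot = labels μ C
        ƛ≤C : ℓ ƛ ≤ C
        ƛ≤C = ℕ.m≤n⇒m≤1+n (ℕ.m≤m⊔n (ℓ ƛ) (ℓ μ))
        μ≤C : ℓ μ ≤ C
        μ≤C = ℕ.m≤n⇒m≤1+n (ℕ.m≤n⊔m (ℓ ƛ) (ℓ μ))
        top<N₀ : sum top < N₀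
        top<N₀ = s≤s (ℕ.≤-reflexive (sum-labels ƛ ƛ≤C))

        f : Carrier
        f = ∑[ a ∈ words bits m ] (∏[ i < m ] ((- (u i * Ξ 0 * S 0)) ^ lookup a i)) * Zw a ƛ μ u Ξ S

        f-chain : f ≈ chain N₀ m (λ j → kernel (v-w (u j) Ξ S θ) (wRow (u j) Ξ S)) C top bot
        f-chain = trans
          (∑-cong-∈ (words bits m) (λ a a∈ → *-congˡ (latticeSum-chain bits-unique N₀
            (λ j c → w (u j * Ξ c) (S c)) (λ j → w-conservative (u j) Ξ S)
            (λ j c i k l b _ → ∉bits {P = λ b → wRow (u j) Ξ S c i k l b ≈ 0#} (λ b → w-zeroʳ (u j * Ξ (suc c)) (S (suc c)) i k l b) b)
            top bot a (∈-box⁺ top top<N₀) (∈-words⁻ a∈))))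
          (∑-fixedRows bits-unique N₀ (λ j → wRow (u j) Ξ S) (λ j → v-w (u j) Ξ S θ) (λ j → w-conservative (u j) Ξ S)
            (λ j ks is _ → w-start j ks is _) top bot top<N₀)

        gauge-h : ∀ ν → ℓ ν ≤ C → gauge S (labels ν C) ≈ negPow S ν * h S ν
        gauge-h ν le = trans (sym (*-cong (negPow² S ν le) (𝖼-γ S ν le))) (*-assoc _ _ _)

        f-gauge : chain N₀ m F-kernel C top bot * (negPow S ƛ * h S ƛ) ≈ f * (negPow S μ * h S μ)
        f-gauge = begin
          chain N₀ m F-kernel C top bot * (negPow S ƛ * h S ƛ)  ≈⟨ *-congˡ (gauge-h ƛ ƛ≤C) ⟨
          chain N₀ m F-kernel C top bot * gauge S top
            ≈⟨ chain-gauge N₀ m (gauge S) (λ j → kernel-gauge (u j) Ξ S θ θS s²qᵏ#1) C top bot ⟩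
          chain N₀ m (λ j → kernel (v-w (u j) Ξ S θ) (wRow (u j) Ξ S)) C top bot * gauge S bot
            ≈⟨ *-cong (sym f-chain) (gauge-h μ μ≤C) ⟩
          f * (negPow S μ * h S μ) ∎

      -- The factors `𝖼` in the definition of `F~*` cancel and leave n_μ / n_λ, with n for `negPow`.
      -- The gauge contributes n_λ² c_λ / (n_μ² c_μ), and the product of the two is the quotient of
      -- the `h`.
      F~*-chain : ∀ {N L} → part ƛ 0 < N → ℓ ƛ ⊔ ℓ μ ≤ L →
        F~* ƛ μ u Ξ S ≈ h S ƛ / h S μ * chain N m F-kernel L (labels ƛ L) (labels μ L)
      F~*-chain {N} {L} lt le = *-cancelˡ (x*y#0 nμ#0 (h#0 μ S#0 s²qᵏ#1)) (begin
        nμ * (nμ * cμ) * (cƛ / cμ * (nμ / nƛ * (cμ / cƛ) * f))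
          ≈⟨ solve 7 (λ nμ iƛ cμ cƛ jμ jƛ f →
               nμ :* (nμ :* cμ) :* (cƛ :* jμ :* (nμ :* iƛ :* (cμ :* jƛ) :* f))
               := (cƛ :* jƛ) :* (cμ :* jμ) :* (nμ :* iƛ) :* (f :* (nμ :* (nμ :* cμ))))
               refl nμ (nƛ ⁻¹) cμ cƛ (cμ ⁻¹) (cƛ ⁻¹) f ⟩
        (cƛ * cƛ ⁻¹) * (cμ * cμ ⁻¹) * (nμ * nƛ ⁻¹) * (f * (nμ * (nμ * cμ)))
          ≈⟨ *-cong (*-congʳ (*-cong (⁻¹-inverse cƛ#0) (⁻¹-inverse cμ#0))) (sym f-gauge) ⟩
        1# * 1# * (nμ * nƛ ⁻¹) * (D * (nƛ * (nƛ * cƛ)))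
          ≈⟨ solve 5 (λ nμ iƛ D nƛ cƛ → :1 :* :1 :* (nμ :* iƛ) :* (D :* (nƛ :* (nƛ :* cƛ)))
               := (nƛ :* iƛ) :* (nμ :* (nƛ :* cƛ) :* D)) refl nμ (nƛ ⁻¹) D nƛ cƛ ⟩
        (nƛ * nƛ ⁻¹) * (nμ * (nƛ * cƛ) * D)
          ≈⟨ *-congʳ (trans (⁻¹-inverse nƛ#0) (sym (⁻¹-inverse (h#0 μ S#0 s²qᵏ#1)))) ⟩
        (h S μ * h S μ ⁻¹) * (nμ * h S ƛ * D)
          ≈⟨ solve 5 (λ hμ jμ nμ hƛ D → (hμ :* jμ) :* (nμ :* hƛ :* D) := nμ :* hμ :* (hƛ :* jμ :* D)) refl (h S μ) (h S μ ⁻¹) nμ (h S ƛ) D ⟩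
        nμ * h S μ * (h S ƛ / h S μ * D)
          ≈⟨ *-congˡ (*-congˡ (chain-labels F-descending F-stable ƛ μ {N₀} {N} (ℕ.n<1+n _) lt (ℕ.n≤1+n _) le)) ⟩
        nμ * h S μ * (h S ƛ / h S μ * chain N m F-kernel L (labels ƛ L) (labels μ L)) ∎)
        where
        nƛ = negPow S ƛ
        nμ = negPow S μ
        cƛ = 𝖼 S ƛ
        cμ = 𝖼 S μ
        D = chain N₀ m F-kernel C top bot
        nƛ#0 = negPow#0 {S} ƛ S#0
        nμ#0 = negPow#0 {S} μ S#0
        cƛ#0 = 𝖼#0 {S} ƛ s²qᵏ#1
        cμ#0 = 𝖼#0 {S} μ s²qᵏ#1

  private
    module _ {p r} {P : Set p} {R : Set r} where

      if-×-yes : (P? : Dec P) (R? : Dec R) {x : Carrier} → P → R → (if does P? ∧ does R? then x else 0#) ≈ x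
      if-×-yes (yes _) (yes _) _ _ = refl
      if-×-yes (yes _) (no ¬r) _ r = contradiction r ¬r
      if-×-yes (no ¬p) _       p _ = contradiction p ¬p

      if-×-no : (P? : Dec P) (R? : Dec R) {x : Carrier} → ¬ (P × R) → (if does P? ∧ does R? then x else 0#) ≈ 0#
      if-×-no (yes p) (yes r) ¬pr = contradiction (p , r) ¬pr
      if-×-no (yes _) (no _)  _   = refl
      if-×-no (no _)  _       _   = refl

    W-zero : ∀ t² s² i j k l → ¬ (i ℕ.+ j ≡ k ℕ.+ l × l ≤ i) → W t² s² i j k l ≈ 0#
    W-zero t² s² i j k l = if-×-no (i ℕ.+ j ℕ.≟ k ℕ.+ l) (l ℕ.≤? i)

  -- The factors are regrouped by whether they depend on the bottom label, the right label or the
  -- difference of both. The quotient form of `x` serves the power and the symbols in s²/t², the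
  -- product form the symbol in s².
  W-Ŵ : ∀ {x T xTqᵏ#1 s²} c → x c ≈ s² / T c → x c * T c ≈ s² → ∀ i j k l →
        W (T c) s² i j k l ≈ Ŵ x T xTqᵏ#1 c i j k l
  W-Ŵ {x} {T} {xTqᵏ#1} {s²} c x≈ xT≈ i j k l with i ℕ.+ j ℕ.≟ k ℕ.+ l
  ... | no  neq = trans (W-zero (T c) s² i j k l (λ (eq , _) → neq eq)) (sym (if-no neq))
  ... | yes eq with l ℕ.≤? i
  ...   | no  l≰i = trans (W-zero (T c) s² i j k l (λ (_ , l≤i) → l≰i l≤i))
    (sym (trans (if-yes eq) (Weight.ω-> qᵏ#1 (x c) (T c) (xTqᵏ#1 c) (ℕ.≰⇒> l≰i))))
  ...   | yes l≤i = begin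
    W (T c) s² i j k l
      ≈⟨ if-×-yes (i ℕ.+ j ℕ.≟ k ℕ.+ l) (l ℕ.≤? i) eq l≤i ⟩
    (s² / T c) ^ l * ((poch (s² / T c) (i ∸ l) * poch (T c) l) / poch s² i) * (poch q i / (poch q (i ∸ l) * poch q l))
      ≈⟨ *-cong (*-cong (^-congˡ l (sym x≈)) (/-cong (*-congʳ (poch-cong (i ∸ l) (sym x≈))) (poch-cong i (sym xT≈))))
           (*-congˡ (⁻¹-* (poch#0 (i ∸ l) qᵏ#1) (poch#0 l qᵏ#1))) ⟩
    x c ^ l * (poch (x c) (i ∸ l) * poch (T c) l * poch (x c * T c) i ⁻¹) * (poch q i * (poch q (i ∸ l) ⁻¹ * poch q l ⁻¹))
      ≈⟨ solve 7 (λ xl px pT s qi qd ql → xl :* (px :* pT :* s) :* (qi :* (qd :* ql)) := (qi :* s) :* (xl :* (pT :* ql)) :* (px :* qd))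
           refl (x c ^ l) (poch (x c) (i ∸ l)) (poch (T c) l) (poch (x c * T c) i ⁻¹) (poch q i) (poch q (i ∸ l) ⁻¹) (poch q l ⁻¹) ⟩
    F i * G l * H (i ∸ l)
      ≡⟨ ≡.cong (λ d → F i * G l * H⁺ d) (≡.sym (ℕ.+-∸-assoc 1 l≤i)) ⟩
    F i * G l * H⁺ (suc i ∸ l)
      ≈⟨ ω-def i l ⟨
    ω i l
      ≈⟨ if-yes eq ⟨
    Ŵ x T xTqᵏ#1 c i j k l ∎
    where open Weight qᵏ#1 (x c) (T c) (xTqᵏ#1 c)

  Ŵ-normalised : ∀ x T xTqᵏ#1 → Normalised (Ŵ x T xTqᵏ#1)
  Ŵ-normalised x T xTqᵏ#1 c = trans (ω-def 0 0) (trans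
    (*-cong (*-cong (poch-ratio-zero q (x c * T c)) (trans (*-identityˡ _) (poch-ratio-zero (T c) q))) (poch-ratio-zero (x c) q))
    (trans (*-identityʳ _) (*-identityʳ _)))
    where open Weight qᵏ#1 (x c) (T c) (xTqᵏ#1 c)

  module _ {n} (κ : Vector n) (√Ξ √S : Seq) where

    private
      Ξ S : Seq
      Ξ = square √Ξ
      S = square √S

    tSeq : Fin n → Seq
    tSeq r c = (Ξ (suc (toℕ r) ℕ.+ suc c) * S (suc (toℕ r) ℕ.+ suc c)) / κ r

    sSeq : Fin n → Seq
    sSeq r c = τS (suc (toℕ r)) √Ξ √S (suc c) ^ 2

    v-W : Fin n → ℕ → Carrier
    v-W r a = (κ r * S 0 / Ξ 0) ^ a * (poch (κ r ⁻¹ * S (suc (toℕ r)) * Ξ (suc (toℕ r))) a / poch q a)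

    module _ (x : Fin n → Seq) (x≈ : ∀ r c → x r c ≈ sSeq r c / tSeq r c) (xt≈ : ∀ r c → x r c * tSeq r c ≈ sSeq r c)
      (xtqᵏ#1 : ∀ r c k → x r c * tSeq r c * q ^ k # 1#)
      (S#0 : ∀ i → S i # 0#) (s²qᵏ#1 : ∀ i k → S (suc i) ^ 2 * q ^ k # 1#) where

      𝔽-kernel : Fin n → Kernel
      𝔽-kernel r = kernel (v-W r) (Ŵ (x r) (tSeq r) (xtqᵏ#1 r))

      𝔽-descending : ∀ r → Descending (𝔽-kernel r)
      𝔽-descending r = kernel-descending {v-W r} (Ŵ-conservative (x r) (tSeq r) (xtqᵏ#1 r))

      private
        𝔽-stable : ∀ r → Stable (𝔽-kernel r)
        𝔽-stable r = kernel-stable {v-W r} (Ŵ-conservative (x r) (tSeq r) (xtqᵏ#1 r)) (Ŵ-normalised (x r) (tSeq r) (xtqᵏ#1 r))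

        wts : Fin n → Weights
        wts r c = W (tSeq r c) (sSeq r c)

      module _ (ƛ μ : Partition) where

        private
          N₀ C : ℕ
          N₀ = suc (part ƛ 0)
          C = columns ƛ μ
          top bot : Vec ℕ C
          top = labels ƛ C
          bot = labels μ C
          sum-top : sum top ≡ part ƛ 0
          sum-top = sum-labels ƛ (ℕ.m≤n⇒m≤1+n (ℕ.m≤m⊔n (ℓ ƛ) (ℓ μ)))
          sum-bot : sum bot ≡ part μ 0
          sum-bot = sum-labels μ (ℕ.m≤n⇒m≤1+n (ℕ.m≤n⊔m (ℓ ƛ) (ℓ μ)))
          top<N₀ : sum top < N₀
          top<N₀ = s≤s (ℕ.≤-reflexive sum-top)
          upTo! : Unique (upTo N₀)
          upTo! = Unique.upTo⁺ N₀

          wts-conservative : ∀ r → Conservative (wts r)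
          wts-conservative r c i j k l neq = W-zero (tSeq r c) (sSeq r c) i j k l (λ (eq , _) → neq eq)

          ZW-chain : ∀ a → a ∈ words (upTo N₀) n → ZW a ƛ μ κ √Ξ √S ≈ chain N₀ n (fixedRows upTo! N₀ wts a) C top bot
          ZW-chain a a∈ = latticeSum-chain upTo! N₀
            (λ r c → W ((Ξ (suc (toℕ r) ℕ.+ c) * S (suc (toℕ r) ℕ.+ c)) / κ r) (τS (suc (toℕ r)) √Ξ √S c ^ 2))
            wts-conservative
            (λ r c i j k l i∈ l∉ → W-zero (tSeq r c) (sSeq r c) i j k l
              (λ (_ , l≤i) → l∉ (∈-upTo⁺ (ℕ.≤-<-trans l≤i (∈-upTo⁻ i∈)))))
            top bot a (∈-box⁺ top top<N₀) (∈-words⁻ a∈)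

          p : Vec ℕ n → Carrier
          p a = ∏[ i < n ] v-W i (lookup a i)

          -- Conservation enforces the condition on the sum of the left labels by itself: for any
          -- other word the chain is zero, so the filter can be replaced by the full sum.
          unfilter : ∀ a → a ∈ words (upTo N₀) n → [ Vec.sum a ℕ.+ part μ 0 ℕ.≟ part ƛ 0 ] * (p a * ZW a ƛ μ κ √Ξ √S)
                     ≈ p a * chain N₀ n (fixedRows upTo! N₀ wts a) C top bot
          unfilter a a∈ with Vec.sum a ℕ.+ part μ 0 ℕ.≟ part ƛ 0
          ... | yes eq  = trans (*-congʳ ([]-yes (Vec.sum a ℕ.+ part μ 0 ℕ.≟ part ƛ 0) eq))
            (trans (*-identityˡ _) (*-congˡ (ZW-chain a a∈)))
          ... | no  neq = trans (0*u ([]-no (Vec.sum a ℕ.+ part μ 0 ℕ.≟ part ƛ 0) neq))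
            (sym (u*0 (fixedRows-balance upTo! N₀ wts wts-conservative top bot a
              (λ eq → neq (≡.trans (≡.cong (Vec.sum a ℕ.+_) (≡.sym sum-bot)) (≡.trans eq sum-top))))))

          g-chain : (∑[ a ∈ filter (λ a → Vec.sum a ℕ.+ part μ 0 ℕ.≟ part ƛ 0) (words (upTo N₀) n) ] p a * ZW a ƛ μ κ √Ξ √S)
                    ≈ chain N₀ n 𝔽-kernel C top bot
          g-chain = trans
            (∑-filter (λ a → Vec.sum a ℕ.+ part μ 0 ℕ.≟ part ƛ 0) (words (upTo N₀) n) _)
            (trans (∑-cong-∈ (words (upTo N₀) n) unfilter)
            (trans (∑-fixedRows upTo! N₀ wts v-W wts-conservative
                      (λ r ks is ks<N a∉ → contradiction (∈-upTo⁺ (ℕ.≤-<-trans (ℕ.m∸n≤m (sum ks) (sum is)) ks<N)) a∉)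
                      top bot top<N₀)
              (chain-cong N₀ n (λ r L ks is → *-congˡ (row-cong
                (λ c → W-Ŵ {x r} {tSeq r} {xtqᵏ#1 r} c (x≈ r c) (xt≈ r c)) (sum ks ∸ sum is) ks is)) C top bot)))

        𝔽-chain : ∀ {N L} → part ƛ 0 < N → ℓ ƛ ⊔ ℓ μ ≤ L →
          𝔽 ƛ μ κ √Ξ √S ≈ h (τS n √Ξ √S) μ / h S ƛ * chain N n 𝔽-kernel L (labels ƛ L) (labels μ L)
        𝔽-chain {N} {L} lt le = *-cong
          (begin
            nμ / nƛ * (cμ / cƛ)          ≈⟨ solve 4 (λ a b c d → a :* b :* (c :* d) := a :* c :* (b :* d)) refl nμ (nƛ ⁻¹) cμ (cƛ ⁻¹) ⟩
            nμ * cμ * (nƛ ⁻¹ * cƛ ⁻¹)    ≈⟨ *-congˡ (⁻¹-* (negPow#0 {S} ƛ S#0) (𝖼#0 {S} ƛ s²qᵏ#1)) ⟨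
            h (τS n √Ξ √S) μ / h S ƛ     ∎)
          (trans g-chain (chain-labels 𝔽-descending 𝔽-stable ƛ μ {N₀} {N} (ℕ.n<1+n _) lt (ℕ.n≤1+n _) le))
          where
          nƛ = negPow S ƛ
          nμ = negPow (τS n √Ξ √S) μ
          cƛ = 𝖼 S ƛ
          cμ = 𝖼 (τS n √Ξ √S) μ

-- Specialisation of the parameters and the Cauchy identity

module Cauchy {c ℓ₁ ℓ₂} (K : Field c ℓ₁ ℓ₂) (q : Field.Carrier K) where

  open Field K hiding (zero)
  open FieldProperties K
  open Functions K q
  open QWeights K q
  open Sums K q
  open Rows K q
  open Commutation K q
  open import Relation.Binary.Reasoning.Setoid setoid

  ∏-* : ∀ n (f g : Fin n → Carrier) → ∏ n (λ i → f i * g i) ≈ ∏ n f * ∏ n g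
  ∏-* zero    f g = sym (*-identityˡ 1#)
  ∏-* (suc n) f g = trans (*-congˡ (∏-* n (f ∘ Fin.suc) (g ∘ Fin.suc)))
    (solve 4 (λ a b c d → a :* b :* (c :* d) := a :* c :* (b :* d)) refl _ _ _ _)

  ∏-one : ∀ n → ∏ n (λ _ → 1#) ≈ 1#
  ∏-one zero    = refl
  ∏-one (suc n) = trans (*-identityˡ _) (∏-one n)

  ∏-swap : ∀ m n (f : Fin m → Fin n → Carrier) → ∏ m (λ j → ∏ n (f j)) ≈ ∏ n (λ i → ∏ m (λ j → f j i))
  ∏-swap zero    n f = sym (∏-one n)
  ∏-swap (suc m) n f = trans (*-congˡ (∏-swap m n (f ∘ Fin.suc))) (sym (∏-* n (f Fin.zero) _))

  module Parametrised (√Ξ √S : Seq) {n m} (κ : Vector n) (u : Vector m) (generic : Generic κ u √Ξ √S) where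

    open Generic generic
    open Zipper K q qᵏ#1
    open SingleExchange K q qᵏ#1
    open Gauge K q qᵏ#1
    open Reduction K q qᵏ#1

    Ξ S p ρ θ Ξₙ Sₙ : Seq
    Ξ = square √Ξ
    S = square √S
    p i = Ξ i * S i
    ρ i = S i / Ξ i
    θ i = Ξ i / S i
    Ξₙ = τΞ n √Ξ √S
    Sₙ = τS n √Ξ √S

    Ξ#0 : ∀ i → Ξ i # 0#
    Ξ#0 i = x*y#0 (√ξ#0 i) (√ξ#0 i)

    S#0 : ∀ i → S i # 0#
    S#0 i = x*y#0 (√s#0 i) (√s#0 i)

    θS : ∀ i → θ i * S i ≈ Ξ i
    θS i = x/y*y (S#0 i)

    θρ : ∀ i → θ i * ρ i ≈ 1#
    θρ i = begin
      Ξ i * S i ⁻¹ * (S i * Ξ i ⁻¹)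
        ≈⟨ solve 4 (λ x s i j → x :* j :* (s :* i) := (x :* i) :* (s :* j)) refl (Ξ i) (S i) (Ξ i ⁻¹) (S i ⁻¹) ⟩
      (Ξ i * Ξ i ⁻¹) * (S i * S i ⁻¹)  ≈⟨ *-cong (⁻¹-inverse (Ξ#0 i)) (⁻¹-inverse (S#0 i)) ⟩
      1# * 1#                          ≈⟨ *-identityˡ 1# ⟩
      1#                               ∎

    τS² : ∀ k i → τS k √Ξ √S i ^ 2 ≈ p (i ℕ.+ k) * ρ i
    τS² k i = begin
      (a * b * s * t ⁻¹) * ((a * b * s * t ⁻¹) * 1#)
        ≈⟨ solve 4 (λ a b s t → (a :* b :* s :* t) :* ((a :* b :* s :* t) :* :1) := b :* b :* (a :* a) :* (s :* s :* (t :* t))) refl a b s (t ⁻¹) ⟩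
      b * b * (a * a) * (s * s * (t ⁻¹ * t ⁻¹))
        ≈⟨ *-congˡ (*-congˡ (⁻¹-* (√ξ#0 i) (√ξ#0 i))) ⟨
      p (i ℕ.+ k) * ρ i ∎
      where
      a = √S (i ℕ.+ k)
      b = √Ξ (i ℕ.+ k)
      s = √S i
      t = √Ξ i

    τS*τΞ : ∀ k i → τS k √Ξ √S i * τΞ k √Ξ √S i ≈ p (i ℕ.+ k)
    τS*τΞ k i = begin
      (a * b * s * t ⁻¹) * (b * a * t * s ⁻¹)
        ≈⟨ solve 6 (λ a b s t j i → (a :* b :* s :* i) :* (b :* a :* t :* j) := (t :* i) :* (s :* j) :* (b :* b :* (a :* a)))
             refl a b s t (s ⁻¹) (t ⁻¹) ⟩
      (t * t ⁻¹) * (s * s ⁻¹) * p (i ℕ.+ k)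
        ≈⟨ *-congʳ (*-cong (⁻¹-inverse (√ξ#0 i)) (⁻¹-inverse (√s#0 i))) ⟩
      1# * 1# * p (i ℕ.+ k)
        ≈⟨ trans (*-congʳ (*-identityˡ 1#)) (*-identityˡ _) ⟩
      p (i ℕ.+ k) ∎
      where
      a = √S (i ℕ.+ k)
      b = √Ξ (i ℕ.+ k)
      s = √S i
      t = √Ξ i

    -- The shift leaves the ratio ξ/s unchanged. Together with `τS*τΞ` this identifies the w-row
    -- with shifted Ξ and S as the original row with `p` moved by `k` columns.
    θτS : ∀ k i → θ i * τS k √Ξ √S i ≈ τΞ k √Ξ √S i
    θτS k i = begin
      t * t * (s * s) ⁻¹ * (a * b * s * t ⁻¹)
        ≈⟨ *-congʳ (*-congˡ (⁻¹-* (√s#0 i) (√s#0 i))) ⟩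
      t * t * (s ⁻¹ * s ⁻¹) * (a * b * s * t ⁻¹)
        ≈⟨ solve 6 (λ a b s t j i → t :* t :* (j :* j) :* (a :* b :* s :* i) := (t :* i) :* (s :* j) :* (b :* a :* t :* j))
             refl a b s t (s ⁻¹) (t ⁻¹) ⟩
      (t * t ⁻¹) * (s * s ⁻¹) * τΞ k √Ξ √S i
        ≈⟨ *-congʳ (*-cong (⁻¹-inverse (√ξ#0 i)) (⁻¹-inverse (√s#0 i))) ⟩
      1# * 1# * τΞ k √Ξ √S i
        ≈⟨ trans (*-congʳ (*-identityˡ 1#)) (*-identityˡ _) ⟩
      τΞ k √Ξ √S i ∎
      where
      a = √S (i ℕ.+ k)
      b = √Ξ (i ℕ.+ k)
      s = √S i
      t = √Ξ i

    Sₙ#0 : ∀ i → Sₙ i # 0#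
    Sₙ#0 i = x*y#0 (x*y#0 (x*y#0 (√s#0 _) (√ξ#0 _)) (√s#0 i)) (x⁻¹#0 (√ξ#0 i))

    p#0 : ∀ i → p i # 0#
    p#0 i = x*y#0 (Ξ#0 i) (S#0 i)

    up#1 : ∀ j i → u j * p (suc i) # 1#
    up#1 j i = #-congʳ (*-assoc _ _ _) (uξs#1 j i)

    -- The quotient s²/t² of the W-vertex: the factor p_(r+c) cancels, and what remains is κ times
    -- s/ξ of the column. This is why y x = u κ has the same value in every column.
    x : Fin n → Seq
    x r i = κ r * ρ (suc i)

    t : Fin n → Seq
    t = tSeq κ √Ξ √S

    xt≈p : ∀ r i → x r i * t r i ≈ ρ (suc i) * p (suc (toℕ r) ℕ.+ suc i)
    xt≈p r i = begin
      κ r * ρ (suc i) * (p k * κ r ⁻¹)    ≈⟨ solve 4 (λ κ ρ p i → κ :* ρ :* (p :* i) := (κ :* i) :* (ρ :* p)) refl (κ r) (ρ (suc i)) (p k) (κ r ⁻¹) ⟩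
      (κ r * κ r ⁻¹) * (ρ (suc i) * p k)  ≈⟨ *-congʳ (⁻¹-inverse (κ#0 r)) ⟩
      1# * (ρ (suc i) * p k)              ≈⟨ *-identityˡ _ ⟩
      ρ (suc i) * p k                     ∎
      where k = suc (toℕ r) ℕ.+ suc i

    xt≈ : ∀ r i → x r i * t r i ≈ sSeq κ √Ξ √S r i
    xt≈ r i = begin
      x r i * t r i                               ≈⟨ xt≈p r i ⟩
      ρ (suc i) * p (suc (toℕ r) ℕ.+ suc i)       ≈⟨ *-comm _ _ ⟩
      p (suc (toℕ r) ℕ.+ suc i) * ρ (suc i)       ≡⟨ ≡.cong (λ k → p k * ρ (suc i)) (ℕ.+-comm (suc (toℕ r)) (suc i)) ⟩
      p (suc i ℕ.+ suc (toℕ r)) * ρ (suc i)       ≈⟨ τS² (suc (toℕ r)) (suc i) ⟨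
      sSeq κ √Ξ √S r i                            ∎

    x≈ : ∀ r i → x r i ≈ sSeq κ √Ξ √S r i / t r i
    x≈ r i = /-unique (x*y#0 (p#0 _) (x⁻¹#0 (κ#0 r))) (xt≈ r i)

    xtqᵏ#1 : ∀ r i k → x r i * t r i * q ^ k # 1#
    xtqᵏ#1 r i k = #-congʳ (*-congʳ (sym (xt≈ r i))) (shift-s²qᵏ#1 (suc (toℕ r)) i k)

    B : Fin n → Kernel
    B = 𝔽-kernel κ √Ξ √S x x≈ xt≈ xtqᵏ#1 S#0 s²qᵏ#1

    -- The recursion makes one more shift a composition with `suc` by definition, which is the form
    -- in which `exchange` returns the w-row.
    shifted : ℕ → Seq → Seq
    shifted zero    f = f
    shifted (suc r) f = shifted r f ∘ suc

    shifted-+ : ∀ r f i → shifted r f i ≡ f (r ℕ.+ i)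
    shifted-+ zero    f i = ≡.refl
    shifted-+ (suc r) f i = ≡.trans (shifted-+ r f (suc i)) (≡.cong f (ℕ.+-suc r i))

    U : Fin m → Seq
    U j i = u j * p (suc i)

    Y : Fin m → Seq
    Y j i = u j * θ (suc i)

    v-D : Fin m → ℕ → Carrier
    v-D j a = (- (u j * θ 0)) ^ a

    -- The w-row with parameter u j after it has passed r rows with weights W.
    D : Fin m → ℕ → Kernel
    D j r = kernel (v-D j) (ŵ (shifted r (U j)) (Y j))

    U-shifted : ∀ j r i → shifted r (U j) i ≈ u j * p (suc (r ℕ.+ i))
    U-shifted j r i = reflexive (shifted-+ r (U j) i)

    parameters : Fin n → Fin m → Parameters
    parameters r j = record
      { x = x r ; T = t r ; y = Y j ; Ω = shifted (toℕ r) (U j) ; v = u j * κ r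
      ; xTqᵏ#1 = xtqᵏ#1 r
      ; Ω-suc = λ i → begin
          shifted (toℕ r) (U j) (suc i)            ≈⟨ U-shifted j (toℕ r) (suc i) ⟩
          u j * p (suc (toℕ r) ℕ.+ suc i)          ≈⟨ *-identityʳ _ ⟨
          u j * p (suc (toℕ r) ℕ.+ suc i) * 1#     ≈⟨ *-congˡ (θρ (suc i)) ⟨
          u j * p (suc (toℕ r) ℕ.+ suc i) * (θ (suc i) * ρ (suc i))
            ≈⟨ solve 4 (λ u p θ ρ → u :* p :* (θ :* ρ) := u :* θ :* (ρ :* p)) refl (u j) (p (suc (toℕ r) ℕ.+ suc i)) (θ (suc i)) (ρ (suc i)) ⟩
          Y j i * (ρ (suc i) * p (suc (toℕ r) ℕ.+ suc i))  ≈⟨ *-congˡ (xt≈p r i) ⟨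
          Y j i * (x r i * t r i)                  ∎
      ; v≈yx = λ i → begin
          u j * κ r                                ≈⟨ *-identityʳ _ ⟨
          u j * κ r * 1#                           ≈⟨ *-congˡ (θρ (suc i)) ⟨
          u j * κ r * (θ (suc i) * ρ (suc i))
            ≈⟨ solve 4 (λ u κ θ ρ → u :* κ :* (θ :* ρ) := u :* θ :* (κ :* ρ)) refl (u j) (κ r) (θ (suc i)) (ρ (suc i)) ⟩
          Y j i * x r i                            ∎
      ; Ω#1 = λ i → #-congʳ (sym (U-shifted j (toℕ r) i)) (up#1 j (toℕ r ℕ.+ i))
      }

    -- The recursion of (b;q)_a / (q;q)_a with b = p_(r+1) / κ replaces 1 - q^(a+1) by 1 - b q^a,
    -- and the factors ξ₀/s₀ and s₀/ξ₀ of the two boundaries cancel. Both terms become multiples of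
    -- u κ (1 - b q^a) with opposite signs.
    boundary : ∀ r j a → let open Parameters (parameters r j) in
      v-D j 0 * v-W κ √Ξ √S r a * (v - Ω 0 * q ^ a) + v-D j 1 * v-W κ √Ξ √S r (suc a) * (1# - q ^ suc a) ≈ 0#
    boundary r j a = begin
      1# * (k ^ a * g a) * (u j * κ r - shifted (toℕ r) (U j) 0 * q ^ a) + - (u j * θ 0) * 1# * (k * k ^ a * g (suc a)) * (1# - q ^ suc a)
        ≈⟨ +-cong (*-congˡ (+-congˡ (-‿cong (*-congʳ Ω₀))))
             (solve 5 (λ d k K g z → d :* :1 :* (k :* K :* g) :* z := d :* k :* K :* (g :* z)) refl _ k (k ^ a) (g (suc a)) (1# - q ^ suc a)) ⟩
      1# * (k ^ a * g a) * (u j * κ r - u j * (κ r * b) * q ^ a) + - (u j * θ 0) * k * k ^ a * (g (suc a) * (1# - q ^ suc a))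
        ≈⟨ +-congˡ (*-cong (*-congʳ θk) (poch-ratio-suc qᵏ#1 a)) ⟩
      1# * (k ^ a * g a) * (u j * κ r - u j * (κ r * b) * q ^ a) + - (u j * κ r) * k ^ a * (g a * (1# - b * q ^ a))
        ≈⟨ solve 6 (λ K g u κ b Q → :1 :* (K :* g) :* (u :* κ :- u :* (κ :* b) :* Q) :+ :- (u :* κ) :* K :* (g :* (:1 :- b :* Q)) := :0)
             refl (k ^ a) (g a) (u j) (κ r) b (q ^ a) ⟩
      0# ∎
      where
      k b : Carrier
      k = κ r * S 0 / Ξ 0
      b = κ r ⁻¹ * S (suc (toℕ r)) * Ξ (suc (toℕ r))
      g : ℕ → Carrier
      g = poch-ratio b q
      Ω₀ : shifted (toℕ r) (U j) 0 ≈ u j * (κ r * b)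
      Ω₀ = trans (U-shifted j (toℕ r) 0) (*-congˡ (trans (reflexive (≡.cong (p ∘ suc) (ℕ.+-identityʳ (toℕ r)))) (begin
        Ξ (suc (toℕ r)) * S (suc (toℕ r))  ≈⟨ *-identityˡ _ ⟨
        1# * p (suc (toℕ r))               ≈⟨ *-congʳ (⁻¹-inverse (κ#0 r)) ⟨
        κ r * κ r ⁻¹ * p (suc (toℕ r))     ≈⟨ solve 4 (λ κ i x s → κ :* i :* (x :* s) := κ :* (i :* s :* x)) refl (κ r) (κ r ⁻¹) (Ξ (suc (toℕ r))) (S (suc (toℕ r))) ⟩
        κ r * b                            ∎)))
      θk : - (u j * θ 0) * k ≈ - (u j * κ r)
      θk = begin
        - (u j * θ 0) * (κ r * S 0 * Ξ 0 ⁻¹)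
          ≈⟨ solve 5 (λ u θ κ s i → :- (u :* θ) :* (κ :* s :* i) := :- (u :* κ :* (θ :* (s :* i)))) refl (u j) (θ 0) (κ r) (S 0) (Ξ 0 ⁻¹) ⟩
        - (u j * κ r * (θ 0 * ρ 0))  ≈⟨ -‿cong (trans (*-congˡ (θρ 0)) (*-identityʳ _)) ⟩
        - (u j * κ r)                ∎

    factor : Fin n → Fin m → Carrier
    factor i j = (1# - u j * κ i) / (1# - u j * Ξ (suc (toℕ i)) * S (suc (toℕ i)))

    commute : ∀ {N L} r j c ν μ → c < L → ZeroFrom c μ → suc (suc (sum ν)) < N →
      (∑[ ƛ ∈ box N L ] (D j (toℕ r) L ƛ ν * B r L ƛ μ)) ≈ factor r j * (∑[ ƛ ∈ box N L ] (B r L ν ƛ * D j (suc (toℕ r)) L μ ƛ))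
    commute {N} {L} r j c ν μ c<L μ0 ν<N = *-cancelˡ 1-Ω#0 (begin
      (1# - Ω 0) * ∑ (box N L) (λ ƛ → D j (toℕ r) L ƛ ν * B r L ƛ μ)
        ≈⟨ exchange (parameters r j) (v-D j) (v-W κ √Ξ √S r) (boundary r j) N c ν μ c<L μ0 ν<N ⟩
      (1# - u j * κ r) * s
        ≈⟨ *-congʳ (x/y*y 1-Ω#0) ⟨
      (1# - u j * κ r) / (1# - Ω 0) * (1# - Ω 0) * s
        ≈⟨ solve 3 (λ f w s → f :* w :* s := w :* (f :* s)) refl _ _ _ ⟩
      (1# - Ω 0) * ((1# - u j * κ r) / (1# - Ω 0) * s)
        ≈⟨ *-congˡ (*-congʳ (*-congˡ (⁻¹-cong (+-congˡ (-‿cong Ω₀))))) ⟩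
      (1# - Ω 0) * (factor r j * s) ∎)
      where
      open Parameters (parameters r j) using (Ω; Ω#1)
      1-Ω#0 : 1# - Ω 0 # 0#
      1-Ω#0 = 1-x#0 (Ω#1 0)
      s : Carrier
      s = ∑ (box N L) (λ ƛ → B r L ν ƛ * D j (suc (toℕ r)) L μ ƛ)
      Ω₀ : Ω 0 ≈ u j * Ξ (suc (toℕ r)) * S (suc (toℕ r))
      Ω₀ = trans (U-shifted j (toℕ r) 0) (trans (reflexive (≡.cong (λ k → u j * p (suc k)) (ℕ.+-identityʳ (toℕ r)))) (sym (*-assoc _ _ _)))

    num-cong : ∀ {U U′ y y′} → U ≈ U′ → y ≈ y′ → ∀ g j l → num U y g j l ≈ num U′ y′ g j l
    num-cong U≈ y≈ g 0 0             = +-congˡ (-‿cong (*-congʳ U≈))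
    num-cong U≈ y≈ g 0 1             = -‿cong (+-cong y≈ (-‿cong (*-congʳ U≈)))
    num-cong U≈ y≈ g 0 (suc (suc l)) = refl
    num-cong U≈ y≈ g 1 0             = refl
    num-cong U≈ y≈ g 1 1             = +-congˡ (-‿cong y≈)
    num-cong U≈ y≈ g 1 (suc (suc l)) = refl
    num-cong U≈ y≈ g (suc (suc j)) l = refl

    ŵ-cong : ∀ {U U′ y y′} → (∀ i → U i ≈ U′ i) → (∀ i → y i ≈ y′ i) →
             ∀ c i j k l → ŵ U y c i j k l ≈ ŵ U′ y′ c i j k l
    ŵ-cong U≈ y≈ c i j k l with i ℕ.+ j ℕ.≟ k ℕ.+ l
    ... | yes eq  = trans (if-yes eq) (trans
      (/-cong (num-cong (U≈ c) (y≈ c) i j l) (+-congˡ (-‿cong (U≈ c)))) (sym (if-yes eq)))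
    ... | no  neq = trans (if-no neq) (sym (if-no neq))

    Û≈U : ∀ j i → Û (u j) Ξ S θ i ≈ U j i
    Û≈U j i = solve 3 (λ u x s → s :* (u :* x) := u :* (x :* s)) refl (u j) (Ξ (suc i)) (S (suc i))

    Ûₙ≈ : ∀ j i → Û (u j) Ξₙ Sₙ θ i ≈ u j * p (suc (i ℕ.+ n))
    Ûₙ≈ j i = trans (solve 3 (λ u x s → s :* (u :* x) := u :* (s :* x)) refl (u j) (Ξₙ (suc i)) (Sₙ (suc i)))
      (*-congˡ (τS*τΞ n (suc i)))

    Û#1 : ∀ j i → Û (u j) Ξ S θ i # 1#
    Û#1 j i = #-congʳ (sym (Û≈U j i)) (up#1 j i)

    Ûₙ#1 : ∀ j i → Û (u j) Ξₙ Sₙ θ i # 1#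
    Ûₙ#1 j i = #-congʳ (sym (Ûₙ≈ j i)) (up#1 j (i ℕ.+ n))

    E Eₙ : Fin m → Kernel
    E j = D j 0
    Eₙ j = D j n

    F-chain : ∀ {N L} ƛ ν → part ƛ 0 < N → ℓ ƛ ⊔ ℓ ν ≤ L →
              F~* ƛ ν u Ξ S ≈ h S ƛ / h S ν * chain N m E L (labels ƛ L) (labels ν L)
    F-chain {N} {L} ƛ ν lt le = trans (F~*-chain u Ξ S θ θS S#0 s²qᵏ#1 Û#1 ƛ ν lt le)
      (*-congˡ (chain-cong N m (λ j L ks is → *-congˡ (row-cong (ŵ-cong (Û≈U j) (λ i → refl)) _ ks is)) L _ _))

    Fₙ-chain : ∀ {N L} ƛ ν → part ƛ 0 < N → ℓ ƛ ⊔ ℓ ν ≤ L →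
               F~* ƛ ν u Ξₙ Sₙ ≈ h Sₙ ƛ / h Sₙ ν * chain N m Eₙ L (labels ƛ L) (labels ν L)
    Fₙ-chain {N} {L} ƛ ν lt le = trans (F~*-chain u Ξₙ Sₙ θ (θτS n) Sₙ#0 (λ i k → shift-s²qᵏ#1 n i k) Ûₙ#1 ƛ ν lt le)
      (*-congˡ (chain-cong N m (λ j L ks is → *-congˡ (row-cong (ŵ-cong
        (λ i → trans (Ûₙ≈ j i) (trans (reflexive (≡.cong (λ k → u j * p (suc k)) (ℕ.+-comm i n))) (sym (U-shifted j n i))))
        (λ i → refl)) _ ks is)) L _ _))

    𝔽-chain′ : ∀ {N L} ƛ μ → part ƛ 0 < N → ℓ ƛ ⊔ ℓ μ ≤ L →
               𝔽 ƛ μ κ √Ξ √S ≈ h Sₙ μ / h S ƛ * chain N n B L (labels ƛ L) (labels μ L)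
    𝔽-chain′ ƛ μ lt le = 𝔽-chain κ √Ξ √S x x≈ xt≈ xtqᵏ#1 S#0 s²qᵏ#1 ƛ μ lt le

    B-descending : ∀ r → Descending (B r)
    B-descending = 𝔽-descending κ √Ξ √S x x≈ xt≈ xtqᵏ#1 S#0 s²qᵏ#1

    B-lengthBounded : ∀ r → LengthBounded 1 (B r)
    B-lengthBounded r = kernel-lengthBounded {v-W κ √Ξ √S r}
      (Ŵ-conservative (x r) (t r) (xtqᵏ#1 r)) (Ŵ-rightBounded (x r) (t r) (xtqᵏ#1 r))

    D-growing : ∀ j r → Growing (D j r)
    D-growing j r = kernel-ŵ-growing (v-D j) (shifted r (U j)) (Y j)

    D-descending : ∀ j r → Descending (D j r)
    D-descending j r = kernel-descending {v-D j} (ŵ-conservative (shifted r (U j)) (Y j))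

    commute-chains : ∀ {N L} c ν μ → n ℕ.+ c ≤ L → ZeroFrom c μ → suc (m ℕ.+ sum ν) < N → sum μ < N →
      (∑[ ƛ ∈ box N L ] (chain N m E L ƛ ν * chain N n B L ƛ μ)) ≈
      (∏[ i < n ] ∏[ j < m ] factor i j) * (∑[ ƛ ∈ box N L ] (chain N n B L ν ƛ * chain N m Eₙ L μ ƛ))
    commute-chains {N} {L} c ν μ le μ0 ν<N μ<N = trans
      (commute-columns N c L (chain N n B L) m E Eₙ (λ j → ∏[ i < n ] factor i j)
        (λ j → D-growing j 0) (λ j → D-descending j n)
        (λ j → commute-rows N c L n B (D j) (λ i → factor i j) B-descending B-lengthBounded
          (λ r → commute r j) le)
        ν μ μ0 ν<N μ<N)
      (*-congʳ (∏-swap m n (λ j i → factor i j)))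

    module _ (ƛ μ : Partition) where

      private
        L′ : ℕ
        L′ = ℓ ƛ ⊔ ℓ μ
        ℓƛ≤ : ℓ ƛ ≤ L′
        ℓƛ≤ = ℕ.m≤m⊔n (ℓ ƛ) (ℓ μ)
        ℓμ≤ : ℓ μ ≤ L′
        ℓμ≤ = ℕ.m≤n⊔m (ℓ ƛ) (ℓ μ)
        N′ : ℕ
        N′ = suc (part ƛ 0)
        top bot : Vec ℕ L′
        top = labels ƛ L′
        bot = labels μ L′

      -- Each of the m w-rows receives at most one unit from the left.
      F-vanishes : ¬ (part ƛ 0 ≤ m ℕ.+ part μ 0) → F~* ƛ μ u Ξ S ≈ 0#
      F-vanishes ≰m+μ = Sum.[ (λ chain≈0 → trans (F-chain ƛ μ ℕ.≤-refl ℕ.≤-refl) (u*0 chain≈0))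
        , (λ le → contradiction (≡.subst₂ (λ a b → a ≤ m ℕ.+ b) (sum-labels ƛ ℓƛ≤) (sum-labels μ ℓμ≤) le) ≰m+μ) ]′
        (chain-growing N′ m (λ j → D-growing j 0) L′ top bot)

      -- Each of the n W-rows lengthens the partition by at most one part. This bounds the length in
      -- the left-hand sum, whereas `F-vanishes` bounds the first part.
      𝔽-vanishes : ¬ (ℓ ƛ ≤ n ℕ.+ ℓ μ) → 𝔽 ƛ μ κ √Ξ √S ≈ 0#
      𝔽-vanishes ≰n+μ = Sum.[ (λ chain≈0 → trans (𝔽-chain′ ƛ μ ℕ.≤-refl ℕ.≤-refl) (u*0 chain≈0))
        , (λ ƛ0 → contradiction (ZeroFrom⇒ℓ≤ ƛ (n ℕ.+ ℓ μ) ℓƛ≤ ƛ0) ≰n+μ) ]′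
        (chain-lengthBounded N′ n B-lengthBounded L′ (ℓ μ) top bot (labels-ZeroFrom μ L′))

      𝔽-vanishes′ : ¬ (part μ 0 ≤ part ƛ 0 × ℓ μ ≤ ℓ ƛ) → 𝔽 ƛ μ κ √Ξ √S ≈ 0#
      𝔽-vanishes′ ⋢ = Sum.[ (λ chain≈0 → trans (𝔽-chain′ ƛ μ ℕ.≤-refl ℕ.≤-refl) (u*0 chain≈0))
        , (λ μ⊑ƛ → contradiction
            (≡.subst₂ _≤_ (sum-labels μ ℓμ≤) (sum-labels ƛ ℓƛ≤) (⊑⇒sum≤ bot top μ⊑ƛ)
            , ZeroFrom⇒ℓ≤ μ (ℓ ƛ) ℓμ≤ (⊑-ZeroFrom (ℓ ƛ) bot top μ⊑ƛ (labels-ZeroFrom ƛ L′))) ⋢) ]′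
        (chain-descending N′ n B-descending L′ top bot)

    -- The bounds on `L` and `N` place every contributing λ in the box: on the left λ₁ ≤ m + ν₁ and
    -- l(λ) ≤ n + l(μ), on the right λ is contained in ν. They also leave the room that
    -- `commute-chains` requires.
    module Boxed (μ ν : Partition) (N L : ℕ) (n+μ≤L : n ℕ.+ ℓ μ ≤ L) (ν≤L : ℓ ν ≤ L)
      (m+ν<N : suc (m ℕ.+ part ν 0) < N) (μ<N : part μ 0 < N) where

      private
        μ≤L : ℓ μ ≤ L
        μ≤L = ℕ.≤-trans (ℕ.m≤n+m (ℓ μ) n) n+μ≤L
        ν<N : part ν 0 < N
        ν<N = ℕ.≤-trans (s≤s (ℕ.m≤n+m (part ν 0) m)) (ℕ.<⇒≤ m+ν<N)
        νL μL : Vec ℕ L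
        νL = labels ν L
        μL = labels μ L
        const : Carrier
        const = h Sₙ μ / h S ν

        support : List Partition
        support = List.map fromLabels (box N L)

        support-unique : Unique support
        support-unique = Unique.map⁺ (λ {v} {w} eq → ≡.trans (≡.sym (labels-fromLabels v))
          (≡.trans (≡.cong (λ ƛ → labels ƛ L) eq) (labels-fromLabels w))) (box-unique N L)

        ∈-support : ∀ ƛ → ℓ ƛ ≤ L → part ƛ 0 < N → ƛ ∈ support
        ∈-support ƛ ℓ≤ <N = ≡.subst (_∈ support) (fromLabels-labels ƛ ℓ≤)
          (∈-map⁺ fromLabels (∈-box⁺ (labels ƛ L) (≡.subst (_< N) (≡.sym (sum-labels ƛ ℓ≤)) <N)))

        f g : Partition → Carrier
        f ƛ = F~* ƛ ν u Ξ S * 𝔽 ƛ μ κ √Ξ √S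
        g ƛ = 𝔽 ν ƛ κ √Ξ √S * F~* μ ƛ u Ξₙ Sₙ

        f-vanishes : ∀ ƛ → ƛ ∉ support → f ƛ ≈ 0#
        f-vanishes ƛ ƛ∉ = go (part ƛ 0 ℕ.≤? m ℕ.+ part ν 0) (ℓ ƛ ℕ.≤? n ℕ.+ ℓ μ)
          where
          go : Dec (part ƛ 0 ≤ m ℕ.+ part ν 0) → Dec (ℓ ƛ ≤ n ℕ.+ ℓ μ) → f ƛ ≈ 0#
          go (no ≰m+ν) _          = 0*u (F-vanishes ƛ ν ≰m+ν)
          go (yes _)   (no ≰n+μ)  = u*0 (𝔽-vanishes ƛ μ ≰n+μ)
          go (yes le)  (yes ℓ≤)   = contradiction (∈-support ƛ (ℕ.≤-trans ℓ≤ n+μ≤L) (ℕ.≤-<-trans le (ℕ.<-trans (ℕ.n<1+n _) m+ν<N))) ƛ∉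

        g-vanishes : ∀ ƛ → ƛ ∉ support → g ƛ ≈ 0#
        g-vanishes ƛ ƛ∉ = 0*u (𝔽-vanishes′ ν ƛ
          (λ (le , ℓ≤) → ƛ∉ (∈-support ƛ (ℕ.≤-trans ℓ≤ ν≤L) (ℕ.≤-<-trans le ν<N))))

        simplify : ∀ {a b c x y} → a # 0# → b / a * x * (a / c * y) ≈ b / c * (x * y)
        simplify {a} {b} {c} {x} {y} a#0 = begin
          b * a ⁻¹ * x * (a * c ⁻¹ * y)
            ≈⟨ solve 6 (λ a b i j x y → b :* i :* x :* (a :* j :* y) := (a :* i) :* (b :* j :* (x :* y))) refl a b (a ⁻¹) (c ⁻¹) x y ⟩
          (a * a ⁻¹) * (b * c ⁻¹ * (x * y))  ≈⟨ *-congʳ (⁻¹-inverse a#0) ⟩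
          1# * (b * c ⁻¹ * (x * y))          ≈⟨ *-identityˡ _ ⟩
          b * c ⁻¹ * (x * y)                 ∎

        -- The box also holds vectors with sum `N` or more, for which the chain description of the
        -- functions is not at hand. For these both sides vanish, because m w-rows cannot raise ν₁
        -- so far.
        f-box : ∀ v → f (fromLabels v) ≈ const * (chain N m E L v νL * chain N n B L v μL)
        f-box v = go (sum v ℕ.<? N)
          where
          ƛ : Partition
          ƛ = fromLabels v
          ƛ≤L : ℓ ƛ ≤ L
          ƛ≤L = ℓ-fromLabels v
          too-large : sum v ≤ m ℕ.+ part ν 0 → sum v < N
          too-large le = ℕ.≤-<-trans le (ℕ.<-trans (ℕ.n<1+n _) m+ν<N)
          chain≈0 : ¬ (sum v < N) → chain N m E L v νL ≈ 0#
          chain≈0 v≮N = Sum.[ (λ eq → eq)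
            , (λ le → contradiction (too-large (≡.subst (λ s → sum v ≤ m ℕ.+ s) (sum-labels ν ν≤L) le)) v≮N) ]′
            (chain-growing N m (λ j → D-growing j 0) L v νL)
          small : part ƛ 0 < N → f ƛ ≈ const * (chain N m E L v νL * chain N n B L v μL)
          small ƛ<N = begin
            F~* ƛ ν u Ξ S * 𝔽 ƛ μ κ √Ξ √S
              ≈⟨ *-cong (F-chain ƛ ν ƛ<N (ℕ.⊔-lub ƛ≤L ν≤L)) (𝔽-chain′ ƛ μ ƛ<N (ℕ.⊔-lub ƛ≤L μ≤L)) ⟩
            h S ƛ / h S ν * chain N m E L (labels ƛ L) νL * (h Sₙ μ / h S ƛ * chain N n B L (labels ƛ L) μL)
              ≈⟨ *-comm _ _ ⟩
            h Sₙ μ / h S ƛ * chain N n B L (labels ƛ L) μL * (h S ƛ / h S ν * chain N m E L (labels ƛ L) νL)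
              ≈⟨ simplify (h#0 {S} ƛ S#0 s²qᵏ#1) ⟩
            const * (chain N n B L (labels ƛ L) μL * chain N m E L (labels ƛ L) νL)
              ≈⟨ *-congˡ (*-comm _ _) ⟩
            const * (chain N m E L (labels ƛ L) νL * chain N n B L (labels ƛ L) μL)
              ≡⟨ ≡.cong (λ v → const * (chain N m E L v νL * chain N n B L v μL)) (labels-fromLabels v) ⟩
            const * (chain N m E L v νL * chain N n B L v μL) ∎
          go : Dec (sum v < N) → f ƛ ≈ const * (chain N m E L v νL * chain N n B L v μL)
          go (yes v<N) = small (≡.subst (_< N) (≡.sym (toParts-entry v)) v<N)
          go (no v≮N)  = trans (0*u (F-vanishes ƛ ν (λ le → v≮N (too-large (≡.subst (_≤ m ℕ.+ part ν 0) (toParts-entry v) le)))))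
            (sym (u*0 (0*u (chain≈0 v≮N))))

        g-box : ∀ v → g (fromLabels v) ≈ const * (chain N n B L νL v * chain N m Eₙ L μL v)
        g-box v = begin
          𝔽 ν ƛ κ √Ξ √S * F~* μ ƛ u Ξₙ Sₙ
            ≈⟨ *-cong (𝔽-chain′ ν ƛ ν<N (ℕ.⊔-lub ν≤L ƛ≤L)) (Fₙ-chain μ ƛ μ<N (ℕ.⊔-lub μ≤L ƛ≤L)) ⟩
          h Sₙ ƛ / h S ν * chain N n B L νL (labels ƛ L) * (h Sₙ μ / h Sₙ ƛ * chain N m Eₙ L μL (labels ƛ L))
            ≈⟨ *-comm _ _ ⟩
          h Sₙ μ / h Sₙ ƛ * chain N m Eₙ L μL (labels ƛ L) * (h Sₙ ƛ / h S ν * chain N n B L νL (labels ƛ L))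
            ≈⟨ simplify (h#0 {Sₙ} ƛ Sₙ#0 (shift-s²qᵏ#1 n)) ⟩
          const * (chain N m Eₙ L μL (labels ƛ L) * chain N n B L νL (labels ƛ L))
            ≈⟨ *-congˡ (*-comm _ _) ⟩
          const * (chain N n B L νL (labels ƛ L) * chain N m Eₙ L μL (labels ƛ L))
            ≡⟨ ≡.cong (λ v → const * (chain N n B L νL v * chain N m Eₙ L μL v)) (labels-fromLabels v) ⟩
          const * (chain N n B L νL v * chain N m Eₙ L μL v) ∎
          where
          ƛ : Partition
          ƛ = fromLabels v
          ƛ≤L : ℓ ƛ ≤ L
          ƛ≤L = ℓ-fromLabels v

        f-sum : ∑ support f ≈ const * ∑ (box N L) (λ v → chain N m E L v νL * chain N n B L v μL)
        f-sum = trans (∑-map fromLabels (box N L) f) (trans (∑-cong (box N L) f-box) (sym (*-∑ const (box N L) _)))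

        g-sum : ∑ support g ≈ const * ∑ (box N L) (λ v → chain N n B L νL v * chain N m Eₙ L μL v)
        g-sum = trans (∑-map fromLabels (box N L) g) (trans (∑-cong (box N L) g-box) (sym (*-∑ const (box N L) _)))

      boxed-identity : ∃₂ λ A B → IsFiniteSum f A × IsFiniteSum g B × A ≈ (∏[ i < n ] ∏[ j < m ] factor i j) * B
      boxed-identity = ∑ support f , ∑ support g
        , record { support = support ; unique = support-unique ; vanishes = f-vanishes ; total = refl }
        , record { support = support ; unique = support-unique ; vanishes = g-vanishes ; total = refl }
        , (begin
          ∑ support f
            ≈⟨ f-sum ⟩
          const * ∑ (box N L) (λ v → chain N m E L v νL * chain N n B L v μL)
            ≈⟨ *-congˡ (commute-chains (ℓ μ) νL μL n+μ≤L (labels-ZeroFrom μ L)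
                 (≡.subst (λ s → suc (m ℕ.+ s) < N) (≡.sym (sum-labels ν ν≤L)) m+ν<N)
                 (≡.subst (_< N) (≡.sym (sum-labels μ μ≤L)) μ<N)) ⟩
          const * ((∏[ i < n ] ∏[ j < m ] factor i j) * ∑ (box N L) (λ v → chain N n B L νL v * chain N m Eₙ L μL v))
            ≈⟨ solve 3 (λ c k s → c :* (k :* s) := k :* (c :* s)) refl _ _ _ ⟩
          (∏[ i < n ] ∏[ j < m ] factor i j) * (const * ∑ (box N L) (λ v → chain N n B L νL v * chain N m Eₙ L μL v))
            ≈⟨ *-congˡ g-sum ⟨
          (∏[ i < n ] ∏[ j < m ] factor i j) * ∑ support g ∎)

    cauchy-identity : ∀ μ ν → ∃₂ λ A B →
      IsFiniteSum (λ ƛ → F~* ƛ ν u Ξ S * 𝔽 ƛ μ κ √Ξ √S) A × IsFiniteSum (λ ƛ → 𝔽 ν ƛ κ √Ξ √S * F~* μ ƛ u Ξₙ Sₙ) B ×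
      A ≈ (∏[ i < n ] ∏[ j < m ] factor i j) * B
    -- Both bounds add up what the two sides of the identity require, in place of a maximum; the two
    -- successors give the strict inequalities on `N`.
    cauchy-identity μ ν = Boxed.boxed-identity μ ν (suc (suc (m ℕ.+ part ν 0 ℕ.+ part μ 0))) (n ℕ.+ ℓ μ ℕ.+ ℓ ν)
      (ℕ.m≤m+n (n ℕ.+ ℓ μ) (ℓ ν)) (ℕ.m≤n+m (ℓ ν) (n ℕ.+ ℓ μ))
      (s≤s (s≤s (ℕ.m≤m+n (m ℕ.+ part ν 0) (part μ 0))))
      (s≤s (ℕ.≤-trans (ℕ.m≤n+m (part μ 0) (m ℕ.+ part ν 0)) (ℕ.n≤1+n _)))

theorem5p10 :
  ∀ {c ℓ₁ ℓ₂} (K : Field c ℓ₁ ℓ₂) →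
  let open Field K in
  (q : Carrier) →
  let open Functions K q in
  (√Ξ √S : Seq) (n m : ℕ) → 1 ≤ n → 1 ≤ m →
  (κ : Vector n) (u : Vector m) →
  Generic κ u √Ξ √S →
  let Ξ = square √Ξ
      S = square √S in
  (μ ν : Partition) →
  ∃₂ λ A B →
    IsFiniteSum (λ ƛ → F~* ƛ ν u Ξ S * 𝔽 ƛ μ κ √Ξ √S) A ×
    IsFiniteSum (λ ƛ → 𝔽 ν ƛ κ √Ξ √S * F~* μ ƛ u (τΞ n √Ξ √S) (τS n √Ξ √S)) B ×
    A ≈ (∏[ i < n ] ∏[ j < m ]
           ((1# - u j * κ i)
             / (1# - u j * Ξ (suc (toℕ i)) * S (suc (toℕ i))))) * B
theorem5p10 K q √Ξ √S n m _ _ κ u generic = Cauchy.Parametrised.cauchy-identity K q √Ξ √S κ u generic
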